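{- Let $G$ be a $C_4$-free graph with minimum degree $k$, and suppose $p=p(k)$ satisfies $pk\to\infty$ as $k\to\infty$. Then with high probability (i.e. with probability tending to $1$ as $k\to\infty$) the random subgraph $G_p$ contains a cycle of length at least $(1-o(1))k^2$.
   Context: A graph is $C_4$-free if it contains no cycle of length $4$ as a (not necessarily induced) subgraph. For a finite graph $G$ and $p\in[0,1]$, $G_p$ is the random spanning subgraph of $G$ obtained by keeping each edge of $G$ independently with probability $p$. The statement is uniform over all such $G$: for every $\eta>0$, the probability that $G_p$ contains a cycle of length at least $(1-\eta)k^2$ tends to $1$ as $k\to\infty$.
   Formalization: The edge probability p(k) is taken to be a rational number in [0,1] for every k, rather than an arbitrary real number. -}

module Defs where

open import Data.Bool using (Bool; true; false; if_then_else_; _∧_; T)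
open import Data.Nat as ℕ using (ℕ; zero; suc)
open import Data.Fin using (Fin; toℕ; combine)
open import Data.List.Base using (allFin)
import Data.Nat.ListAction
open import Data.Vec as Vec using (Vec; []; _∷_; lookup)
open import Data.List as List using (List; []; _∷_; _++_; [_]; length; map; concatMap)
open import Data.List.Relation.Unary.Linked using (Linked)
open import Data.List.Relation.Unary.Unique.Propositional using (Unique)
open import Data.Integer using (+_)
open import Data.Rational as ℚ using (ℚ; 0ℚ; 1ℚ; _+_; _*_; _-_; _≤_)
open import Data.Product using (Σ; ∃; _×_; _,_)
open import Relation.Binary.PropositionalEquality using (_≡_; _≢_)
open import Relation.Nullary using (¬_; Dec; does)
open import Level using (0ℓ)
open import Relation.Unary using (Pred; Decidable)

ℕtoℚ : ℕ → ℚ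
ℕtoℚ k = (+ k) ℚ./ 1

record Graph (n : ℕ) : Set where
  field
    adj    : Fin n → Fin n → Bool
    sym    : ∀ u v → adj u v ≡ adj v u
    irrefl : ∀ v → adj v v ≡ false
open Graph public

deg : ∀ {n} → Graph n → Fin n → ℕ
deg {n} G v = Data.Nat.ListAction.sum (map (λ u → if adj G v u then 1 else 0) (allFin n))

MinDegree : ∀ {n} → Graph n → ℕ → Set
MinDegree G k = (∀ v → k ℕ.≤ deg G v) × ∃ (λ v → deg G v ≡ k)

C4Free : ∀ {n} → Graph n → Set
C4Free {n} G = ¬ Σ (Fin n) λ a → Σ (Fin n) λ b → Σ (Fin n) λ c → Σ (Fin n) λ d →
  a ≢ b × a ≢ c × a ≢ d × b ≢ c × b ≢ d × c ≢ d ×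
  T (adj G a b) × T (adj G b c) × T (adj G c d) × T (adj G d a)

Adj : ∀ {n} → (Fin n → Fin n → Bool) → Fin n → Fin n → Set
Adj A u v = T (A u v)

IsCycle : ∀ {n} → (Fin n → Fin n → Bool) → Fin n → List (Fin n) → Set
IsCycle A x xs = 3 ℕ.≤ suc (length xs) × Unique (x ∷ xs) × Linked (Adj A) (x ∷ xs ++ [ x ])

HasCycleAtLeast : ∀ {n} → (Fin n → Fin n → Bool) → ℚ → Set
HasCycleAtLeast {n} A L =
  Σ (Fin n) λ x → Σ (List (Fin n)) λ xs → IsCycle A x xs × L ≤ ℕtoℚ (suc (length xs))

-- Random subgraph model: one independent Bernoulli(p) coin for every ordered pair
-- (u , v) of vertices (n * n coins); the edge uv of G is kept iff the coin of the
-- pair (min , max) shows true.  Coins of non-edges / pairs (u , v) with u ≥ v are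
-- irrelevant, so the kept graph is distributed exactly as G_p.
Coins : ℕ → Set
Coins n = Vec Bool (n ℕ.* n)

coin : ∀ {n} → Coins n → Fin n → Fin n → Bool
coin c u v = if toℕ u ℕ.<ᵇ toℕ v then lookup c (combine u v) else lookup c (combine v u)

subgraph : ∀ {n} → Graph n → Coins n → Fin n → Fin n → Bool
subgraph G c u v = adj G u v ∧ coin c u v

allVecs : (m : ℕ) → List (Vec Bool m)
allVecs zero = [] ∷ []
allVecs (suc m) = concatMap (λ v → (true ∷ v) ∷ (false ∷ v) ∷ []) (allVecs m)

weight : ∀ {m} → ℚ → Vec Bool m → ℚ
weight p [] = 1ℚ
weight p (b ∷ v) = (if b then p else 1ℚ - p) * weight p v

Pr : ∀ {m} → ℚ → {P : Pred (Vec Bool m) 0ℓ} → Decidable P → ℚ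
Pr {m} p dec = List.foldr _+_ 0ℚ (map (λ v → if does (dec v) then weight p v else 0ℚ) (allVecs m))

{-# OPTIONS --safe #-}
module Submission where

-- Explore G_p by depth-first search, revealing an edge only when the search needs it.  At most n
-- tests succeed, so by a supermartingale argument the expected number of tests is at most n/p, which
-- is o(kn); hence almost every vertex keeps (1 - o(1))k untested edges, and all untested edges join a
-- vertex to one of its ancestors in the search forest.  They are still independent, so any set
-- of many more than 1/p of them contains a kept one.  If some vertex has many untested edges spanning tree distance
-- L = (1 - η)k², one of them closes a long cycle.  Otherwise C₄-freeness (sets S and A with |A| < κ²
-- span at most κ(|S| + κ) edges) shows that few vertices have height below a small multiple of k²,
-- hence few have height below Ck², so almost every vertex has about d descendants within distance d.
-- Some branch of length Ck² then consists almost entirely of such vertices.  Each of its windows of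
-- length o(k²) sees less than κ² vertices within distance L below it, so it sends many untested edges
-- far up the branch.  A bounded number of overlapping kept edges of this kind, together with the
-- branch, form a cycle of length at least L.
--
-- Constants: k = (a + 7)r, κ = ar, L = ℓr² with ℓ = a² - 13, windows have length 2r²,
-- the branch has length (2ℓ + 4)r², and B bounds the reciprocal density of the exceptional vertices.

-- The number of tests is random, and so is the set of coins left over. Hence no distribution of the
-- search is ever formed: both the search and the final sprinkling are backward inductions on an
-- expectation conditional on the revealed coins. The value k² comes from the bound κ(|S| + κ): if
-- each vertex of S sends (a + 4)r edges into A, where κ = ar, then |S| is at most a²r/4, which is
-- far below the r² good vertices of a window. So the only escape from |A| ≤ κ² is to send edges far
-- away. The obstacle is that A must contain everything less than L below a window, including the
-- side subtrees, which one branch does not control. They are controlled on average: each vertex has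
-- at most d ancestors at distance less than d, so the mean number of descendants at distance less
-- than d is at most d. A tall vertex attains d on its own, so few vertices can exceed it
-- noticeably. This is why the tall vertices must be nearly all vertices before a branch can be
-- chosen.

module Probability where

  open import Data.Bool using (Bool; true; false; if_then_else_)
  open import Data.Nat as ℕ using (ℕ; zero; suc)
  import Data.Nat.Properties as ℕ
  import Data.Integer as ℤ
  import Data.Integer.Properties as ℤ
  open import Data.Nat.Coprimality as Coprime using (1-coprimeTo)
  open import Data.Fin using (zero; suc)
  open import Data.List as List using (List; []; _∷_; length)
  open import Data.List.Relation.Unary.All as All using (All; []; _∷_)
  open import Data.List.Relation.Unary.AllPairs using ([]; _∷_)
  open import Data.List.Relation.Unary.Unique.Propositional using (Unique)
  open import Data.List.Relation.Unary.Any using (here; there)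
  open import Data.List.Membership.Propositional using (_∈_)
  open import Data.Maybe using (Maybe; just; nothing)
  open import Data.Product using (_×_; _,_; proj₁; proj₂)
  open import Data.Rational
  open import Data.Rational.Properties
  open import Data.Rational.Solver
  open import Data.Vec using (Vec; []; _∷_; lookup; replicate; _[_]≔_)
  open import Data.Vec.Properties using (lookup∘update′)
  open import Function using (_∘_)
  open import Relation.Binary.PropositionalEquality
  open import Relation.Unary using (Decidable; Pred)
  open import Relation.Nullary using (does)
  open import Level using (0ℓ)
  open import Defs using (allVecs; weight; Pr; ℕtoℚ)
  open +-*-Solver

  -- Expectations over partially revealed coins

  Revealed : ℕ → Set
  Revealed m = Vec (Maybe Bool) m

  -- The expectation conditional on the coins that have been revealed.
  E : ∀ {m} → ℚ → Revealed m → (Vec Bool m → ℚ) → ℚ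
  E p []            f = f []
  E p (just b ∷ σ)  f = E p σ (f ∘ (b ∷_))
  E p (nothing ∷ σ) f = p * E p σ (f ∘ (true ∷_)) + (1ℚ - p) * E p σ (f ∘ (false ∷_))

  -- The recursion of `E` reveals coordinates in order; a later coordinate is brought to the front
  -- by exchanging two averages.
  E-split : ∀ {m} p (σ : Revealed m) f i → lookup σ i ≡ nothing →
    E p σ f ≡ p * E p (σ [ i ]≔ just true) f + (1ℚ - p) * E p (σ [ i ]≔ just false) f
  E-split p (nothing ∷ σ) f zero    eq = refl
  E-split p (just b ∷ σ)  f (suc i) eq = E-split p σ (f ∘ (b ∷_)) i eq
  E-split p (nothing ∷ σ) f (suc i) eq
    rewrite E-split p σ (f ∘ (true ∷_)) i eq | E-split p σ (f ∘ (false ∷_)) i eq =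
    solve 6 (λ p q a b c d → p :* (p :* a :+ q :* b) :+ q :* (p :* c :+ q :* d)
                          := p :* (p :* a :+ q :* c) :+ q :* (p :* b :+ q :* d)) refl
      p (1ℚ - p) _ _ _ _

  E-complement : ∀ {m} p (σ : Revealed m) f g → (∀ c → f c + g c ≡ 1ℚ) → E p σ f + E p σ g ≡ 1ℚ
  E-complement p []            f g eq = eq []
  E-complement p (just b ∷ σ)  f g eq = E-complement p σ _ _ (eq ∘ (b ∷_))
  E-complement p (nothing ∷ σ) f g eq = begin
    p * a + (1ℚ - p) * b + (p * c + (1ℚ - p) * d)
      ≡⟨ solve 6 (λ p q a b c d → p :* a :+ q :* b :+ (p :* c :+ q :* d) := p :* (a :+ c) :+ q :* (b :+ d)) refl p (1ℚ - p) a b c d ⟩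
    p * (a + c) + (1ℚ - p) * (b + d)
      ≡⟨ cong₂ (λ x y → p * x + (1ℚ - p) * y) (E-complement p σ _ _ (eq ∘ (true ∷_))) (E-complement p σ _ _ (eq ∘ (false ∷_))) ⟩
    p * 1ℚ + (1ℚ - p) * 1ℚ
      ≡⟨ solve 1 (λ p → p :* con 1ℚ :+ (con 1ℚ :- p) :* con 1ℚ := con 1ℚ) refl p ⟩
    1ℚ ∎
    where
    open ≡-Reasoning
    a b c d : ℚ
    a = E p σ (f ∘ (true ∷_))
    b = E p σ (f ∘ (false ∷_))
    c = E p σ (g ∘ (true ∷_))
    d = E p σ (g ∘ (false ∷_))

  Consistent : ∀ {m} → Revealed m → Vec Bool m → Set
  Consistent σ c = ∀ i {b} → lookup σ i ≡ just b → lookup c i ≡ b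

  -- `E` averages over the completions of `σ` only. Success enters here: once the revealed coins
  -- contain a long cycle, the failure indicator is zero on every completion.
  E-zero : ∀ {m} p (σ : Revealed m) f → (∀ c → Consistent σ c → f c ≡ 0ℚ) → E p σ f ≡ 0ℚ
  E-zero p []            f f≡0 = f≡0 [] λ ()
  E-zero p (just b ∷ σ)  f f≡0 = E-zero p σ _ λ c cons → f≡0 (b ∷ c) λ { zero refl → refl ; (suc i) eq → cons i eq }
  E-zero p (nothing ∷ σ) f f≡0
    rewrite E-zero p σ (f ∘ (true ∷_)) (λ c cons → f≡0 (true ∷ c) λ { (suc i) eq → cons i eq })
          | E-zero p σ (f ∘ (false ∷_)) (λ c cons → f≡0 (false ∷ c) λ { (suc i) eq → cons i eq }) =
    solve 1 (λ p → p :* con 0ℚ :+ (con 1ℚ :- p) :* con 0ℚ := con 0ℚ) refl p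

  module _ {A : Set} where

    sumℚ : (A → ℚ) → List A → ℚ
    sumℚ g xs = List.foldr _+_ 0ℚ (List.map g xs)

    sumℚ-linear : ∀ a b g h {k : A → ℚ} → (∀ x → k x ≡ a * g x + b * h x) → ∀ xs → sumℚ k xs ≡ a * sumℚ g xs + b * sumℚ h xs
    sumℚ-linear a b g h eq [] = solve 2 (λ a b → con 0ℚ := a :* con 0ℚ :+ b :* con 0ℚ) refl a b
    sumℚ-linear a b g h eq (x ∷ xs) = trans (cong₂ _+_ (eq x) (sumℚ-linear a b g h eq xs))
      (solve 6 (λ a b g h G H → a :* g :+ b :* h :+ (a :* G :+ b :* H) := a :* (g :+ G) :+ b :* (h :+ H)) refl a b (g x) (h x) _ _)

  sumℚ-pairs : ∀ {A B : Set} (g : B → ℚ) (s t : A → B) xs →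
    sumℚ g (List.concatMap (λ x → s x ∷ t x ∷ []) xs) ≡ sumℚ (λ x → g (s x) + g (t x)) xs
  sumℚ-pairs g s t []       = refl
  sumℚ-pairs g s t (x ∷ xs) = trans (cong (λ z → g (s x) + (g (t x) + z)) (sumℚ-pairs g s t xs)) (sym (+-assoc (g (s x)) _ _))

  sum-weights : ∀ m p (b : Vec Bool m → Bool) →
    sumℚ (λ v → if b v then weight p v else 0ℚ) (allVecs m) ≡ E p (replicate m nothing) (λ v → if b v then 1ℚ else 0ℚ)
  sum-weights zero p b with b []
  ... | true  = refl
  ... | false = refl
  sum-weights (suc m) p b = begin
    sumℚ k (allVecs (suc m))
      ≡⟨ sumℚ-pairs k (true ∷_) (false ∷_) (allVecs m) ⟩
    sumℚ (λ v → k (true ∷ v) + k (false ∷ v)) (allVecs m)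
      ≡⟨ sumℚ-linear p (1ℚ - p) (λ v → if b (true ∷ v) then weight p v else 0ℚ) (λ v → if b (false ∷ v) then weight p v else 0ℚ)
           (λ v → cong₂ _+_ (if-* p (weight p v) (b (true ∷ v))) (if-* (1ℚ - p) (weight p v) (b (false ∷ v)))) (allVecs m) ⟩
    p * sumℚ (λ v → if b (true ∷ v) then weight p v else 0ℚ) (allVecs m)
      + (1ℚ - p) * sumℚ (λ v → if b (false ∷ v) then weight p v else 0ℚ) (allVecs m)
      ≡⟨ cong₂ (λ x y → p * x + (1ℚ - p) * y) (sum-weights m p (b ∘ (true ∷_))) (sum-weights m p (b ∘ (false ∷_))) ⟩
    _ ∎
    where
    open ≡-Reasoning
    k : Vec Bool (suc m) → ℚ
    k v = if b v then weight p v else 0ℚ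
    if-* : ∀ q x c → (if c then q * x else 0ℚ) ≡ q * (if c then x else 0ℚ)
    if-* q x true  = refl
    if-* q x false = sym (*-zeroʳ q)

  -- Phrased through the failure indicator because all later estimates of `E` are upper bounds.
  Pr≡1-failure : ∀ {m} p {P : Pred (Vec Bool m) 0ℓ} (dec : Decidable P) →
    Pr p dec ≡ 1ℚ - E p (replicate m nothing) (λ c → if does (dec c) then 0ℚ else 1ℚ)
  Pr≡1-failure {m} p dec = begin
    Pr p dec            ≡⟨ sum-weights m p (λ c → does (dec c)) ⟩
    x                   ≡⟨ solve 2 (λ x y → x := x :+ y :- y) refl x y ⟩
    x + y - y           ≡⟨ cong (_- y) (E-complement p (replicate m nothing) _ _ λ c → if-+ (does (dec c))) ⟩
    1ℚ - y              ∎
    where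
    open ≡-Reasoning
    x y : ℚ
    x = E p (replicate m nothing) (λ c → if does (dec c) then 1ℚ else 0ℚ)
    y = E p (replicate m nothing) (λ c → if does (dec c) then 0ℚ else 1ℚ)
    if-+ : ∀ b → (if b then 1ℚ else 0ℚ) + (if b then 0ℚ else 1ℚ) ≡ 1ℚ
    if-+ true  = refl
    if-+ false = refl

  -- `_/_` divides by a gcd and is stuck on a variable `k`. With denominator 1 the fraction is in
  -- lowest terms already, and in this explicit form sums, products and order come down to integers.
  ℕtoℚ≡mkℚ : ∀ k → ℕtoℚ k ≡ mkℚ (ℤ.+ k) 0 (Coprime.sym (1-coprimeTo k))
  ℕtoℚ≡mkℚ k = normalize-coprime (Coprime.sym (1-coprimeTo k))

  ℕtoℚ-+ : ∀ a b → ℕtoℚ (a ℕ.+ b) ≡ ℕtoℚ a + ℕtoℚ b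
  ℕtoℚ-+ a b = sym (trans (cong₂ _+_ (ℕtoℚ≡mkℚ a) (ℕtoℚ≡mkℚ b))
    (/-cong {q₁ = 1} {q₂ = 1} (cong₂ ℤ._+_ (ℤ.*-identityʳ (ℤ.+ a)) (ℤ.*-identityʳ (ℤ.+ b))) refl))

  ℕtoℚ-* : ∀ a b → ℕtoℚ (a ℕ.* b) ≡ ℕtoℚ a * ℕtoℚ b
  ℕtoℚ-* a b = sym (trans (cong₂ _*_ (ℕtoℚ≡mkℚ a) (ℕtoℚ≡mkℚ b)) (/-cong {q₁ = 1} {q₂ = 1} (sym (ℤ.pos-* a b)) refl))

  ℕtoℚ-mono : ∀ {a b} → a ℕ.≤ b → ℕtoℚ a ≤ ℕtoℚ b
  ℕtoℚ-mono {a} {b} a≤b = subst₂ _≤_ (sym (ℕtoℚ≡mkℚ a)) (sym (ℕtoℚ≡mkℚ b))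
    (*≤* (subst₂ ℤ._≤_ (sym (ℤ.*-identityʳ (ℤ.+ a))) (sym (ℤ.*-identityʳ (ℤ.+ b))) (ℤ.+≤+ a≤b)))

  0≤ℕtoℚ : ∀ a → 0ℚ ≤ ℕtoℚ a
  0≤ℕtoℚ a = ℕtoℚ-mono {0} {a} ℕ.z≤n

  *-nonNeg : ∀ {x y} → 0ℚ ≤ x → 0ℚ ≤ y → 0ℚ ≤ x * y
  *-nonNeg {x} 0≤x 0≤y = ≤-trans (≤-reflexive (sym (*-zeroʳ x))) (*-monoˡ-≤-nonNeg x {{nonNegative 0≤x}} 0≤y)

  -- Testing independent coins until one succeeds

  module Bernoulli (p : ℚ) (0≤p : 0ℚ ≤ p) (p≤1 : p ≤ 1ℚ) where

    0≤1-p : 0ℚ ≤ 1ℚ - p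
    0≤1-p = ≤-trans (≤-reflexive (sym (+-inverseʳ p))) (+-monoˡ-≤ (- p) p≤1)

    *-mono-p : ∀ {x y} → x ≤ y → p * x ≤ p * y
    *-mono-p = *-monoˡ-≤-nonNeg p {{nonNegative 0≤p}}

    *-mono-1-p : ∀ {x y} → x ≤ y → (1ℚ - p) * x ≤ (1ℚ - p) * y
    *-mono-1-p = *-monoˡ-≤-nonNeg (1ℚ - p) {{nonNegative 0≤1-p}}

    average≤ : ∀ {x y z} → x ≤ z → y ≤ z → p * x + (1ℚ - p) * y ≤ z
    average≤ {x} {y} {z} x≤z y≤z = ≤-trans (+-mono-≤ (*-mono-p x≤z) (*-mono-1-p y≤z))
      (≤-reflexive (solve 2 (λ p z → p :* z :+ (con 1ℚ :- p) :* z := z) refl p z))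

    E≤1 : ∀ {m} (σ : Revealed m) f → (∀ c → f c ≤ 1ℚ) → E p σ f ≤ 1ℚ
    E≤1 []            f f≤1 = f≤1 []
    E≤1 (just b ∷ σ)  f f≤1 = E≤1 σ _ (f≤1 ∘ (b ∷_))
    E≤1 (nothing ∷ σ) f f≤1 = average≤ (E≤1 σ _ (f≤1 ∘ (true ∷_))) (E≤1 σ _ (f≤1 ∘ (false ∷_)))

    miss : ℕ → ℚ
    miss zero    = 1ℚ
    miss (suc m) = (1ℚ - p) * miss m

    0≤miss : ∀ m → 0ℚ ≤ miss m
    0≤miss zero    = nonNegative⁻¹ 1ℚ
    0≤miss (suc m) = ≤-trans (≤-reflexive (sym (*-zeroʳ (1ℚ - p)))) (*-mono-1-p (0≤miss m))

    miss-suc≤ : ∀ m → miss (suc m) ≤ miss m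
    miss-suc≤ m = ≤-trans (*-monoʳ-≤-nonNeg (miss m) {{nonNegative (0≤miss m)}} 1-p≤1) (≤-reflexive (*-identityˡ (miss m)))
      where
      1-p≤1 : 1ℚ - p ≤ 1ℚ
      1-p≤1 = ≤-trans (+-monoʳ-≤ 1ℚ (neg-antimono-≤ 0≤p)) (≤-reflexive (+-identityʳ 1ℚ))

    miss-antitone : ∀ {m n} → m ℕ.≤′ n → miss n ≤ miss m
    miss-antitone (ℕ.≤′-reflexive refl) = ≤-refl
    miss-antitone (ℕ.≤′-step {n} m≤n)   = ≤-trans (miss-suc≤ n) (miss-antitone m≤n)

    -- Coins are revealed until the first success. Since pβ + (1 - p)(β + x) = β + (1 - p)x, the
    -- bound β for a success is paid once, and only the event that every coin fails adds to it.
    -- `Inv` carries through the failures whatever is required to evaluate a success.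
    try-all : ∀ {m} f → (∀ c → f c ≤ 1ℚ) → ∀ β → 0ℚ ≤ β → (Inv : Revealed m → Set) → ∀ es → Unique es →
      (∀ {σ e} → e ∈ es → Inv σ → lookup σ e ≡ nothing → Inv (σ [ e ]≔ just false) × E p (σ [ e ]≔ just true) f ≤ β) →
      ∀ {σ} → Inv σ → All (λ e → lookup σ e ≡ nothing) es → E p σ f ≤ β + miss (length es)
    try-all f f≤1 β 0≤β Inv [] [] step {σ} inv [] =
      ≤-trans (E≤1 σ f f≤1) (≤-trans (≤-reflexive (sym (+-identityˡ 1ℚ))) (+-monoˡ-≤ 1ℚ 0≤β))
    try-all f f≤1 β 0≤β Inv (e ∷ es) (e∉es ∷ unique) step {σ} inv (eq ∷ eqs) = begin
      E p σ f
        ≡⟨ E-split p σ f e eq ⟩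
      p * E p (σ [ e ]≔ just true) f + (1ℚ - p) * E p (σ [ e ]≔ just false) f
        ≤⟨ +-mono-≤ (*-mono-p (proj₂ now)) (*-mono-1-p (try-all f f≤1 β 0≤β Inv es unique (step ∘ there) (proj₁ now) rest)) ⟩
      p * β + (1ℚ - p) * (β + miss (length es))
        ≡⟨ solve 3 (λ p β m → p :* β :+ (con 1ℚ :- p) :* (β :+ m) := β :+ (con 1ℚ :- p) :* m) refl p β (miss (length es)) ⟩
      β + miss (suc (length es)) ∎
      where
      open ≤-Reasoning
      now : _
      now = step (here refl) inv eq
      rest : All (λ e′ → lookup (σ [ e ]≔ just false) e′ ≡ nothing) es
      rest = All.zipWith (λ (e≢e′ , eq′) → trans (lookup∘update′ (e≢e′ ∘ sym) σ (just false)) eq′) (e∉es , eqs)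

    -- (1 + (1 + m)p)(1 - p) equals 1 + mp minus (1 + m)p².
    bernoulli : ∀ m → (1ℚ + ℕtoℚ m * p) * miss m ≤ 1ℚ
    bernoulli zero    = ≤-reflexive (trans (*-identityʳ _) (trans (cong (1ℚ +_) (*-zeroˡ p)) (+-identityʳ 1ℚ)))
    bernoulli (suc m) = begin
      (1ℚ + ℕtoℚ (suc m) * p) * ((1ℚ - p) * x)
        ≡⟨ cong (λ z → (1ℚ + z * p) * ((1ℚ - p) * x)) (ℕtoℚ-+ 1 m) ⟩
      (1ℚ + (1ℚ + y) * p) * ((1ℚ - p) * x)
        ≡⟨ solve 3 (λ p x y → (con 1ℚ :+ (con 1ℚ :+ y) :* p) :* ((con 1ℚ :- p) :* x)
                           := (con 1ℚ :+ y :* p) :* x :- (con 1ℚ :+ y) :* p :* p :* x) refl p x y ⟩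
      (1ℚ + y * p) * x - (1ℚ + y) * p * p * x
        ≤⟨ +-mono-≤ (bernoulli m) (neg-antimono-≤ 0≤) ⟩
      1ℚ - 0ℚ
        ≡⟨ refl ⟩
      1ℚ ∎
      where
      open ≤-Reasoning
      x y : ℚ
      x = miss m
      y = ℕtoℚ m
      0≤ : 0ℚ ≤ (1ℚ + y) * p * p * x
      0≤ = *-nonNeg (*-nonNeg (*-nonNeg (≤-trans (0≤ℕtoℚ (suc m)) (≤-reflexive (ℕtoℚ-+ 1 m))) 0≤p) 0≤p) (0≤miss m)

    -- The bound 1/(mp) for (1 - p)^m without division. It is weaker than an exponential, but it
    -- tends to 0 as mp grows and stays rational.
    miss≤ : ∀ m → ℕtoℚ m * p * miss m ≤ 1ℚ
    miss≤ m = ≤-trans (*-monoʳ-≤-nonNeg (miss m) {{nonNegative (0≤miss m)}}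
      (≤-trans (≤-reflexive (sym (+-identityˡ (ℕtoℚ m * p)))) (+-monoˡ-≤ (ℕtoℚ m * p) (nonNegative⁻¹ 1ℚ)))) (bernoulli m)

module LongCycles where

  open import Data.Nat.Properties
  open import Algebra.Properties.Semiring.Sum +-*-semiring using (sum; ∑-comm; ∑-distrib-+; *-distribˡ-sum; *-distribʳ-sum; sum-cong-≗; sum-syntax)
  open import Data.Bool as Bool using (Bool; true; false; if_then_else_; _∧_; T)
  import Data.Bool.Properties as Bool
  open import Data.Empty using (⊥)
  open import Data.Fin as Fin using (Fin; zero; suc; toℕ; fromℕ<; combine)
  import Data.Fin.Properties as Fin
  import Data.Integer as ℤ
  open import Data.List using (List; []; _∷_; _++_; [_]; length; reverse; _∷ʳ_; filter; map; tabulate; allFin)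
  open import Data.List.Membership.Propositional using (_∈_)
  open import Data.List.Membership.Propositional.Properties using (∈-map⁻; ∈-filter⁻)
  open import Data.List.Properties using (unfold-reverse; length-reverse; length-map)
  open import Data.List.Relation.Binary.Permutation.Propositional using (↭-sym)
  open import Data.List.Relation.Binary.Permutation.Propositional.Properties using (↭-reverse; All-resp-↭)
  open import Data.List.Relation.Unary.All as All using (All; []; _∷_)
  open import Data.List.Relation.Unary.AllPairs using ([]; _∷_)
  open import Data.List.Relation.Unary.Any using (here)
  open import Data.List.Relation.Unary.Linked as Linked using (Linked; [-]; _∷_)
  open import Data.List.Relation.Unary.Unique.Propositional using (Unique)
  import Data.List.Relation.Unary.Unique.Propositional.Properties as Unique
  open import Data.Maybe using (Maybe; just; nothing; maybe)
  import Data.Maybe.Properties as Maybe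
  open import Data.Nat
  open import Data.Nat.DivMod using (m/n*n≤m; /-mono-≤; m*n/n≡m; m≡m%n+[m/n]*n; m%n<n)
  import Data.Nat.ListAction
  open import Data.Nat.Tactic.RingSolver using (solve-∀)
  open import Data.Product as Product using (∃; _×_; _,_; proj₁; proj₂)
  open import Data.Rational as ℚ using (ℚ; 0ℚ; 1ℚ; mkℚ)
  import Data.Rational.Properties as ℚ
  open import Data.Rational.Solver using (module +-*-Solver)
  import Data.Rational.Unnormalised as ℚᵘ
  import Data.Rational.Unnormalised.Properties as ℚᵘ
  open import Data.Sum as Sum using (_⊎_; inj₁; inj₂)
  open import Data.Unit using (tt)
  open import Data.Vec using ([]; _∷_; lookup; replicate; _[_]≔_)
  open import Data.Vec.Functional using (updateAt)
  open import Data.Vec.Functional.Properties using (updateAt-updates; updateAt-minimal)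
  open import Data.Vec.Properties using (lookup∘update; lookup∘update′; lookup-replicate)
  open import Function using (_∘_; const)
  open import Relation.Binary.PropositionalEquality hiding ([_])
  open import Relation.Nullary using (¬_; Dec; yes; no; does; contradiction)
  open import Relation.Nullary.Decidable using (_×-dec_; _⊎-dec_; ¬?; map′)
  open import Relation.Unary using (Decidable)
  open import Defs hiding (sym)
  open Probability

  -- Counting with sums of indicators

  -- Certificate for linear arithmetic: the hypotheses are added up into A ≤ B,
  -- and the identity X + B + s ≡ Y + A is left to the ring solver.
  ≤-by : ∀ {A B X Y} s → A ≤ B → X + B + s ≡ Y + A → X ≤ Y
  ≤-by {A} {B} {X} {Y} s A≤B eq = +-cancelʳ-≤ A X Y (begin
    X + A      ≤⟨ +-monoʳ-≤ X A≤B ⟩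
    X + B      ≤⟨ m≤m+n (X + B) s ⟩
    X + B + s  ≡⟨ eq ⟩
    Y + A      ∎)
    where open ≤-Reasoning

  2xy≤x²+y² : ∀ x y → 2 * (x * y) ≤ x * x + y * y
  2xy≤x²+y² x y with ≤-total x y
  ... | inj₁ x≤y with (d , refl) ← m≤n⇒∃[o]m+o≡n x≤y =
    ≤-by (d * d) (z≤n {0}) (lemma x d)
    where
    lemma : ∀ x d → 2 * (x * (x + d)) + 0 + d * d ≡ x * x + (x + d) * (x + d) + 0
    lemma = solve-∀
  ... | inj₂ y≤x with (d , refl) ← m≤n⇒∃[o]m+o≡n y≤x =
    ≤-by (d * d) (z≤n {0}) (lemma y d)
    where
    lemma : ∀ y d → 2 * ((y + d) * y) + 0 + d * d ≡ (y + d) * (y + d) + y * y + 0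
    lemma = solve-∀

  𝟙 : ∀ {P : Set} → Dec P → ℕ
  𝟙 d = if does d then 1 else 0

  module _ {P : Set} where

    𝟙-≤ : ∀ {x} (d : Dec P) → (P → 1 ≤ x) → 𝟙 d ≤ x
    𝟙-≤ (yes p) f = f p
    𝟙-≤ (no _)  f = z≤n

    𝟙≤1 : (d : Dec P) → 𝟙 d ≤ 1
    𝟙≤1 d = 𝟙-≤ d λ _ → ≤-refl

    1≤𝟙 : (d : Dec P) → P → 1 ≤ 𝟙 d
    1≤𝟙 (yes _) _ = ≤-refl
    1≤𝟙 (no ¬p) p = contradiction p ¬p

    𝟙-*-≤ : ∀ {x y} (d : Dec P) → (P → x ≤ y) → 𝟙 d * x ≤ y
    𝟙-*-≤ {x} (yes p) f = ≤-trans (≤-reflexive (+-identityʳ x)) (f p)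
    𝟙-*-≤ (no _) f = z≤n

    𝟙-*-mono : ∀ {x y} (d : Dec P) → (P → x ≤ y) → 𝟙 d * x ≤ 𝟙 d * y
    𝟙-*-mono (yes p) f = +-monoˡ-≤ 0 (f p)
    𝟙-*-mono (no _) f = z≤n

    𝟙-*-idem : (d : Dec P) → 𝟙 d * 𝟙 d ≡ 𝟙 d
    𝟙-*-idem (yes _) = refl
    𝟙-*-idem (no _)  = refl

  𝟙-mono : ∀ {P Q : Set} (d : Dec P) (e : Dec Q) → (P → Q) → 𝟙 d ≤ 𝟙 e
  𝟙-mono d e f = 𝟙-≤ d (1≤𝟙 e ∘ f)

  𝟙-× : ∀ {P Q : Set} (d : Dec P) (e : Dec Q) → 𝟙 (d ×-dec e) ≡ 𝟙 d * 𝟙 e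
  𝟙-× (yes _) (yes _) = refl
  𝟙-× (yes _) (no _)  = refl
  𝟙-× (no _)  _       = refl

  𝟙-⊎-≤ : ∀ {P Q R : Set} (d : Dec P) (e : Dec Q) (f : Dec R) → (P → Q ⊎ R) → 𝟙 d ≤ 𝟙 e + 𝟙 f
  𝟙-⊎-≤ d e f g = 𝟙-≤ d λ p → case (g p)
    where
    case : _ ⊎ _ → 1 ≤ 𝟙 e + 𝟙 f
    case (inj₁ q) = ≤-trans (1≤𝟙 e q) (m≤m+n _ _)
    case (inj₂ r) = ≤-trans (1≤𝟙 f r) (m≤n+m _ _)

  sum-mono : ∀ {n} {f g : Fin n → ℕ} → (∀ i → f i ≤ g i) → sum f ≤ sum g
  sum-mono {zero}  f≤g = z≤n
  sum-mono {suc n} f≤g = +-mono-≤ (f≤g zero) (sum-mono (f≤g ∘ suc))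

  sum-const : ∀ n c → sum {n} (λ _ → c) ≡ n * c
  sum-const zero    c = refl
  sum-const (suc n) c = cong (c +_) (sum-const n c)

  sum-≤-const : ∀ {n c} {f : Fin n → ℕ} → (∀ i → f i ≤ c) → sum f ≤ n * c
  sum-≤-const {n} {c} f≤c = ≤-trans (sum-mono f≤c) (≤-reflexive (sum-const n c))

  term≤sum : ∀ {n} (f : Fin n → ℕ) i → f i ≤ sum f
  term≤sum f zero    = m≤m+n _ _
  term≤sum f (suc i) = ≤-trans (term≤sum (f ∘ suc) i) (m≤n+m _ _)

  sum-split : ∀ m {n} (f : ℕ → ℕ) → ∑[ i < m + n ] f (toℕ i) ≡ ∑[ i < m ] f (toℕ i) + ∑[ i < n ] f (m + toℕ i)
  sum-split zero    f = refl
  sum-split (suc m) f = trans (cong (f 0 +_) (sum-split m (f ∘ suc))) (sym (+-assoc (f 0) _ _))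

  sum-window : ∀ a w {m} (f : ℕ → ℕ) → a + w ≤ m → ∑[ i < w ] f (a + toℕ i) ≤ ∑[ i < m ] f (toℕ i)
  sum-window a w f a+w≤m with (d , refl) ← m≤n⇒∃[o]m+o≡n a+w≤m = begin
    ∑[ i < w ] f (a + toℕ i)                             ≤⟨ m≤n+m _ _ ⟩
    ∑[ i < a ] f (toℕ i) + ∑[ i < w ] f (a + toℕ i)      ≡⟨ sum-split a f ⟨
    ∑[ i < a + w ] f (toℕ i)                             ≤⟨ m≤m+n _ _ ⟩
    ∑[ i < a + w ] f (toℕ i) + ∑[ i < d ] f (a + w + toℕ i) ≡⟨ sum-split (a + w) f ⟨
    ∑[ i < a + w + d ] f (toℕ i)                         ∎
    where open ≤-Reasoning

  pigeonhole : ∀ {n c} → Fin n → (f : Fin n → ℕ) → n * c ≤ sum f → ∃ λ i → c ≤ f i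
  pigeonhole {suc n} _ = go n
    where
    go : ∀ n {c} (f : Fin (suc n) → ℕ) → suc n * c ≤ sum f → ∃ λ i → c ≤ f i
    go zero {c} f c≤ =
      zero , ≤-trans (≤-reflexive (sym (+-identityʳ c))) (≤-trans c≤ (≤-reflexive (+-identityʳ (f zero))))
    go (suc n) {c} f c≤ with c ≤? f zero
    ... | yes c≤f = zero , c≤f
    ... | no  c≰f = Product.map suc (λ c≤fi → c≤fi)
      (go n (f ∘ suc) (+-cancelˡ-≤ c _ _ (≤-trans c≤ (+-monoˡ-≤ _ (<⇒≤ (≰⇒> c≰f))))))

  module _ {n} {P : Fin n → Set} (P? : ∀ i → Dec (P i)) where

    sum-none : (∀ i → ¬ P i) → ∑[ i < n ] 𝟙 (P? i) ≡ 0
    sum-none none = n≤0⇒n≡0 (≤-trans (sum-≤-const λ i → 𝟙-≤ (P? i) λ p → contradiction p (none i)) (≤-reflexive (*-zeroʳ n)))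

  sum-unique-≤ : ∀ {n x} {P : Fin n → Set} (P? : ∀ i → Dec (P i)) →
    (∀ {i j} → P i → P j → i ≡ j) → (∀ {i} → P i → 1 ≤ x) → ∑[ i < n ] 𝟙 (P? i) ≤ x
  sum-unique-≤ {zero}  P? uniq P⇒1≤x = z≤n
  sum-unique-≤ {suc n} P? uniq P⇒1≤x with P? zero
  ... | yes p = ≤-trans (≤-reflexive (cong suc (sum-none (P? ∘ suc) λ i q → Fin.0≢1+n (uniq p q)))) (P⇒1≤x p)
  ... | no  _ = sum-unique-≤ (P? ∘ suc) (λ p q → Fin.suc-injective (uniq p q)) P⇒1≤x

  sum-diagonal : ∀ {n} (f : Fin n → ℕ) i → ∑[ j < n ] (𝟙 (i Fin.≟ j) * f j) ≤ f i
  sum-diagonal {n} f i = begin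
    ∑[ j < n ] (𝟙 (i Fin.≟ j) * f j)   ≤⟨ sum-mono (λ j → 𝟙-*-mono (i Fin.≟ j) λ { refl → ≤-refl }) ⟩
    ∑[ j < n ] (𝟙 (i Fin.≟ j) * f i)   ≡⟨ *-distribʳ-sum (f i) (λ j → 𝟙 (i Fin.≟ j)) ⟨
    (∑[ j < n ] 𝟙 (i Fin.≟ j)) * f i ≤⟨ *-monoˡ-≤ (f i) (sum-unique-≤ (i Fin.≟_) (λ p q → trans (sym p) q) λ _ → ≤-refl) ⟩
    1 * f i                          ≡⟨ *-identityˡ (f i) ⟩
    f i                              ∎
    where open ≤-Reasoning

  sum-*-sum : ∀ {m n} (f : Fin m → ℕ) (g : Fin n → ℕ) → sum f * sum g ≡ ∑[ i < m ] (∑[ j < n ] (f i * g j))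
  sum-*-sum f g = trans (*-distribʳ-sum (sum g) f) (sum-cong-≗ λ i → *-distribˡ-sum (f i) g)

  ∑-distrib-+₃ : ∀ {n} (f g h : Fin n → ℕ) → ∑[ i < n ] (f i + g i + h i) ≡ sum f + sum g + sum h
  ∑-distrib-+₃ f g h = trans (∑-distrib-+ (λ i → f i + g i) h) (cong (_+ sum h) (∑-distrib-+ f g))

  sum-find : ∀ {n} {P : Fin n → Set} (P? : ∀ i → Dec (P i)) → 0 < ∑[ i < n ] 𝟙 (P? i) → ∃ P
  sum-find P? pos with Fin.any? P?
  ... | yes found = found
  ... | no  none  = contradiction (sum-none P? λ i p → none (i , p)) (m<n⇒n≢0 pos)

  𝟙+𝟙¬ : ∀ {P : Set} (d : Dec P) → 𝟙 d + 𝟙 (¬? d) ≡ 1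
  𝟙+𝟙¬ (yes _) = refl
  𝟙+𝟙¬ (no _)  = refl

  count+count¬ : ∀ {n} {P : Fin n → Set} (P? : ∀ i → Dec (P i)) → ∑[ i < n ] 𝟙 (P? i) + ∑[ i < n ] 𝟙 (¬? (P? i)) ≡ n
  count+count¬ {n} P? = trans (sym (∑-distrib-+ (λ i → 𝟙 (P? i)) (λ i → 𝟙 (¬? (P? i)))))
    (trans (sum-cong-≗ λ i → 𝟙+𝟙¬ (P? i)) (trans (sum-const n 1) (*-identityʳ n)))

  -- Degrees in C₄-free graphs

  module C4FreeCounting {n} {U : Fin n → Fin n → Set} (U? : ∀ a b → Dec (U a b))
    (U-C4 : ∀ {a a′ b b′} → a ≢ a′ → b ≢ b′ → U a b → U a b′ → U a′ b → U a′ b′ → ⊥) where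

    -- In a C₄-free graph two distinct vertices have at most one common neighbour,
    -- so the cherries are counted by their pairs of leaves.
    cherries : {B R : Fin n → Fin n → Set} (B? : ∀ c l → Dec (B c l)) (R? : ∀ l l′ → Dec (R l l′)) →
      (∀ {c l} → B c l → U c l) → (∀ {c l l′} → l ≢ l′ → B c l → B c l′ → R l l′) →
      ∑[ c < n ] (∑[ l < n ] 𝟙 (B? c l) * ∑[ l < n ] 𝟙 (B? c l))
        ≤ ∑[ c < n ] (∑[ l < n ] 𝟙 (B? c l)) + ∑[ l < n ] (∑[ l′ < n ] 𝟙 (R? l l′))
    cherries {B} {R} B? R? B⇒U B⇒R = begin
      ∑[ c < n ] (d c * d c)
        ≡⟨ sum-cong-≗ (λ c → sum-*-sum (b c) (b c)) ⟩
      ∑[ c < n ] (∑[ l < n ] (∑[ l′ < n ] (b c l * b c l′)))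
        ≡⟨ ∑-comm (λ c l → ∑[ l′ < n ] (b c l * b c l′)) ⟩
      ∑[ l < n ] (∑[ c < n ] (∑[ l′ < n ] (b c l * b c l′)))
        ≡⟨ sum-cong-≗ (λ l → ∑-comm (λ c l′ → b c l * b c l′)) ⟩
      ∑[ l < n ] (∑[ l′ < n ] (∑[ c < n ] (b c l * b c l′)))
        ≤⟨ sum-mono (λ l → sum-mono (common l)) ⟩
      ∑[ l < n ] (∑[ l′ < n ] (𝟙 (l Fin.≟ l′) * D l′ + 𝟙 (R? l l′)))
        ≡⟨ sum-cong-≗ (λ l → ∑-distrib-+ (λ l′ → 𝟙 (l Fin.≟ l′) * D l′) (λ l′ → 𝟙 (R? l l′))) ⟩
      ∑[ l < n ] (∑[ l′ < n ] (𝟙 (l Fin.≟ l′) * D l′) + ∑[ l′ < n ] 𝟙 (R? l l′))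
        ≡⟨ ∑-distrib-+ (λ l → ∑[ l′ < n ] (𝟙 (l Fin.≟ l′) * D l′)) (λ l → ∑[ l′ < n ] 𝟙 (R? l l′)) ⟩
      ∑[ l < n ] (∑[ l′ < n ] (𝟙 (l Fin.≟ l′) * D l′)) + r
        ≤⟨ +-monoˡ-≤ r (sum-mono (sum-diagonal D)) ⟩
      ∑[ l < n ] D l + r
        ≡⟨ cong (_+ r) (∑-comm (λ l c → b c l)) ⟩
      ∑[ c < n ] d c + r ∎
      where
      open ≤-Reasoning
      b : Fin n → Fin n → ℕ
      b c l = 𝟙 (B? c l)
      d D : Fin n → ℕ
      d c = ∑[ l < n ] b c l
      D l = ∑[ c < n ] b c l
      r : ℕ
      r = ∑[ l < n ] (∑[ l′ < n ] 𝟙 (R? l l′))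
      common : ∀ l l′ → ∑[ c < n ] (b c l * b c l′) ≤ 𝟙 (l Fin.≟ l′) * D l′ + 𝟙 (R? l l′)
      common l l′ with l Fin.≟ l′
      ... | yes refl = begin
        ∑[ c < n ] (b c l * b c l)  ≡⟨ sum-cong-≗ (λ c → 𝟙-*-idem (B? c l)) ⟩
        D l                         ≡⟨ +-identityʳ (D l) ⟨
        D l + 0                     ≤⟨ m≤m+n _ _ ⟩
        D l + 0 + 𝟙 (R? l l)        ∎
      ... | no l≢l′ = begin
        ∑[ c < n ] (b c l * b c l′)             ≡⟨ sum-cong-≗ (λ c → 𝟙-× (B? c l) (B? c l′)) ⟨
        ∑[ c < n ] 𝟙 (B? c l ×-dec B? c l′)     ≤⟨ sum-unique-≤ (λ c → B? c l ×-dec B? c l′) unique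
                                                     (λ (p , q) → 1≤𝟙 (R? l l′) (B⇒R l≢l′ p q)) ⟩
        𝟙 (R? l l′)                             ∎
        where
        unique : ∀ {c c′} → B c l × B c l′ → B c′ l × B c′ l′ → c ≡ c′
        unique {c} {c′} (p , p′) (q , q′) with c Fin.≟ c′
        ... | yes c≡c′ = c≡c′
        ... | no  c≢c′ = contradiction (U-C4 c≢c′ l≢l′ (B⇒U p) (B⇒U p′) (B⇒U q) (B⇒U q′)) λ ()

    module _ {A S : Fin n → Set} (A? : ∀ a → Dec (A a)) (S? : ∀ v → Dec (S v)) where

      edges : ℕ
      edges = ∑[ a < n ] (∑[ v < n ] 𝟙 (A? a ×-dec S? v ×-dec U? a v))

      -- The case t = s + κ of 2κtd ≤ κ²d² + t², summed over the degrees d of the vertices of A.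
      density : ∀ κ .{{_ : NonZero κ}} → ∑[ a < n ] 𝟙 (A? a) ≤ κ * κ →
        edges ≤ κ * (∑[ v < n ] 𝟙 (S? v) + κ)
      -- With t = s + κ, moving κ² · `edges` to the left leaves the coefficient 2κt - κ² = κ(2s +
      -- κ), and κ(2s + κ) · κ(s + κ) exceeds κ²(s² + t²) by sκ³.
      density κ {{κ≢0}} ∣A∣≤κ² = *-cancelˡ-≤ (κ * (2 * s + κ)) {{nz}}
        (≤-by (s * κ * κ * κ) (+-mono-≤ sum-amgm (+-mono-≤ (*-monoʳ-≤ (κ * κ) squares) (*-monoʳ-≤ (t * t) ∣A∣≤κ²)))
          (identity edges κ s (∑[ a < n ] (d a * d a)) (∑[ a < n ] 𝟙 (A? a))))
        where
        open ≤-Reasoning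
        s t : ℕ
        s = ∑[ v < n ] 𝟙 (S? v)
        t = s + κ
        nz : NonZero (κ * (2 * s + κ))
        nz = m*n≢0 κ (2 * s + κ) {{κ≢0}} {{>-nonZero (≤-trans (>-nonZero⁻¹ κ) (m≤n+m κ (2 * s)))}}
        B? : ∀ a v → Dec (A a × S v × U a v)
        B? a v = A? a ×-dec S? v ×-dec U? a v
        d : Fin n → ℕ
        d a = ∑[ v < n ] 𝟙 (B? a v)
        squares : ∑[ a < n ] (d a * d a) ≤ edges + s * s
        squares = ≤-trans
          (cherries B? (λ v v′ → S? v ×-dec S? v′) (λ (_ , _ , u) → u) λ _ (_ , p , _) (_ , q , _) → p , q)
          (+-monoʳ-≤ edges (≤-reflexive (trans (sum-cong-≗ λ v → sum-cong-≗ λ v′ → 𝟙-× (S? v) (S? v′))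
            (sym (sum-*-sum (λ v → 𝟙 (S? v)) (λ v → 𝟙 (S? v)))))))
        amgm : ∀ a → 2 * (κ * t) * d a ≤ κ * κ * (d a * d a) + t * t * 𝟙 (A? a)
        amgm a with A? a
        ... | no _ = ≤-reflexive (trans (cong (2 * (κ * t) *_) d≡0) (trans (*-zeroʳ (2 * (κ * t)))
          (sym (trans (cong₂ (λ x y → κ * κ * (x * x) + y) d≡0 (*-zeroʳ (t * t))) (cong (_+ 0) (*-zeroʳ (κ * κ)))))))
          where
          d≡0 : ∑[ v < n ] 0 ≡ 0
          d≡0 = trans (sum-const n 0) (*-zeroʳ n)
        ... | yes p = begin
          2 * (κ * t) * x                 ≡⟨ eq₁ κ t x ⟩
          2 * ((κ * x) * t)               ≤⟨ 2xy≤x²+y² (κ * x) t ⟩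
          (κ * x) * (κ * x) + t * t       ≡⟨ eq₂ κ t x ⟩
          κ * κ * (x * x) + t * t * 1     ∎
          where
          x : ℕ
          x = ∑[ v < n ] 𝟙 (yes p ×-dec S? v ×-dec U? a v)
          eq₁ : ∀ κ t x → 2 * (κ * t) * x ≡ 2 * ((κ * x) * t)
          eq₁ = solve-∀
          eq₂ : ∀ κ t x → (κ * x) * (κ * x) + t * t ≡ κ * κ * (x * x) + t * t * 1
          eq₂ = solve-∀
        sum-amgm : 2 * (κ * t) * edges ≤ κ * κ * ∑[ a < n ] (d a * d a) + t * t * ∑[ a < n ] 𝟙 (A? a)
        sum-amgm = begin
          2 * (κ * t) * edges                       ≡⟨ *-distribˡ-sum (2 * (κ * t)) d ⟩
          ∑[ a < n ] (2 * (κ * t) * d a)            ≤⟨ sum-mono amgm ⟩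
          ∑[ a < n ] (κ * κ * (d a * d a) + t * t * 𝟙 (A? a))
            ≡⟨ ∑-distrib-+ (λ a → κ * κ * (d a * d a)) (λ a → t * t * 𝟙 (A? a)) ⟩
          ∑[ a < n ] (κ * κ * (d a * d a)) + ∑[ a < n ] (t * t * 𝟙 (A? a))
            ≡⟨ cong₂ _+_ (*-distribˡ-sum (κ * κ) (λ a → d a * d a)) (*-distribˡ-sum (t * t) (λ a → 𝟙 (A? a))) ⟨
          κ * κ * ∑[ a < n ] (d a * d a) + t * t * ∑[ a < n ] 𝟙 (A? a) ∎
        identity : ∀ e κ s q z →
          κ * (2 * s + κ) * e + (κ * κ * q + (s + κ) * (s + κ) * z + (κ * κ * (e + s * s) + (s + κ) * (s + κ) * (κ * κ))) + s * κ * κ * κ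
          ≡ κ * (2 * s + κ) * (κ * (s + κ)) + (2 * (κ * (s + κ)) * e + (κ * κ * q + (s + κ) * (s + κ) * z))
        identity = solve-∀

  -- Rooted forests

  module _ {n} (par : Fin n → Maybe (Fin n)) where

    anc : ℕ → Fin n → Maybe (Fin n)
    anc zero    v = just v
    anc (suc j) v = maybe (anc j) nothing (par v)

  module _ {n} {par : Fin n → Maybe (Fin n)} where

    anc-suc : ∀ {v u} j → par v ≡ just u → anc par (suc j) v ≡ anc par j u
    anc-suc j eq = cong (maybe (anc par j) nothing) eq

    anc-suc⁻¹ : ∀ {v a} j → anc par (suc j) v ≡ just a → ∃ λ u → par v ≡ just u × anc par j u ≡ just a
    anc-suc⁻¹ {v} j eq with par v
    ... | just u = u , refl , eq

    anc-+ : ∀ {v u a} i j → anc par i v ≡ just u → anc par j u ≡ just a → anc par (i + j) v ≡ just a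
    anc-+ zero    j refl eq₂ = eq₂
    anc-+ {v} (suc i) j eq₁ eq₂ with par v
    ... | just _ = anc-+ i j eq₁ eq₂

    anc-split : ∀ {v a} i j → anc par (i + j) v ≡ just a → ∃ λ u → anc par i v ≡ just u × anc par j u ≡ just a
    anc-split {v} zero    j eq = v , refl , eq
    anc-split {v} (suc i) j eq with par v
    ... | just _ = anc-split i j eq

    anc-≤ : ∀ {v a i j} → i ≤ j → anc par j v ≡ just a → ∃ λ u → anc par i v ≡ just u × anc par (j ∸ i) u ≡ just a
    anc-≤ {i = i} {j} i≤j eq = anc-split i (j ∸ i) (subst (λ x → anc par x _ ≡ just _) (sym (m+[n∸m]≡n i≤j)) eq)

    anc-between : ∀ {v u a i j} → i ≤ j → anc par i v ≡ just u → anc par j v ≡ just a → anc par (j ∸ i) u ≡ just a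
    anc-between i≤j eq₁ eq₂ with (_ , eq , eq′) ← anc-≤ i≤j eq₂ with refl ← Maybe.just-injective (trans (sym eq₁) eq) = eq′

  -- The depth certifies that `par` has no cycles and makes the distance to an ancestor a function
  -- of the two vertices.
  module RootedForest {n} (par : Fin n → Maybe (Fin n)) (dep : Fin n → ℕ)
    (par-dep : ∀ {v u} → par v ≡ just u → dep v ≡ suc (dep u)) where

    anc-dep : ∀ {v u} j → anc par j v ≡ just u → dep v ≡ j + dep u
    anc-dep zero    refl = refl
    anc-dep (suc j) eq with (_ , eq₁ , eq₂) ← anc-suc⁻¹ {par = par} j eq = trans (par-dep eq₁) (cong suc (anc-dep j eq₂))

    distance-unique : ∀ {v u} i j → anc par i v ≡ just u → anc par j v ≡ just u → i ≡ j
    distance-unique {u = u} i j p q = +-cancelʳ-≡ (dep u) i j (trans (sym (anc-dep i p)) (anc-dep j q))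

    anc-unique : ∀ {v u u′} j → anc par j v ≡ just u → anc par j v ≡ just u′ → u ≡ u′
    anc-unique j p q = Maybe.just-injective (trans (sym p) q)

    anc? : ∀ j v u → Dec (anc par j v ≡ just u)
    anc? j v u = Maybe.≡-dec Fin._≟_ (anc par j v) (just u)

    Near Far : ℕ → Fin n → Fin n → Set
    Near g v u = ∃ λ j → j < g × anc par j v ≡ just u
    Far  g v u = ∃ λ j → g ≤ j × anc par j v ≡ just u

    near? : ∀ g v u → Dec (Near g v u)
    near? g v u = anyUpTo? (λ j → anc? j v u) g

    -- The only possible distance is `dep v ∸ dep u`, so the unbounded quantifier in `Far` becomes
    -- one test.
    far? : ∀ g v u → Dec (Far g v u)
    far? g v u = map′ (λ (p , q) → _ , p , q) from (g ≤? dep v ∸ dep u ×-dec anc? (dep v ∸ dep u) v u)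
      where
      from : Far g v u → g ≤ dep v ∸ dep u × anc par (dep v ∸ dep u) v ≡ just u
      from (j , g≤j , eq) = subst (λ i → g ≤ i × anc par i v ≡ just u)
        (sym (trans (cong (_∸ dep u) (anc-dep j eq)) (m+n∸n≡m j (dep u)))) (g≤j , eq)

    ancestors≤ : ∀ g v → ∑[ u < n ] 𝟙 (near? g v u) ≤ g
    ancestors≤ g v = begin
      ∑[ u < n ] 𝟙 (near? g v u)
        ≤⟨ sum-mono (λ u → 𝟙-≤ (near? g v u) (find u)) ⟩
      ∑[ u < n ] (∑[ j < g ] 𝟙 (anc? (toℕ j) v u))
        ≡⟨ ∑-comm (λ u (j : Fin g) → 𝟙 (anc? (toℕ j) v u)) ⟩
      ∑[ j < g ] (∑[ u < n ] 𝟙 (anc? (toℕ j) v u))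
        ≤⟨ sum-≤-const {g} (λ j → sum-unique-≤ (anc? (toℕ j) v) (anc-unique (toℕ j)) λ _ → ≤-refl) ⟩
      g * 1
        ≡⟨ *-identityʳ g ⟩
      g ∎
      where
      open ≤-Reasoning
      find : ∀ u → Near g v u → 1 ≤ ∑[ j < g ] 𝟙 (anc? (toℕ j) v u)
      find u (j , j<g , eq) = ≤-trans
        (1≤𝟙 (anc? (toℕ (fromℕ< j<g)) v u) (subst (λ i → anc par i v ≡ just u) (sym (Fin.toℕ-fromℕ< j<g)) eq))
        (term≤sum (λ i → 𝟙 (anc? (toℕ i) v u)) (fromℕ< j<g))

    levels≤ : ∀ {g} {P : Fin n → Set} (P? : ∀ u → Dec (P u)) {Q : Fin g → Fin n → Set} (Q? : ∀ i u → Dec (Q i u)) →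
      (∀ {i j u} → Q i u → Q j u → i ≡ j) → (∀ {i u} → Q i u → P u) →
      ∑[ i < g ] (∑[ u < n ] 𝟙 (Q? i u)) ≤ ∑[ u < n ] 𝟙 (P? u)
    levels≤ P? Q? unique Q⇒P = ≤-trans (≤-reflexive (∑-comm (λ i u → 𝟙 (Q? i u))))
      (sum-mono λ u → sum-unique-≤ (λ i → Q? i u) unique λ q → 1≤𝟙 (P? u) (Q⇒P q))

    descendants : ℕ → Fin n → ℕ
    descendants g u = ∑[ v < n ] 𝟙 (near? g v u)

    weighted-descendants : ∀ g {P : Fin n → Set} (P? : ∀ u → Dec (P u)) →
      ∑[ u < n ] (𝟙 (P? u) * descendants g u) ≡ ∑[ v < n ] (∑[ u < n ] 𝟙 (P? u ×-dec near? g v u))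
    weighted-descendants g P? = trans
      (sum-cong-≗ λ u → trans (*-distribˡ-sum (𝟙 (P? u)) (λ v → 𝟙 (near? g v u)))
        (sum-cong-≗ λ v → sym (𝟙-× (P? u) (near? g v u))))
      (∑-comm (λ u v → 𝟙 (P? u ×-dec near? g v u)))

    -- The pairs are counted from their lower ends. This controls the average of `descendants g`,
    -- although a single value may be huge.
    sum-descendants≤ : ∀ g → ∑[ u < n ] descendants g u ≤ n * g
    sum-descendants≤ g = ≤-trans (≤-reflexive (∑-comm (λ u v → 𝟙 (near? g v u)))) (sum-≤-const (ancestors≤ g))

    -- Height at least `h`, witnessed by a descendant exactly `h` levels down so that heights can be
    -- compared without taking maxima.
    Tall : ℕ → Fin n → Set
    Tall h u = ∃ λ y → anc par h y ≡ just u

    tall? : ∀ h u → Dec (Tall h u)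
    tall? h u = Fin.any? λ y → anc? h y u

    far⇒tall : ∀ {h v u} → Far h v u → Tall h u
    far⇒tall {h} {v} {u} (j , h≤j , eq)
      with (y , _ , eq′) ← anc-≤ (m∸n≤m j h) eq = y , subst (λ i → anc par i y ≡ just u) (m∸[m∸n]≡n h≤j) eq′

    -- The chain from the witness up to `u` contributes one vertex on each of the g nearest levels.
    tall⇒descendants≥ : ∀ {h g u} → g ≤ suc h → Tall h u → g ≤ descendants g u
    tall⇒descendants≥ {h} {g} {u} g≤1+h (y , eq) = begin
      g                                           ≡⟨ trans (sum-const g 1) (*-identityʳ g) ⟨
      ∑[ i < g ] 1                                ≤⟨ sum-mono level ⟩
      ∑[ i < g ] (∑[ v < n ] 𝟙 (anc? (toℕ i) v u)) ≤⟨ levels≤ (λ v → near? g v u) (λ i v → anc? (toℕ i) v u)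
                                                       (λ p q → Fin.toℕ-injective (distance-unique _ _ p q))
                                                       (λ {i} p → toℕ i , Fin.toℕ<n i , p) ⟩
      descendants g u                             ∎
      where
      open ≤-Reasoning
      level : (i : Fin g) → 1 ≤ ∑[ v < n ] 𝟙 (anc? (toℕ i) v u)
      level i with (v , eq′) ← far⇒tall (h , ≤-trans (Fin.toℕ≤pred[n] i) (pred-mono-≤ g≤1+h) , eq) =
        ≤-trans (1≤𝟙 (anc? (toℕ i) v u) eq′) (term≤sum (λ v → 𝟙 (anc? (toℕ i) v u)) v)

    short : ℕ → ℕ
    short h = ∑[ u < n ] 𝟙 (¬? (tall? h u))

    -- A vertex of height in [i , i + g) has a descendant of height < g exactly i levels below it.
    short-+ : ∀ i g → short (i + g) ≤ short i + short g
    short-+ i g = begin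
      short (i + g)
        ≤⟨ sum-mono (λ u → 𝟙-≤ (¬? (tall? (i + g) u)) (cover u)) ⟩
      ∑[ u < n ] (𝟙 (¬? (tall? i u)) + ∑[ y < n ] 𝟙 (Q? u y))
        ≡⟨ ∑-distrib-+ (λ u → 𝟙 (¬? (tall? i u))) (λ u → ∑[ y < n ] 𝟙 (Q? u y)) ⟩
      short i + ∑[ u < n ] (∑[ y < n ] 𝟙 (Q? u y))
        ≤⟨ +-monoʳ-≤ (short i) (levels≤ (λ y → ¬? (tall? g y)) Q? (λ (p , _) (q , _) → anc-unique i p q) proj₂) ⟩
      short i + short g ∎
      where
      open ≤-Reasoning
      Q? : ∀ u y → Dec (anc par i y ≡ just u × ¬ Tall g y)
      Q? u y = anc? i y u ×-dec ¬? (tall? g y)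
      cover : ∀ u → ¬ Tall (i + g) u → 1 ≤ 𝟙 (¬? (tall? i u)) + ∑[ y < n ] 𝟙 (Q? u y)
      cover u ¬tall with tall? i u
      ... | no  _        = m≤m+n _ _
      ... | yes (y , eq) = ≤-trans
        (1≤𝟙 (Q? u y) (eq , λ (z , eq′) → ¬tall (z , subst (λ j → anc par j z ≡ just u) (+-comm g i) (anc-+ g i eq′ eq))))
        (term≤sum (λ y → 𝟙 (Q? u y)) y)

    short-* : ∀ h g → short (h * g) ≤ h * short g
    short-* zero    g = ≤-reflexive (sum-none (λ u → ¬? (tall? 0 u)) λ u ¬tall → ¬tall (u , refl))
    short-* (suc h) g = ≤-trans (short-+ g (h * g)) (+-monoʳ-≤ (short g) (short-* h g))

  -- C₄-free graphs all of whose edges join a vertex to an ancestor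

  module VerticalGraph {n} (par : Fin n → Maybe (Fin n)) (dep : Fin n → ℕ)
    (par-dep : ∀ {v u} → par v ≡ just u → dep v ≡ suc (dep u))
    {U : Fin n → Fin n → Set} (U? : ∀ a b → Dec (U a b)) (U-sym : ∀ {a b} → U a b → U b a)
    (U-C4 : ∀ {a a′ b b′} → a ≢ a′ → b ≢ b′ → U a b → U a b′ → U a′ b → U a′ b′ → ⊥)
    (vertical : ∀ {u v} → U u v → (∃ λ j → anc par j u ≡ just v) ⊎ (∃ λ j → anc par j v ≡ just u)) where

    open RootedForest par dep par-dep
    open C4FreeCounting U? U-C4

    -- Two ancestors of v at distance < g from v are at distance < g from each other,
    -- so there are at most 2g|Y| pairs of leaves for the cherries counted here.
    short-edges : ∀ g c .{{_ : NonZero c}} {X Y : Fin n → Set} (X? : ∀ v → Dec (X v)) (Y? : ∀ v → Dec (Y v)) →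
      c * ∑[ v < n ] (∑[ a < n ] 𝟙 (X? v ×-dec Y? a ×-dec near? g v a ×-dec U? v a))
        ≤ 2 * (g * ∑[ a < n ] 𝟙 (Y? a)) + c * c * ∑[ v < n ] 𝟙 (X? v)
    short-edges g c@(suc c-1) {X} {Y} X? Y? =
      -- The two estimates give (2c - 1)F on the left; the surplus (c - 1)F is dropped.
      ≤-by (c-1 * F) (+-mono-≤ sum-amgm squares)
        (identity c-1 F (∑[ v < n ] (d v * d v)) (c * c * ∑[ v < n ] 𝟙 (X? v)) (2 * (g * ∑[ a < n ] 𝟙 (Y? a))))
      where
      open ≤-Reasoning
      B? : ∀ v a → Dec (X v × Y a × Near g v a × U v a)
      B? v a = X? v ×-dec Y? a ×-dec near? g v a ×-dec U? v a
      R? : ∀ a a′ → Dec ((Y a × Near g a a′) ⊎ (Y a′ × Near g a′ a))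
      R? a a′ = (Y? a ×-dec near? g a a′) ⊎-dec (Y? a′ ×-dec near? g a′ a)
      d : Fin n → ℕ
      d v = ∑[ a < n ] 𝟙 (B? v a)
      F : ℕ
      F = ∑[ v < n ] d v
      leaves : ∀ {v a a′} → a ≢ a′ → X v × Y a × Near g v a × U v a → X v × Y a′ × Near g v a′ × U v a′ →
        (Y a × Near g a a′) ⊎ (Y a′ × Near g a′ a)
      leaves _ (_ , ya , (i , i<g , eq) , _) (_ , ya′ , (j , j<g , eq′) , _) with ≤-total i j
      ... | inj₁ i≤j = inj₁ (ya  , j ∸ i , ≤-<-trans (m∸n≤m j i) j<g , anc-between i≤j eq eq′)
      ... | inj₂ j≤i = inj₂ (ya′ , i ∸ j , ≤-<-trans (m∸n≤m i j) i<g , anc-between j≤i eq′ eq)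
      N : ℕ
      N = ∑[ a < n ] (∑[ a′ < n ] 𝟙 (Y? a ×-dec near? g a a′))
      N≤ : N ≤ g * ∑[ a < n ] 𝟙 (Y? a)
      N≤ = begin
        N                                 ≡⟨ sum-cong-≗ (λ a → trans (sum-cong-≗ λ a′ → 𝟙-× (Y? a) (near? g a a′))
                                               (sym (*-distribˡ-sum (𝟙 (Y? a)) (λ a′ → 𝟙 (near? g a a′))))) ⟩
        ∑[ a < n ] (𝟙 (Y? a) * ∑[ a′ < n ] 𝟙 (near? g a a′))
                                          ≤⟨ sum-mono (λ a → *-monoʳ-≤ (𝟙 (Y? a)) (ancestors≤ g a)) ⟩
        ∑[ a < n ] (𝟙 (Y? a) * g)         ≡⟨ *-distribʳ-sum g (λ a → 𝟙 (Y? a)) ⟨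
        (∑[ a < n ] 𝟙 (Y? a)) * g         ≡⟨ *-comm _ g ⟩
        g * ∑[ a < n ] 𝟙 (Y? a)           ∎
      pairs : ∑[ a < n ] (∑[ a′ < n ] 𝟙 (R? a a′)) ≤ 2 * (g * ∑[ a < n ] 𝟙 (Y? a))
      pairs = begin
        ∑[ a < n ] (∑[ a′ < n ] 𝟙 (R? a a′))
          ≤⟨ sum-mono (λ a → sum-mono λ a′ → 𝟙-⊎-≤ (R? a a′) (Y? a ×-dec near? g a a′) (Y? a′ ×-dec near? g a′ a) λ r → r) ⟩
        ∑[ a < n ] (∑[ a′ < n ] (𝟙 (Y? a ×-dec near? g a a′) + 𝟙 (Y? a′ ×-dec near? g a′ a)))
          ≡⟨ sum-cong-≗ (λ a → ∑-distrib-+ (λ a′ → 𝟙 (Y? a ×-dec near? g a a′)) (λ a′ → 𝟙 (Y? a′ ×-dec near? g a′ a))) ⟩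
        ∑[ a < n ] (∑[ a′ < n ] 𝟙 (Y? a ×-dec near? g a a′) + ∑[ a′ < n ] 𝟙 (Y? a′ ×-dec near? g a′ a))
          ≡⟨ ∑-distrib-+ (λ a → ∑[ a′ < n ] 𝟙 (Y? a ×-dec near? g a a′)) (λ a → ∑[ a′ < n ] 𝟙 (Y? a′ ×-dec near? g a′ a)) ⟩
        N + ∑[ a < n ] (∑[ a′ < n ] 𝟙 (Y? a′ ×-dec near? g a′ a))
          ≡⟨ cong (N +_) (∑-comm (λ a a′ → 𝟙 (Y? a′ ×-dec near? g a′ a))) ⟩
        N + N
          ≡⟨ cong (N +_) (+-identityʳ N) ⟨
        2 * N
          ≤⟨ *-monoʳ-≤ 2 N≤ ⟩
        2 * (g * ∑[ a < n ] 𝟙 (Y? a)) ∎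
      squares : ∑[ v < n ] (d v * d v) ≤ F + 2 * (g * ∑[ a < n ] 𝟙 (Y? a))
      squares = ≤-trans (cherries B? R? (λ (_ , _ , _ , u) → u) leaves) (+-monoʳ-≤ F pairs)
      amgm : ∀ v → 2 * (c * d v) ≤ d v * d v + c * c * 𝟙 (X? v)
      amgm v with X? v
      ... | no _ = ≤-reflexive (trans (cong (2 *_) (trans (cong (c *_) d≡0) (*-zeroʳ c)))
        (sym (cong₂ (λ x y → x * x + y) d≡0 (*-zeroʳ (c * c)))))
        where
        d≡0 : ∑[ a < n ] 0 ≡ 0
        d≡0 = trans (sum-const n 0) (*-zeroʳ n)
      ... | yes p = begin
        2 * (c * x)           ≤⟨ 2xy≤x²+y² c x ⟩
        c * c + x * x         ≡⟨ +-comm (c * c) (x * x) ⟩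
        x * x + c * c         ≡⟨ cong (x * x +_) (*-identityʳ (c * c)) ⟨
        x * x + c * c * 1     ∎
        where
        x : ℕ
        x = ∑[ a < n ] 𝟙 (yes p ×-dec Y? a ×-dec near? g v a ×-dec U? v a)
      sum-amgm : 2 * (c * F) ≤ ∑[ v < n ] (d v * d v) + c * c * ∑[ v < n ] 𝟙 (X? v)
      sum-amgm = begin
        2 * (c * F)                    ≡⟨ cong (2 *_) (*-distribˡ-sum c d) ⟩
        2 * ∑[ v < n ] (c * d v)       ≡⟨ *-distribˡ-sum 2 (λ v → c * d v) ⟩
        ∑[ v < n ] (2 * (c * d v))     ≤⟨ sum-mono amgm ⟩
        ∑[ v < n ] (d v * d v + c * c * 𝟙 (X? v))
          ≡⟨ ∑-distrib-+ (λ v → d v * d v) (λ v → c * c * 𝟙 (X? v)) ⟩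
        ∑[ v < n ] (d v * d v) + ∑[ v < n ] (c * c * 𝟙 (X? v))
          ≡⟨ cong (∑[ v < n ] (d v * d v) +_) (*-distribˡ-sum (c * c) (λ v → 𝟙 (X? v))) ⟨
        ∑[ v < n ] (d v * d v) + c * c * ∑[ v < n ] 𝟙 (X? v) ∎
      identity : ∀ c F q x y → suc c * F + (q + x + (F + y)) + c * F ≡ y + x + (2 * (suc c * F) + q)
      identity = solve-∀

    -- Each such edge v–a is seen from the g ancestors u of v at distance < g, as an edge
    -- between the vertices less than g below u and those less than L above u.
    middle-edges : ∀ g L κ .{{_ : NonZero κ}} → L ≤ κ * κ → {X : Fin n → Set} (X? : ∀ v → Dec (X v)) →
      g * ∑[ v < n ] (∑[ a < n ] 𝟙 (X? v ×-dec far? g v a ×-dec near? L v a ×-dec U? v a))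
        ≤ κ * (g * ∑[ v < n ] 𝟙 (X? v) + n * κ)
    middle-edges g L κ L≤κ² {X} X? = begin
      g * ∑[ v < n ] (∑[ a < n ] 𝟙 (m? v a))
        ≡⟨ trans (*-distribˡ-sum g (λ v → ∑[ a < n ] 𝟙 (m? v a))) (sum-cong-≗ λ v → *-distribˡ-sum g (λ a → 𝟙 (m? v a))) ⟩
      ∑[ v < n ] (∑[ a < n ] (g * 𝟙 (m? v a)))
        ≤⟨ sum-mono (λ v → sum-mono (seen v)) ⟩
      ∑[ v < n ] (∑[ a < n ] (∑[ u < n ] t u v a))
        ≡⟨ sum-cong-≗ (λ v → ∑-comm (λ a u → t u v a)) ⟩
      ∑[ v < n ] (∑[ u < n ] (∑[ a < n ] t u v a))
        ≡⟨ ∑-comm (λ v u → ∑[ a < n ] t u v a) ⟩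
      ∑[ u < n ] (∑[ v < n ] (∑[ a < n ] t u v a))
        ≡⟨ sum-cong-≗ (λ u → ∑-comm (t u)) ⟩
      ∑[ u < n ] edges (near? L u) (S? u)
        ≤⟨ sum-mono (λ u → density (near? L u) (S? u) κ (≤-trans (ancestors≤ L u) L≤κ²)) ⟩
      ∑[ u < n ] (κ * (s u + κ))
        ≡⟨ *-distribˡ-sum κ (λ u → s u + κ) ⟨
      κ * ∑[ u < n ] (s u + κ)
        ≡⟨ cong (κ *_) (trans (∑-distrib-+ s (λ _ → κ)) (cong (sum s +_) (sum-const n κ))) ⟩
      κ * (∑[ u < n ] s u + n * κ)
        ≤⟨ *-monoʳ-≤ κ (+-monoˡ-≤ (n * κ) sum-s≤) ⟩
      κ * (g * ∑[ v < n ] 𝟙 (X? v) + n * κ) ∎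
      where
      open ≤-Reasoning
      m? : ∀ v a → Dec (X v × Far g v a × Near L v a × U v a)
      m? v a = X? v ×-dec far? g v a ×-dec near? L v a ×-dec U? v a
      S? : ∀ u v → Dec (X v × Near g v u)
      S? u v = X? v ×-dec near? g v u
      s : Fin n → ℕ
      s u = ∑[ v < n ] 𝟙 (S? u v)
      t? : ∀ u v a → Dec (Near L u a × (X v × Near g v u) × U a v)
      t? u v a = near? L u a ×-dec S? u v ×-dec U? a v
      t : Fin n → Fin n → Fin n → ℕ
      t u v a = 𝟙 (t? u v a)
      sum-s≤ : ∑[ u < n ] s u ≤ g * ∑[ v < n ] 𝟙 (X? v)
      sum-s≤ = begin
        ∑[ u < n ] s u
          ≡⟨ ∑-comm (λ u v → 𝟙 (S? u v)) ⟩
        ∑[ v < n ] (∑[ u < n ] 𝟙 (S? u v))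
          ≡⟨ sum-cong-≗ (λ v → trans (sum-cong-≗ λ u → 𝟙-× (X? v) (near? g v u))
               (sym (*-distribˡ-sum (𝟙 (X? v)) (λ u → 𝟙 (near? g v u))))) ⟩
        ∑[ v < n ] (𝟙 (X? v) * ∑[ u < n ] 𝟙 (near? g v u))
          ≤⟨ sum-mono (λ v → *-monoʳ-≤ (𝟙 (X? v)) (ancestors≤ g v)) ⟩
        ∑[ v < n ] (𝟙 (X? v) * g)
          ≡⟨ *-distribʳ-sum g (λ v → 𝟙 (X? v)) ⟨
        (∑[ v < n ] 𝟙 (X? v)) * g
          ≡⟨ *-comm _ g ⟩
        g * ∑[ v < n ] 𝟙 (X? v) ∎
      seen : ∀ v a → g * 𝟙 (m? v a) ≤ ∑[ u < n ] t u v a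
      seen v a = ≤-trans (≤-reflexive (*-comm g (𝟙 (m? v a)))) (𝟙-*-≤ (m? v a) λ m → begin
        g                                 ≡⟨ trans (sum-const g 1) (*-identityʳ g) ⟨
        ∑[ i < g ] 1                      ≤⟨ sum-mono (level m) ⟩
        ∑[ i < g ] (∑[ u < n ] 𝟙 (q? i u)) ≤⟨ levels≤ (λ u → t? u v a) q?
                                               (λ (p , _) (q , _) → Fin.toℕ-injective (distance-unique _ _ p q))
                                               (λ {i} {u} (p , near , x , e) →
                                                 near , (x , toℕ i , Fin.toℕ<n i , p) , e) ⟩
        ∑[ u < n ] t u v a                ∎)
        where
        q? : (i : Fin g) → ∀ u → Dec (anc par (toℕ i) v ≡ just u × Near L u a × X v × U a v)
        q? i u = anc? (toℕ i) v u ×-dec near? L u a ×-dec X? v ×-dec U? a v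
        level : X v × Far g v a × Near L v a × U v a → ∀ i → 1 ≤ ∑[ u < n ] 𝟙 (q? i u)
        level (x , (j , g≤j , eq) , (j′ , j′<L , eq′) , e) i
          with refl ← distance-unique j j′ eq eq′
          with (u , p , q) ← anc-≤ (<⇒≤ (<-≤-trans (Fin.toℕ<n i) g≤j)) eq =
          ≤-trans (1≤𝟙 (q? i u) (p , (j ∸ toℕ i , ≤-<-trans (m∸n≤m j (toℕ i)) j′<L , q) , x , U-sym e))
            (term≤sum (λ u → 𝟙 (q? i u)) u)

    degree : Fin n → ℕ
    degree v = ∑[ a < n ] 𝟙 (U? v a)

    up down : ℕ → Fin n → ℕ
    up   d v = ∑[ a < n ] 𝟙 (U? v a ×-dec far? d v a)
    down d v = ∑[ a < n ] 𝟙 (U? v a ×-dec far? d a v)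

    module _ (k e : ℕ) where

      Full : Fin n → Set
      Full v = k ≤ degree v + e

      full? : ∀ v → Dec (Full v)
      full? v = k ≤? degree v + e

      notFull : ℕ
      notFull = ∑[ v < n ] 𝟙 (¬? (full? v))

    -- A vertex of height < g sends its edges less than g down, or less than g′,
    -- between g′ and L, or at least L up.
    module _ (g g′ L k e m : ℕ) (up≤m : ∀ v → up L v ≤ m) where

      private
        X? : ∀ v → Dec (¬ Tall g v)
        X? v = ¬? (tall? g v)

        Down Up Mid : Fin n → Fin n → ℕ
        Down v a = 𝟙 (X? a ×-dec X? v ×-dec near? g a v ×-dec U? a v)
        Up   v a = 𝟙 (X? v ×-dec yes tt ×-dec near? g′ v a ×-dec U? v a)
        Mid  v a = 𝟙 (X? v ×-dec far? g′ v a ×-dec near? L v a ×-dec U? v a)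

      short-degrees : k * short g ≤
        ∑[ v < n ] (∑[ a < n ] Down v a) + ∑[ v < n ] (∑[ a < n ] Up v a) + ∑[ v < n ] (∑[ a < n ] Mid v a)
          + (m + e) * short g + k * notFull k e
      short-degrees = begin
        k * short g
          ≡⟨ *-distribˡ-sum k (λ v → 𝟙 (X? v)) ⟩
        ∑[ v < n ] (k * 𝟙 (X? v))
          ≤⟨ sum-mono bound ⟩
        ∑[ v < n ] (load v + (m + e) * 𝟙 (X? v) + k * 𝟙 (¬? (full? k e v)))
          ≡⟨ ∑-distrib-+₃ load (λ v → (m + e) * 𝟙 (X? v)) (λ v → k * 𝟙 (¬? (full? k e v))) ⟩
        sum load + ∑[ v < n ] ((m + e) * 𝟙 (X? v)) + ∑[ v < n ] (k * 𝟙 (¬? (full? k e v)))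
          ≡⟨ cong₂ _+_ (cong₂ _+_ (∑-distrib-+₃ (λ v → ∑[ a < n ] Down v a) (λ v → ∑[ a < n ] Up v a) (λ v → ∑[ a < n ] Mid v a))
               (sym (*-distribˡ-sum (m + e) (λ v → 𝟙 (X? v)))))
               (sym (*-distribˡ-sum k (λ v → 𝟙 (¬? (full? k e v))))) ⟩
        ∑[ v < n ] (∑[ a < n ] Down v a) + ∑[ v < n ] (∑[ a < n ] Up v a) + ∑[ v < n ] (∑[ a < n ] Mid v a)
          + (m + e) * short g + k * notFull k e ∎
        where
        open ≤-Reasoning
        load : Fin n → ℕ
        load v = ∑[ a < n ] Down v a + ∑[ a < n ] Up v a + ∑[ a < n ] Mid v a
        classify : ∀ v → ¬ Tall g v → ∀ a → 𝟙 (U? v a) ≤ Down v a + Up v a + Mid v a + 𝟙 (U? v a ×-dec far? L v a)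
        classify v xv a = 𝟙-≤ (U? v a) λ e → case e (vertical e)
          where
          case : U v a → _ → 1 ≤ Down v a + Up v a + Mid v a + 𝟙 (U? v a ×-dec far? L v a)
          -- Here `a` lies below `v`. If its distance were at least g, or if `a` were tall itself,
          -- then `v` would have height at least g.
          case e (inj₂ (j , eq)) with j <? g
          ... | no  j≮g = contradiction (far⇒tall (j , ≮⇒≥ j≮g , eq)) xv
          ... | yes j<g = begin
            1                         ≤⟨ 1≤𝟙 (X? a ×-dec X? v ×-dec near? g a v ×-dec U? a v)
                                           ((λ (y , eq′) → xv (far⇒tall (g + j , m≤m+n g j , anc-+ g j eq′ eq))) ,
                                            xv , (j , j<g , eq) , U-sym e) ⟩
            Down v a                  ≤⟨ m≤m+n _ _ ⟩
            Down v a + Up v a         ≤⟨ m≤m+n _ _ ⟩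
            Down v a + Up v a + Mid v a ≤⟨ m≤m+n _ _ ⟩
            _                         ∎
          case e (inj₁ (j , eq)) with j <? g′ | j <? L
          ... | yes j<g′ | _ = begin
            1                         ≤⟨ 1≤𝟙 (X? v ×-dec yes tt ×-dec near? g′ v a ×-dec U? v a) (xv , tt , (j , j<g′ , eq) , e) ⟩
            Up v a                    ≤⟨ m≤n+m _ _ ⟩
            Down v a + Up v a         ≤⟨ m≤m+n _ _ ⟩
            Down v a + Up v a + Mid v a ≤⟨ m≤m+n _ _ ⟩
            _                         ∎
          ... | no j≮g′ | yes j<L = begin
            1                         ≤⟨ 1≤𝟙 (X? v ×-dec far? g′ v a ×-dec near? L v a ×-dec U? v a)
                                           (xv , (j , ≮⇒≥ j≮g′ , eq) , (j , j<L , eq) , e) ⟩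
            Mid v a                   ≤⟨ m≤n+m _ _ ⟩
            Down v a + Up v a + Mid v a ≤⟨ m≤m+n _ _ ⟩
            _                         ∎
          ... | no j≮g′ | no j≮L = ≤-trans (1≤𝟙 (U? v a ×-dec far? L v a) (e , j , ≮⇒≥ j≮L , eq)) (m≤n+m _ _)
        degree≤ : ∀ v → ¬ Tall g v → degree v ≤ load v + m
        degree≤ v xv = begin
          degree v
            ≤⟨ sum-mono (classify v xv) ⟩
          ∑[ a < n ] (Down v a + Up v a + Mid v a + 𝟙 (U? v a ×-dec far? L v a))
            ≡⟨ trans (∑-distrib-+ (λ a → Down v a + Up v a + Mid v a) (λ a → 𝟙 (U? v a ×-dec far? L v a)))
                 (cong (_+ up L v) (∑-distrib-+₃ (Down v) (Up v) (Mid v))) ⟩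
          load v + up L v
            ≤⟨ +-monoʳ-≤ (load v) (up≤m v) ⟩
          load v + m ∎
        cases : ∀ {P Q : Set} (d : Dec P) (d′ : Dec Q) {t} → (P → Q → k ≤ t + (m + e)) →
          k * 𝟙 d ≤ t + (m + e) * 𝟙 d + k * 𝟙 (¬? d′)
        cases (no _)  d′ f = ≤-trans (≤-reflexive (*-zeroʳ k)) z≤n
        cases (yes _) (no _) f = m≤n+m (k * 1) _
        cases (yes p) (yes q) {t} f = begin
          k * 1                 ≡⟨ *-identityʳ k ⟩
          k                     ≤⟨ f p q ⟩
          t + (m + e)           ≡⟨ cong (t +_) (*-identityʳ (m + e)) ⟨
          t + (m + e) * 1       ≤⟨ m≤m+n _ _ ⟩
          _                     ∎
        bound : ∀ v → k * 𝟙 (X? v) ≤ load v + (m + e) * 𝟙 (X? v) + k * 𝟙 (¬? (full? k e v))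
        bound v = cases (X? v) (full? k e v) λ xv full → begin
          k                ≤⟨ full ⟩
          degree v + e     ≤⟨ +-monoˡ-≤ e (degree≤ v xv) ⟩
          load v + m + e      ≡⟨ +-assoc (load v) m e ⟩
          load v + (m + e)    ∎

    -- Few vertices have height below r²

    module _ (a r B : ℕ) .{{_ : NonZero a}} .{{_ : NonZero r}} .{{_ : NonZero B}} (L : ℕ)
      (L≤ : L ≤ (a * r) * (a * r)) (r-large : 2 * (a * a * B) * B ≤ r)
      (few-notFull : B * notFull ((a + 7) * r) r ≤ n) (up≤r : ∀ v → up L v ≤ r) where

      -- Put x = `short (r * r)` and let ν be the number of vertices that are not full. In the bound
      -- for (a + 7)rx the edges going down cost 3rx, those less than ry up cost rx, the middle ones
      -- arx, and the tested or very long ones 2rx: a + 6 of the a + 7 copies of rx. The copy left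
      -- over is at most 2yn + rn/B + (a + 7)rν. Multiplied by B, the three errors are at most 1, 1
      -- and a + 7 times rn, whence a + 9.
      few-short : B * short (r * r) ≤ (a + 9) * n
      few-short = *-cancelˡ-≤ r (≤-by 0
        (+-mono-≤ (*-monoʳ-≤ B (short-degrees (r * r) (r * y) L ((a + 7) * r) r r up≤r))
        (+-mono-≤ (*-monoʳ-≤ B down≤) (+-mono-≤ (*-monoʳ-≤ B up≤) (+-mono-≤ mid≤
        (+-mono-≤ (*-monoʳ-≤ ((a + 7) * r) few-notFull) (*-monoʳ-≤ n r-large))))))
        (identity a r B n y (short (r * r)) (notFull ((a + 7) * r) r) _ _ _))
        where
        y : ℕ
        -- Chosen so that the error n(ar)² of `middle-edges`, divided by ry, is rn/B.
        y = a * a * B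
        instance
          y≢0 : NonZero y
          y≢0 = m*n≢0 (a * a) B {{m*n≢0 a a}}
          ry≢0 : NonZero (r * y)
          ry≢0 = m*n≢0 r y
          ar≢0 : NonZero (a * r)
          ar≢0 = m*n≢0 a r
        X? : ∀ v → Dec (¬ Tall (r * r) v)
        X? v = ¬? (tall? (r * r) v)
        down≤ : ∑[ v < n ] (∑[ a < n ] 𝟙 (X? a ×-dec X? v ×-dec near? (r * r) a v ×-dec U? a v)) ≤ 3 * (r * short (r * r))
        down≤ = *-cancelˡ-≤ r (≤-trans
          (≤-reflexive (cong (r *_) (∑-comm (λ v a → 𝟙 (X? a ×-dec X? v ×-dec near? (r * r) a v ×-dec U? a v)))))
          (≤-trans (short-edges (r * r) r X? X?) (≤-reflexive (eq r (short (r * r))))))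
          where
          eq : ∀ r x → 2 * (r * r * x) + r * r * x ≡ r * (3 * (r * x))
          eq = solve-∀
        up≤ : ∑[ v < n ] (∑[ a < n ] 𝟙 (X? v ×-dec yes tt ×-dec near? (r * y) v a ×-dec U? v a)) ≤ 2 * (y * n) + r * short (r * r)
        up≤ = *-cancelˡ-≤ r (≤-trans (short-edges (r * y) r X? (λ _ → yes tt)) (≤-reflexive
          (trans (cong (λ z → 2 * (r * y * z) + r * r * short (r * r)) (trans (sum-const n 1) (*-identityʳ n)))
            (eq r y n (short (r * r))))))
          where
          eq : ∀ r y n x → 2 * (r * y * n) + r * r * x ≡ r * (2 * (y * n) + r * x)
          eq = solve-∀
        mid≤ : B * ∑[ v < n ] (∑[ a < n ] 𝟙 (X? v ×-dec far? (r * y) v a ×-dec near? L v a ×-dec U? v a))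
          ≤ B * (a * r * short (r * r)) + n * r
        mid≤ = *-cancelˡ-≤ (r * y) (begin
          r * y * (B * Mid)                              ≡⟨ eq₁ (r * y) B Mid ⟩
          B * (r * y * Mid)                              ≤⟨ *-monoʳ-≤ B (middle-edges (r * y) L (a * r) L≤ X?) ⟩
          B * (a * r * (r * y * x + n * (a * r)))        ≡⟨ eq₂ a r B x n ⟩
          r * y * (B * (a * r * x) + n * r)              ∎)
          where
          open ≤-Reasoning
          x Mid : ℕ
          x = short (r * r)
          Mid = ∑[ v < n ] (∑[ a < n ] 𝟙 (X? v ×-dec far? (r * y) v a ×-dec near? L v a ×-dec U? v a))
          eq₁ : ∀ g B M → g * (B * M) ≡ B * (g * M)
          eq₁ = solve-∀
          eq₂ : ∀ a r B x n → B * (a * r * (r * (a * a * B) * x + n * (a * r))) ≡ r * (a * a * B) * (B * (a * r * x) + n * r)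
          eq₂ = solve-∀
        identity : ∀ a r B n y x ν D P M →
          r * (B * x) + (B * (D + P + M + (r + r) * x + (a + 7) * r * ν) + (B * (3 * (r * x)) + (B * (2 * (y * n) + r * x)
            + (B * (a * r * x) + n * r + ((a + 7) * r * n + n * r))))) + 0
          ≡ r * ((a + 9) * n) + (B * ((a + 7) * r * x) + (B * D + (B * P + (B * M
            + ((a + 7) * r * (B * ν) + n * (2 * y * B))))))
        identity = solve-∀

    -- A branch whose windows all send many edges far up

    module _ (a ℓ r B : ℕ) .{{_ : NonZero a}} .{{_ : NonZero r}} .{{_ : NonZero B}}
      (ℓ≤ : ℓ + 13 ≤ a * a)
      (B-large : (2 * ℓ + 4) * (1 + (ℓ + 5) * ((2 * ℓ + 4) * (a + 9))) ≤ B)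
      (r-large : 2 * (a * a * B) * B ≤ r)
      (few-notFull : B * notFull ((a + 7) * r) r ≤ n)
      (up≤r : ∀ v → up (ℓ * (r * r)) v ≤ r) (down≤r : ∀ v → down (ℓ * (r * r)) v ≤ r) where

      private
        h L L′ w M : ℕ
        -- `L′` is L + 2w: whatever lies less than L below a branch vertex of one window lies less
        -- than `L′` below each branch vertex of the next. `M` is 2L + 2w, the room that the final
        -- zigzag takes.
        h  = 2 * ℓ + 4
        L  = ℓ * (r * r)
        L′ = (ℓ + 4) * (r * r)
        w  = 2 * (r * r)
        M  = h * (r * r)

        square : ∀ x → x ≤ a * a → x * (r * r) ≤ (a * r) * (a * r)
        square x x≤ = ≤-trans (*-monoˡ-≤ (r * r) x≤) (≤-reflexive (eq a r))
          where
          eq : ∀ a r → a * a * (r * r) ≡ (a * r) * (a * r)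
          eq = solve-∀

        few : B * short (r * r) ≤ (a + 9) * n
        few = few-short a r B L (square ℓ (≤-trans (m≤m+n ℓ 13) ℓ≤)) r-large few-notFull up≤r

        Light Good : Fin n → Set
        Light u = descendants L′ u ≤ L′ + r * r
        Good u = Full ((a + 7) * r) r u × Tall M u × Light u

        light? : ∀ u → Dec (Light u)
        light? u = descendants L′ u ≤? L′ + r * r

        good? : ∀ u → Dec (Good u)
        good? u = full? ((a + 7) * r) r u ×-dec tall? M u ×-dec light? u

        heavy? : ∀ u → Dec (Tall M u × ¬ Light u)
        heavy? u = tall? M u ×-dec ¬? (light? u)

        heavy : ℕ
        heavy = ∑[ u < n ] 𝟙 (heavy? u)

        L′≤1+M : L′ ≤ suc M
        L′≤1+M = ≤-trans (*-monoˡ-≤ (r * r) (+-monoˡ-≤ 4 (m≤m+n ℓ _))) (n≤1+n M)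

        -- The average of descendants L′ is at most L′, and tall vertices reach it.
        few-heavy : heavy ≤ (ℓ + 4) * short M
        few-heavy = *-cancelˡ-≤ (r * r) {{m*n≢0 r r}} (≤-by 0 (+-mono-≤ sum-bound (sum-descendants≤ L′))
          (identity (r * r) heavy (n * L′) (∑[ u < n ] descendants L′ u) (short M) ℓ))
          where
          open ≤-Reasoning
          bound : ∀ u → L′ + r * r * 𝟙 (heavy? u) ≤ descendants L′ u + L′ * 𝟙 (¬? (tall? M u))
          bound u = cases (tall? M u) (light? u) (tall⇒descendants≥ L′≤1+M)
            where
            cases : ∀ {P : Set} {x} (d : Dec P) (d′ : Dec (x ≤ L′ + r * r)) → (P → L′ ≤ x) →
              L′ + r * r * 𝟙 (d ×-dec ¬? d′) ≤ x + L′ * 𝟙 (¬? d)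
            cases {x = x} (no _) d′ f = begin
              L′ + r * r * 0   ≡⟨ cong (L′ +_) (*-zeroʳ (r * r)) ⟩
              L′ + 0           ≡⟨ +-comm L′ 0 ⟩
              L′               ≡⟨ *-identityʳ L′ ⟨
              L′ * 1           ≤⟨ m≤n+m _ _ ⟩
              x + L′ * 1       ∎
            cases {x = x} (yes p) (yes _) f = +-mono-≤ (f p) (≤-trans (≤-reflexive (*-zeroʳ (r * r))) z≤n)
            cases {x = x} (yes p) (no x≰) f = begin
              L′ + r * r * 1   ≡⟨ cong (L′ +_) (*-identityʳ (r * r)) ⟩
              L′ + r * r       ≤⟨ <⇒≤ (≰⇒> x≰) ⟩
              x                ≤⟨ m≤m+n _ _ ⟩
              x + L′ * 0       ∎
          sum-bound : n * L′ + r * r * heavy ≤ ∑[ u < n ] descendants L′ u + L′ * short M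
          sum-bound = begin
            n * L′ + r * r * heavy
              ≡⟨ cong₂ _+_ (sum-const n L′) (sym (*-distribˡ-sum (r * r) (λ u → 𝟙 (heavy? u)))) ⟨
            ∑[ u < n ] L′ + ∑[ u < n ] (r * r * 𝟙 (heavy? u))
              ≡⟨ ∑-distrib-+ (λ _ → L′) (λ u → r * r * 𝟙 (heavy? u)) ⟨
            ∑[ u < n ] (L′ + r * r * 𝟙 (heavy? u))
              ≤⟨ sum-mono bound ⟩
            ∑[ u < n ] (descendants L′ u + L′ * 𝟙 (¬? (tall? M u)))
              ≡⟨ ∑-distrib-+ (descendants L′) (λ u → L′ * 𝟙 (¬? (tall? M u))) ⟩
            ∑[ u < n ] descendants L′ u + ∑[ u < n ] (L′ * 𝟙 (¬? (tall? M u)))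
              ≡⟨ cong (∑[ u < n ] descendants L′ u +_) (*-distribˡ-sum L′ (λ u → 𝟙 (¬? (tall? M u)))) ⟨
            ∑[ u < n ] descendants L′ u + L′ * short M ∎
          identity : ∀ q y N D Z ℓ → q * y + (D + (ℓ + 4) * q * Z + N) + 0 ≡ q * ((ℓ + 4) * Z) + (N + q * y + D)
          identity = solve-∀

        bad : ℕ
        bad = ∑[ u < n ] 𝟙 (¬? (good? u))

        bad≤ : bad ≤ notFull ((a + 7) * r) r + short M + heavy
        bad≤ = ≤-trans (sum-mono λ u → cases (full? ((a + 7) * r) r u) (tall? M u) (light? u))
          (≤-reflexive (∑-distrib-+₃ (λ u → 𝟙 (¬? (full? ((a + 7) * r) r u))) (λ u → 𝟙 (¬? (tall? M u))) (λ u → 𝟙 (heavy? u))))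
          where
          cases : ∀ {P Q R : Set} (p : Dec P) (q : Dec Q) (r : Dec R) →
            𝟙 (¬? (p ×-dec q ×-dec r)) ≤ 𝟙 (¬? p) + 𝟙 (¬? q) + 𝟙 (q ×-dec ¬? r)
          cases (yes _) (yes _) (yes _) = ≤-refl
          cases (yes _) (yes _) (no _)  = ≤-refl
          cases (yes _) (no _)  _       = ≤-refl
          cases (no _)  _       _       = s≤s z≤n

        -- By `few-heavy`, `bad` is at most ν + (ℓ + 5) · `short M` with ν the number of vertices
        -- that are not full, and `short M` is at most h · `short (r * r)` by subadditivity. With ν
        -- ≤ n/B and `few` the total is n/B times 1 + (ℓ + 5)h(a + 9); the requirement on `B` is
        -- read off from this.
        few-bad : h * bad ≤ n
        few-bad = *-cancelˡ-≤ B (≤-by 0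
          (+-mono-≤ (*-monoʳ-≤ (B * h) bad≤) (+-mono-≤ (*-monoʳ-≤ (B * h) few-heavy)
          (+-mono-≤ (*-monoʳ-≤ (B * h * (ℓ + 5)) (short-* h (r * r)))
          (+-mono-≤ (*-monoʳ-≤ h few-notFull) (+-mono-≤ (*-monoʳ-≤ (h * (ℓ + 5) * h) few) (*-monoʳ-≤ n B-large))))))
          (identity B h bad n ℓ a (notFull ((a + 7) * r) r) (short M) heavy (short (r * r))))
          where
          identity : ∀ B h b n ℓ a ν Z y x →
            B * (h * b) + (B * h * (ν + Z + y) + (B * h * ((ℓ + 4) * Z) + (B * h * (ℓ + 5) * (h * x)
              + (h * n + (h * (ℓ + 5) * h * ((a + 9) * n) + n * B))))) + 0
            ≡ B * n + (B * h * b + (B * h * y + (B * h * (ℓ + 5) * Z + (h * (B * ν)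
              + (h * (ℓ + 5) * h * (B * x) + n * (h * (1 + (ℓ + 5) * (h * (a + 9)))))))))
          identity = solve-∀

        GoodAt : Fin n → ℕ → Set
        GoodAt v j = ∃ λ u → anc par j v ≡ just u × Good u

        goodAt? : ∀ v j → Dec (GoodAt v j)
        goodAt? v j = Fin.any? λ u → anc? j v u ×-dec good? u

        -- Averaging over `v`: a good vertex is tall and so has at least M descendants at distance
        -- less than M, while M · `bad` is at most r²n. Hence the mean number of good vertices among
        -- the M lowest levels of a branch is at least M - r². Levels beyond the root count as bad,
        -- so this also forces the branch to be long.
        good-branch : Fin n → ∃ λ v → ∑[ j < M ] 𝟙 (¬? (goodAt? v (toℕ j))) ≤ r * r
        good-branch v₀ = let (v , M≤) = find v₀ in v , ≤-by 0 (+-mono-≤ M≤ (levels v))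
          (identity (goods v) M (r * r) (badLevels v) (goodLevels v) (count+count¬ (λ (j : Fin M) → goodAt? v (toℕ j))))
          where
          open ≤-Reasoning
          goods goodLevels badLevels : Fin n → ℕ
          goods v = ∑[ u < n ] 𝟙 (good? u ×-dec near? M v u)
          goodLevels v = ∑[ j < M ] 𝟙 (goodAt? v (toℕ j))
          badLevels v = ∑[ j < M ] 𝟙 (¬? (goodAt? v (toℕ j)))
          identity : ∀ G M q b g → g + b ≡ M → b + (G + q + g) + 0 ≡ q + (M + G)
          identity G _ q b g refl = lemma G q b g
            where
            lemma : ∀ G q b g → b + (G + q + g) + 0 ≡ q + (g + b + G)
            lemma = solve-∀
          levels : ∀ v → goods v ≤ goodLevels v
          levels v = begin
            goods v
              ≤⟨ sum-mono (λ u → 𝟙-≤ (good? u ×-dec near? M v u) (found u)) ⟩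
            ∑[ u < n ] (∑[ j < M ] 𝟙 (anc? (toℕ j) v u ×-dec good? u))
              ≡⟨ ∑-comm (λ u (j : Fin M) → 𝟙 (anc? (toℕ j) v u ×-dec good? u)) ⟩
            ∑[ j < M ] (∑[ u < n ] 𝟙 (anc? (toℕ j) v u ×-dec good? u))
              ≤⟨ sum-mono {M} (λ j → sum-unique-≤ (λ u → anc? (toℕ j) v u ×-dec good? u)
                   (λ (p , _) (q , _) → anc-unique (toℕ j) p q) (λ {u} p → 1≤𝟙 (goodAt? v (toℕ j)) (u , p))) ⟩
            goodLevels v ∎
            where
            found : ∀ u → Good u × Near M v u → 1 ≤ ∑[ j < M ] 𝟙 (anc? (toℕ j) v u ×-dec good? u)
            found u (g , j , j<M , eq) = ≤-trans
              (1≤𝟙 (anc? (toℕ (fromℕ< j<M)) v u ×-dec good? u)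
                (subst (λ i → anc par i v ≡ just u) (sym (Fin.toℕ-fromℕ< j<M)) eq , g))
              (term≤sum (λ j → 𝟙 (anc? (toℕ j) v u ×-dec good? u)) (fromℕ< j<M))
          total : n * M ≤ ∑[ v < n ] (goods v + r * r)
          total = ≤-by 0 (+-mono-≤ M*good≤ (*-monoʳ-≤ (r * r) few-bad))
            (trans (eq n h (r * r) bad (∑[ u < n ] 𝟙 (good? u)) (sum goods) (count+count¬ good?))
              (cong (_+ (M * ∑[ u < n ] 𝟙 (good? u) + r * r * (h * bad)))
                (sym (trans (∑-distrib-+ goods (λ _ → r * r)) (cong (sum goods +_) (sum-const n (r * r)))))))
            where
            M*good≤ : M * ∑[ u < n ] 𝟙 (good? u) ≤ sum goods
            M*good≤ = begin
              M * ∑[ u < n ] 𝟙 (good? u)                       ≡⟨ *-comm M _ ⟩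
              (∑[ u < n ] 𝟙 (good? u)) * M                     ≡⟨ *-distribʳ-sum M (λ u → 𝟙 (good? u)) ⟩
              ∑[ u < n ] (𝟙 (good? u) * M)                     ≤⟨ sum-mono (λ u → 𝟙-*-mono (good? u) λ (_ , tall , _) →
                                                                    tall⇒descendants≥ (n≤1+n M) tall) ⟩
              ∑[ u < n ] (𝟙 (good? u) * descendants M u)       ≡⟨ weighted-descendants M good? ⟩
              sum goods                                        ∎
            eq : ∀ n h q b g G → g + b ≡ n → n * (h * q) + (G + q * n) + 0 ≡ G + n * q + (h * q * g + q * (h * b))
            eq _ h q b g G refl = lemma h q b g G
              where
              lemma : ∀ h q b g G → (g + b) * (h * q) + (G + q * (g + b)) + 0 ≡ G + (g + b) * q + (h * q * g + q * (h * b))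
              lemma = solve-∀
          find : Fin n → ∃ λ v → M ≤ goods v + r * r
          find v₀ = pigeonhole v₀ (λ v → goods v + r * r) total

        many-good : ∀ {v} → ∑[ j < M ] 𝟙 (¬? (goodAt? v (toℕ j))) ≤ r * r → ∀ i → i + w ≤ M →
          r * r ≤ ∑[ j < w ] 𝟙 (goodAt? v (i + toℕ j))
        many-good {v} few i i+w≤M = ≤-by 0 (≤-trans (sum-window i w (λ j → 𝟙 (¬? (goodAt? v j))) i+w≤M) few)
          (trans (eq (r * r)) (sym (count+count¬ {w} (λ j → goodAt? v (i + toℕ j)))))
          where
          eq : ∀ q → q + q + 0 ≡ 2 * q
          eq = solve-∀

        -- Suppose that every good vertex of the window has fewer than r edges reaching 3w up. Then
        -- each sends (a + 4)r edges into the set A of vertices near the window, and `density` with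
        -- κ = ar gives (a + 4)rs ≤ ar(s + ar) for the number s of good vertices. As s ≥ r², this
        -- yields 4r ≤ a², against a² ≤ r.
        window-edges : ∀ {v} → ∑[ j < M ] 𝟙 (¬? (goodAt? v (toℕ j))) ≤ r * r → ∀ i → i + (w + w) ≤ M →
          ∃ λ j → ∃ λ x → i ≤ j × j < i + w × anc par j v ≡ just x × r ≤ up (3 * w) x
        window-edges {v} few i i+2w≤M
          -- A good vertex of the next window: being light, it limits how many vertices lie less
          -- than L below the present window, side subtrees included.
          with (j₂ , t , anc-t , _ , _ , light) ← sum-find {w} (λ j → goodAt? v (i + w + toℕ j))
                 (<-≤-trans (>-nonZero⁻¹ (r * r) {{m*n≢0 r r}})
                   (many-good few (i + w) (≤-trans (≤-reflexive (+-assoc i w w)) i+2w≤M)))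
          with (b , anc-b , b→t) ← anc-≤ {i = i} (≤-trans (m≤m+n i w) (m≤m+n (i + w) (toℕ j₂))) anc-t
          with Fin.any? (λ x → near? w b x ×-dec good? x ×-dec r ≤? up (3 * w) x)
        ... | yes (x , (j , j<w , eq) , _ , r≤) =
          i + j , x , m≤m+n i j , +-monoʳ-< i j<w , anc-+ i j anc-b eq , r≤
        ... | no none = contradiction (≤-trans 4r≤a² a²≤r) (<⇒≱ (m<m+n r (≤-trans (>-nonZero⁻¹ r) (m≤m+n r _))))
          where
          open ≤-Reasoning
          S? : ∀ x → Dec (Near w b x × Good x)
          S? x = near? w b x ×-dec good? x
          A? : ∀ x → Dec (Near L′ x t ⊎ Near (4 * w) b x)
          A? x = near? L′ x t ⊎-dec near? (4 * w) b x
          s : ℕ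
          s = ∑[ x < n ] 𝟙 (S? x)
          -- The lightness of `t` contributes (ℓ + 4)r² + r², and the 4w = 8r² nearest ancestors of
          -- `b` the rest; the sum explains the 13 in ℓ + 13 ≤ a².
          ∣A∣≤ : ∑[ x < n ] 𝟙 (A? x) ≤ (a * r) * (a * r)
          ∣A∣≤ = begin
            ∑[ x < n ] 𝟙 (A? x)
              ≤⟨ sum-mono (λ x → 𝟙-⊎-≤ (A? x) (near? L′ x t) (near? (4 * w) b x) λ p → p) ⟩
            ∑[ x < n ] (𝟙 (near? L′ x t) + 𝟙 (near? (4 * w) b x))
              ≡⟨ ∑-distrib-+ (λ x → 𝟙 (near? L′ x t)) (λ x → 𝟙 (near? (4 * w) b x)) ⟩
            descendants L′ t + ∑[ x < n ] 𝟙 (near? (4 * w) b x)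
              ≤⟨ +-mono-≤ light (ancestors≤ (4 * w) b) ⟩
            (ℓ + 4) * (r * r) + r * r + 4 * (2 * (r * r))
              ≡⟨ eq ℓ (r * r) ⟩
            (ℓ + 13) * (r * r)
              ≤⟨ square (ℓ + 13) ℓ≤ ⟩
            (a * r) * (a * r) ∎
            where
            eq : ∀ ℓ q → (ℓ + 4) * q + q + 4 * (2 * q) ≡ (ℓ + 13) * q
            eq = solve-∀
          s≥ : r * r ≤ s
          s≥ = begin
            r * r
              ≤⟨ many-good few i (≤-trans (+-monoʳ-≤ i (m≤m+n w w)) i+2w≤M) ⟩
            ∑[ j < w ] 𝟙 (goodAt? v (i + toℕ j))
              ≤⟨ sum-mono {w} (λ j → 𝟙-≤ (goodAt? v (i + toℕ j)) λ (u , eq , good) →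
                   ≤-trans (1≤𝟙 (q? j u) (subst (λ z → anc par z b ≡ just u) (m+n∸m≡n i (toℕ j))
                     (anc-between (m≤m+n i (toℕ j)) anc-b eq) , good)) (term≤sum (λ u → 𝟙 (q? j u)) u)) ⟩
            ∑[ j < w ] (∑[ u < n ] 𝟙 (q? j u))
              ≤⟨ levels≤ S? q? (λ (p , _) (q , _) → Fin.toℕ-injective (distance-unique _ _ p q))
                   (λ {j} (p , good) → (toℕ j , Fin.toℕ<n j , p) , good) ⟩
            s ∎
            where
            q? : (j : Fin w) → ∀ u → Dec (anc par (toℕ j) b ≡ just u × Good u)
            q? j u = anc? (toℕ j) b u ×-dec good? u
          classify : ∀ x → Near w b x × Good x → ∀ c →
            𝟙 (U? x c) ≤ 𝟙 (A? c ×-dec S? x ×-dec U? c x) + 𝟙 (U? x c ×-dec far? (3 * w) x c) + 𝟙 (U? x c ×-dec far? L c x)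
          classify x (near@(j , j<w , b→x) , good) c = 𝟙-≤ (U? x c) λ e → case e (vertical e)
            where
            case : U x c → _ → 1 ≤ 𝟙 (A? c ×-dec S? x ×-dec U? c x) + 𝟙 (U? x c ×-dec far? (3 * w) x c) + 𝟙 (U? x c ×-dec far? L c x)
            inside : U x c → Near L′ c t ⊎ Near (4 * w) b c → _
            inside e p = ≤-trans (1≤𝟙 (A? c ×-dec S? x ×-dec U? c x) (p , (near , good) , U-sym e))
              (≤-trans (m≤m+n _ (𝟙 (U? x c ×-dec far? (3 * w) x c))) (m≤m+n _ (𝟙 (U? x c ×-dec far? L c x))))
            case e (inj₁ (j′ , eq)) with j′ <? 3 * w
            ... | yes j′<3w = inside e (inj₂ (j + j′ , +-mono-<-≤ j<w (<⇒≤ j′<3w) , anc-+ j j′ b→x eq))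
            ... | no  j′≮3w = ≤-trans (1≤𝟙 (U? x c ×-dec far? (3 * w) x c) (e , j′ , ≮⇒≥ j′≮3w , eq))
              (≤-trans (m≤n+m _ (𝟙 (A? c ×-dec S? x ×-dec U? c x))) (m≤m+n _ (𝟙 (U? x c ×-dec far? L c x))))
            case e (inj₂ (j′ , eq)) with j′ <? L
            ... | no  j′≮L = ≤-trans (1≤𝟙 (U? x c ×-dec far? L c x) (e , j′ , ≮⇒≥ j′≮L , eq)) (m≤n+m _ _)
            ... | yes j′<L = inside e (inj₁ (j′ + d , distance , anc-+ j′ d eq (anc-between j≤ b→x b→t)))
              where
              D d : ℕ
              D = i + w + toℕ j₂ ∸ i
              d = D ∸ j
              D≡ : D ≡ w + toℕ j₂
              D≡ = trans (cong (_∸ i) (+-assoc i w (toℕ j₂))) (m+n∸m≡n i (w + toℕ j₂))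
              j≤ : j ≤ D
              j≤ = ≤-trans (<⇒≤ j<w) (≤-trans (m≤m+n w (toℕ j₂)) (≤-reflexive (sym D≡)))
              distance : j′ + d < L′
              distance = <-≤-trans (+-mono-<-≤ j′<L (≤-trans (m∸n≤m D j) (≤-trans (≤-reflexive D≡)
                (+-monoʳ-≤ w (<⇒≤ (Fin.toℕ<n j₂)))))) (≤-reflexive (eq′ ℓ (r * r)))
                where
                eq′ : ∀ ℓ q → ℓ * q + (2 * q + 2 * q) ≡ (ℓ + 4) * q
                eq′ = solve-∀
          -- Of (a + 7)r edges, at most r each are tested, reach 3w or more up, or reach L or more
          -- down.
          inner : ∀ x → Near w b x × Good x → (a + 4) * r ≤ ∑[ c < n ] 𝟙 (A? c ×-dec S? x ×-dec U? c x)
          inner x p@(near , good@(full , _)) = ≤-by 0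
            (+-mono-≤ full (+-mono-≤ degree≤ (+-mono-≤ (<⇒≤ (≰⇒> λ r≤ → none (x , near , good , r≤))) (down≤r x))))
            (identity a r (degree x) (∑[ c < n ] 𝟙 (A? c ×-dec S? x ×-dec U? c x)) (up (3 * w) x) (down L x))
            where
            degree≤ : degree x ≤ ∑[ c < n ] 𝟙 (A? c ×-dec S? x ×-dec U? c x) + up (3 * w) x + down L x
            degree≤ = ≤-trans (sum-mono (classify x p)) (≤-reflexive (∑-distrib-+₃
              (λ c → 𝟙 (A? c ×-dec S? x ×-dec U? c x)) (λ c → 𝟙 (U? x c ×-dec far? (3 * w) x c)) (λ c → 𝟙 (U? x c ×-dec far? L c x))))
            identity : ∀ a r δ e u d → (a + 4) * r + (δ + r + (e + u + d + (r + r))) + 0 ≡ e + ((a + 7) * r + (δ + (u + d)))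
            identity = solve-∀
          edges≥ : (a + 4) * r * s ≤ edges A? S?
          edges≥ = begin
            (a + 4) * r * s
              ≡⟨ *-comm ((a + 4) * r) s ⟩
            s * ((a + 4) * r)
              ≡⟨ *-distribʳ-sum ((a + 4) * r) (λ x → 𝟙 (S? x)) ⟩
            ∑[ x < n ] (𝟙 (S? x) * ((a + 4) * r))
              ≤⟨ sum-mono (λ x → 𝟙-*-≤ (S? x) (inner x)) ⟩
            ∑[ x < n ] (∑[ c < n ] 𝟙 (A? c ×-dec S? x ×-dec U? c x))
              ≡⟨ ∑-comm (λ x c → 𝟙 (A? c ×-dec S? x ×-dec U? c x)) ⟩
            edges A? S? ∎
          4r≤a² : 4 * r ≤ a * a
          4r≤a² = *-cancelˡ-≤ (r * r) {{m*n≢0 r r}} (≤-by 0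
            (+-mono-≤ (≤-trans edges≥ (density A? S? (a * r) {{m*n≢0 a r}} ∣A∣≤)) (*-monoʳ-≤ (4 * r) s≥)) (identity a r s))
            where
            identity : ∀ a r s → r * r * (4 * r) + (a * r * (s + a * r) + 4 * r * s) + 0 ≡ r * r * (a * a) + ((a + 4) * r * s + 4 * r * (r * r))
            identity = solve-∀
          a²≤r : a * a ≤ r
          a²≤r = begin
            a * a                  ≤⟨ m≤m*n (a * a) B ⟩
            a * a * B              ≤⟨ m≤m+n _ _ ⟩
            2 * (a * a * B)        ≤⟨ m≤m*n _ B ⟩
            2 * (a * a * B) * B    ≤⟨ r-large ⟩
            r                      ∎

      climbing-branch : Fin n → ∃ λ v → ∀ i → i + (w + w) ≤ M →
        ∃ λ j → ∃ λ x → i ≤ j × j < i + w × anc par j v ≡ just x × r ≤ up (3 * w) x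
      climbing-branch v₀ = let (v , few) = good-branch v₀ in v , window-edges few

  -- Cycles along a branch of the forest

  data Path {A : Set} (R : A → A → Set) : A → A → List A → Set where
    end : ∀ {u} → Path R u u [ u ]
    _◅_ : ∀ {u v w l} → R u w → Path R w v l → Path R u v (u ∷ l)

  module _ {A : Set} {R : A → A → Set} where

    snoc : ∀ {u v w l} → Path R u v l → R v w → Path R u w (l ∷ʳ w)
    snoc end      s = s ◅ end
    snoc (r ◅ rs) s = r ◅ snoc rs s

    reversePath : (∀ {u v} → R u v → R v u) → ∀ {u v l} → Path R u v l → Path R v u (reverse l)
    reversePath R-sym end = end
    reversePath R-sym (_◅_ {u} {v} {l = l} r rs) =
      subst (Path R v u) (sym (unfold-reverse u l)) (snoc (reversePath R-sym rs) (R-sym r))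

    closePath : ∀ {u v w l} → Path R u v l → R v w → Linked R (l ++ [ w ])
    closePath end                s = s ∷ [-]
    closePath (r ◅ end)          s = r ∷ s ∷ [-]
    closePath (r ◅ rs@(_ ◅ _))   s = r ∷ closePath rs s

    mapPath : ∀ {S : A → A → Set} → (∀ {u v} → R u v → S u v) → ∀ {u v l} → Path R u v l → Path S u v l
    mapPath f end      = end
    mapPath f (r ◅ rs) = f r ◅ mapPath f rs

  unique-reverse : ∀ {A : Set} {l : List A} → Unique l → Unique (reverse l)
  unique-reverse {l = []}    [] = []
  unique-reverse {l = x ∷ l} (x∉l ∷ unique) = subst Unique (sym (unfold-reverse x l))
    (Unique.++⁺ (unique-reverse unique) ([] ∷ []) λ { (y∈ , here refl) →
      All.lookup (All-resp-↭ (↭-sym (↭-reverse l)) x∉l) y∈ refl })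
    where
    open import Data.List.Relation.Unary.Any using (here)

  -- Revealed coins as present and untested edges

  module RandomGraph {n} (G : Graph n) where

    edge : Fin n → Fin n → Fin (n * n)
    edge u v = if toℕ u <ᵇ toℕ v then combine u v else combine v u

    coin≡lookup : (c : Coins n) → ∀ u v → coin c u v ≡ lookup c (edge u v)
    coin≡lookup c u v with toℕ u <ᵇ toℕ v
    ... | true  = refl
    ... | false = refl

    edge-sym : ∀ u v → edge u v ≡ edge v u
    edge-sym u v with toℕ u <ᵇ toℕ v in eq₁ | toℕ v <ᵇ toℕ u in eq₂
    ... | true  | false = refl
    ... | false | true  = refl
    ... | true  | true  = contradiction (<ᵇ⇒< (toℕ u) (toℕ v) (subst T (sym eq₁) _)) (<-asym (<ᵇ⇒< (toℕ v) (toℕ u) (subst T (sym eq₂) _)))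
    ... | false | false = cong₂ combine (sym u≡v) u≡v
      where
      u≡v : u ≡ v
      u≡v = Fin.toℕ-injective (≤-antisym (≮⇒≥ (λ lt → subst T eq₂ (<⇒<ᵇ lt))) (≮⇒≥ (λ lt → subst T eq₁ (<⇒<ᵇ lt))))

    edge-injective : ∀ {u v a b} → edge u v ≡ edge a b → (u ≡ a × v ≡ b) ⊎ (u ≡ b × v ≡ a)
    edge-injective {u} {v} {a} {b} eq with toℕ u <ᵇ toℕ v | toℕ a <ᵇ toℕ b
    ... | true  | true  = inj₁ (Fin.combine-injective u v a b eq)
    ... | true  | false = inj₂ (Fin.combine-injective u v b a eq)
    ... | false | true  = let (v≡a , u≡b) = Fin.combine-injective v u a b eq in inj₂ (u≡b , v≡a)
    ... | false | false = let (v≡b , u≡a) = Fin.combine-injective v u b a eq in inj₁ (u≡a , v≡b)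

    record Present (σ : Revealed (n * n)) (u v : Fin n) : Set where
      constructor present
      field
        adjacent : adj G u v ≡ true
        kept     : lookup σ (edge u v) ≡ just true

    record Untested (σ : Revealed (n * n)) (u v : Fin n) : Set where
      constructor untested
      field
        adjacent : adj G u v ≡ true
        hidden   : lookup σ (edge u v) ≡ nothing

    untested? : ∀ σ u v → Dec (Untested σ u v)
    untested? σ u v = map′ (λ (a , h) → untested a h) (λ (untested a h) → a , h)
      (adj G u v Bool.≟ true ×-dec Maybe.≡-dec Bool._≟_ (lookup σ (edge u v)) nothing)

    present-sym : ∀ {σ u v} → Present σ u v → Present σ v u
    present-sym {σ} {u} {v} (present a eq) = present (trans (Graph.sym G v u) a) (trans (cong (lookup σ) (edge-sym v u)) eq)

    untested-sym : ∀ {σ u v} → Untested σ u v → Untested σ v u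
    untested-sym {σ} {u} {v} (untested a eq) = untested (trans (Graph.sym G v u) a) (trans (cong (lookup σ) (edge-sym v u)) eq)

    reveal-present : ∀ {σ i u v} b → lookup σ i ≡ nothing → Present σ u v → Present (σ [ i ]≔ just b) u v
    reveal-present {σ} {i} {u} {v} b σi (present a eq) = present a (trans (lookup∘update′ edge≢i σ (just b)) eq)
      where
      edge≢i : edge u v ≢ i
      edge≢i refl with () ← trans (sym eq) σi

    present⇒subgraph : ∀ {σ} {c : Coins n} → Consistent σ c → ∀ {u v} → Present σ u v → Adj (subgraph G c) u v
    present⇒subgraph {c = c} cons {u} {v} (present a eq) =
      subst T (sym (cong₂ _∧_ a (trans (coin≡lookup c u v) (cons (edge u v) eq)))) _

    module Branch (par : Fin n → Maybe (Fin n)) (dep : Fin n → ℕ)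
      (par-dep : ∀ {v u} → par v ≡ just u → dep v ≡ suc (dep u)) where

      open RootedForest par dep par-dep

      TreePresent : Revealed (n * n) → Set
      TreePresent σ = ∀ {v u} → par v ≡ just u → Present σ v u

      -- A path with m vertices joining the ancestors lo and hi of v whose other vertices are
      -- ancestors below lo, so that the ancestors strictly between lo and hi remain available.
      record Ladder (v : Fin n) (σ : Revealed (n * n)) (lo hi m : ℕ) : Set where
        field
          {bottom top} : Fin n
          {vertices}   : List (Fin n)
          bottom-at : anc par lo v ≡ just bottom
          top-at    : anc par hi v ≡ just top
          path      : Path (Present σ) bottom top vertices
          unique    : Unique vertices
          places    : All (λ y → ∃ λ j → anc par j v ≡ just y × (j ≤ lo ⊎ j ≡ hi)) vertices
          length≡   : length vertices ≡ m
      open Ladder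

      reveal-ladder : ∀ {v σ lo hi m i} b → lookup σ i ≡ nothing → Ladder v σ lo hi m → Ladder v (σ [ i ]≔ just b) lo hi m
      reveal-ladder b σi lad = record
        { bottom-at = bottom-at lad ; top-at = top-at lad ; path = mapPath (reveal-present b σi) (path lad)
        ; unique = unique lad ; places = places lad ; length≡ = length≡ lad }

      apart : ∀ {v x y} i j → i ≢ j → anc par i v ≡ just x → anc par j v ≡ just y → x ≢ y
      apart i j i≢j p q refl = i≢j (distance-unique i j p q)

      rung : ∀ {v σ x y} i j → i < j → anc par i v ≡ just x → anc par j v ≡ just y → Present σ x y → Ladder v σ i j 2
      rung i j i<j p q e = record
        { bottom-at = p ; top-at = q ; path = e ◅ end
        ; unique = (apart i j (<⇒≢ i<j) p q ∷ []) ∷ [] ∷ []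
        ; places = (i , p , inj₁ ≤-refl) ∷ (j , q , inj₂ refl) ∷ [] ; length≡ = refl }

      parent-at : ∀ {v x y} j → anc par j v ≡ just x → anc par (suc j) v ≡ just y → par x ≡ just y
      parent-at {v} {x} {y} j p q
        with (u , eq , eq′) ← anc-suc⁻¹ {par = par} 0 (subst (λ i → anc par i x ≡ just y) (m+n∸n≡m 1 j)
               (anc-between (n≤1+n j) p q)) = trans eq eq′

      -- The lower end follows one tree edge upwards; the strict inequality keeps the new vertex
      -- apart from the top.
      raise : ∀ {v σ lo hi m} → TreePresent σ → suc lo < hi → Ladder v σ lo hi m → Ladder v σ (suc lo) hi (suc m)
      raise {v} {σ} {lo} {hi} tree 1+lo<hi lad with (y , y-at , _) ← anc-≤ (<⇒≤ 1+lo<hi) (top-at lad) = record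
        { bottom-at = y-at ; top-at = top-at lad
        ; path = present-sym (tree (parent-at lo (bottom-at lad) y-at)) ◅ path lad
        ; unique = All.map new (places lad) ∷ unique lad
        ; places = (suc lo , y-at , inj₁ ≤-refl) ∷ All.map weaken (places lad)
        ; length≡ = cong suc (length≡ lad) }
        where
        new : ∀ {z} → (∃ λ j → anc par j v ≡ just z × (j ≤ lo ⊎ j ≡ hi)) → y ≢ z
        new (j , z-at , inj₁ j≤lo) = apart (suc lo) j (>⇒≢ (s≤s j≤lo)) y-at z-at
        new (j , z-at , inj₂ refl) = apart (suc lo) j (<⇒≢ 1+lo<hi) y-at z-at
        weaken : ∀ {z} → (∃ λ j → anc par j v ≡ just z × (j ≤ lo ⊎ j ≡ hi)) → ∃ λ j → anc par j v ≡ just z × (j ≤ suc lo ⊎ j ≡ hi)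
        weaken (j , z-at , inj₁ j≤lo) = j , z-at , inj₁ (m≤n⇒m≤1+n j≤lo)
        weaken (j , z-at , inj₂ j≡hi) = j , z-at , inj₂ j≡hi

      raises : ∀ {v σ lo hi m} d → TreePresent σ → lo + d < hi → Ladder v σ lo hi m → Ladder v σ (lo + d) hi (m + d)
      raises {v} {σ} {lo} {hi} {m} zero tree _ lad =
        subst₂ (λ l k → Ladder v σ l hi k) (sym (+-identityʳ lo)) (sym (+-identityʳ m)) lad
      raises {v} {σ} {lo} {hi} {m} (suc d) tree lt lad =
        subst₂ (λ l k → Ladder v σ l hi k) (sym (+-suc lo d)) (sym (+-suc m d))
          (raise tree lt′ (raises d tree (<-trans (n<1+n _) lt′) lad))
        where
        lt′ : suc (lo + d) < hi
        lt′ = subst (_< hi) (+-suc lo d) lt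

      -- The new edge is attached to the lower end and the path is then reversed, so the old top
      -- becomes the lower end from which the climb continues. The levels strictly between the old
      -- ends are skipped for good, and every old vertex sits at level `hi` or below, as `places`
      -- demands.
      jump : ∀ {v σ lo hi m new y} → lo < hi → hi < new → (lad : Ladder v σ lo hi m) → anc par new v ≡ just y →
        Present σ (bottom lad) y → Ladder v σ hi new (suc m)
      jump {v} {σ} {lo} {hi} {m} {new} {y} lo<hi hi<new lad y-at e = record
        { bottom-at = top-at lad ; top-at = y-at
        ; path = reversePath present-sym (present-sym e ◅ path lad)
        ; unique = unique-reverse (All.map fresh (places lad) ∷ unique lad)
        ; places = All-resp-↭ (↭-sym (↭-reverse _)) ((new , y-at , inj₂ refl) ∷ All.map below (places lad))
        ; length≡ = trans (length-reverse (y ∷ vertices lad)) (cong suc (length≡ lad)) }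
        where
        ≤hi : ∀ {j} → j ≤ lo ⊎ j ≡ hi → j ≤ hi
        ≤hi (inj₁ j≤lo) = ≤-trans j≤lo (<⇒≤ lo<hi)
        ≤hi (inj₂ refl) = ≤-refl
        fresh : ∀ {z} → (∃ λ j → anc par j v ≡ just z × (j ≤ lo ⊎ j ≡ hi)) → y ≢ z
        fresh (j , z-at , p) = apart new j (>⇒≢ (≤-<-trans (≤hi p) hi<new)) y-at z-at
        below : ∀ {z} → (∃ λ j → anc par j v ≡ just z × (j ≤ lo ⊎ j ≡ hi)) → ∃ λ j → anc par j v ≡ just z × (j ≤ hi ⊎ j ≡ new)
        below (j , z-at , p) = j , z-at , inj₁ (≤hi p)

      Cycle : Revealed (n * n) → ℕ → Set
      Cycle σ m = ∃ λ x → ∃ λ xs → Unique (x ∷ xs) × Linked (Present σ) (x ∷ xs ++ [ x ]) × suc (length xs) ≡ m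

      -- The path climbs through the d free levels, gaining one vertex on each, and the last tree
      -- edge below the top closes it.
      close : ∀ {v σ lo d m} → TreePresent σ → Ladder v σ lo (suc (lo + d)) m → Cycle σ (m + d)
      close {σ = σ} {d = d} tree lad = finish (raises d tree ≤-refl lad)
        where
        finish : ∀ {v lo m} → Ladder v σ lo (suc lo) m → Cycle σ m
        finish {lo = lo} record { bottom-at = p ; top-at = q ; path = end } = contradiction refl (apart lo (suc lo) (<⇒≢ (n<1+n lo)) p q)
        finish {lo = lo} record { bottom-at = p ; top-at = q ; path = rs@(_ ◅ _) ; unique = unique ; length≡ = length≡ } =
          _ , _ , unique , closePath rs (present-sym (tree (parent-at lo p q))) , length≡

  -- Sprinkling the untested edges

  length-filter : ∀ {n} {A : Set} {P : A → Set} (P? : ∀ a → Dec (P a)) (f : Fin n → A) →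
    length (filter P? (tabulate f)) ≡ ∑[ i < n ] 𝟙 (P? (f i))
  length-filter {zero}  P? f = refl
  length-filter {suc n} P? f with P? (f Fin.zero)
  ... | yes _ = cong suc (length-filter P? (f ∘ Fin.suc))
  ... | no  _ = length-filter P? (f ∘ Fin.suc)

  module Search {n} (G : Graph n) (p : ℚ) (0≤p : 0ℚ ℚ.≤ p) (p≤1 : p ℚ.≤ 1ℚ)
    (f : Coins n → ℚ) (f≤1 : ∀ c → f c ℚ.≤ 1ℚ) (r : ℕ)
    (par : Fin n → Maybe (Fin n)) (dep : Fin n → ℕ)
    (par-dep : ∀ {v u} → par v ≡ just u → dep v ≡ suc (dep u))
    (σ₀ : Revealed (n * n)) where

    open RandomGraph G
    open Branch par dep par-dep
    open RootedForest par dep par-dep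
    open Bernoulli p 0≤p p≤1

    try-edges : ∀ x {C : Fin n → Set} (C? : ∀ c → Dec (C c)) → r ≤ ∑[ c < n ] 𝟙 (C? c) →
      ∀ β → 0ℚ ℚ.≤ β → (Inv : Revealed (n * n) → Set) →
      (∀ {σ c} → C c → Inv σ → lookup σ (edge x c) ≡ nothing →
        Inv (σ [ edge x c ]≔ just false) × E p (σ [ edge x c ]≔ just true) f ℚ.≤ β) →
      ∀ {σ} → Inv σ → (∀ {c} → C c → lookup σ (edge x c) ≡ nothing) → E p σ f ℚ.≤ β ℚ.+ miss r
    try-edges x {C} C? r≤ β 0≤β Inv step {σ} inv hidden = ℚ.≤-trans
      (try-all f f≤1 β 0≤β Inv es (Unique.map⁺ injective (Unique.filter⁺ C? (Unique.allFin⁺ n))) step′ inv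
        (All.tabulate λ e∈ → let (c , Cc , e≡) = candidate e∈ in trans (cong (lookup σ) e≡) (hidden Cc)))
      (ℚ.+-monoʳ-≤ β (miss-antitone (≤⇒≤′ (≤-trans r≤ (≤-reflexive (sym length-es))))))
      where
      es : List (Fin (n * n))
      es = map (edge x) (filter C? (allFin n))
      length-es : length es ≡ ∑[ c < n ] 𝟙 (C? c)
      length-es = trans (length-map (edge x) (filter C? (allFin n))) (length-filter C? (λ i → i))
      injective : ∀ {c c′} → edge x c ≡ edge x c′ → c ≡ c′
      injective eq with edge-injective eq
      ... | inj₁ (_ , c≡c′)    = c≡c′
      ... | inj₂ (x≡c′ , c≡x)  = trans c≡x x≡c′
      candidate : ∀ {e} → e ∈ es → ∃ λ c → C c × e ≡ edge x c
      candidate e∈ with (c , c∈ , e≡) ← ∈-map⁻ (edge x) e∈ = c , proj₂ (∈-filter⁻ C? {xs = allFin n} c∈) , e≡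
      step′ : ∀ {σ e} → e ∈ es → Inv σ → lookup σ e ≡ nothing → Inv (σ [ e ]≔ just false) × E p (σ [ e ]≔ just true) f ℚ.≤ β
      step′ e∈ inv σe with (c , Cc , refl) ← candidate e∈ = step Cc inv σe

    module _ (L : ℕ) (cycle⇒0 : ∀ {σ m} → L ≤ m → Cycle σ m → E p σ f ≡ 0ℚ) (tree₀ : TreePresent σ₀) where

      reveal-tree : ∀ {σ i} b → lookup σ i ≡ nothing → TreePresent σ → TreePresent (σ [ i ]≔ just b)
      reveal-tree b σi tree eq = reveal-present b σi (tree eq)

      revealed-present : ∀ {σ x c} → Untested σ₀ x c → Present (σ [ edge x c ]≔ just true) x c
      revealed-present {σ} {x} {c} u = present (Untested.adjacent u) (lookup∘update (edge x c) σ (just true))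

      shortcut : ∀ {v σ y} j → L ≤ j → anc par j v ≡ just y → TreePresent σ → Present σ v y → 0 < j → E p σ f ℚ.≤ 0ℚ
      shortcut (suc j) L≤ eq tree e _ = ℚ.≤-reflexive
        (cycle⇒0 (m≤n⇒m≤1+n L≤) (close tree (rung 0 (suc j) (s≤s z≤n) refl eq e)))

      try-up : ∀ {v} → 0 < L → r ≤ ∑[ a < n ] 𝟙 (untested? σ₀ v a ×-dec far? L v a) → E p σ₀ f ℚ.≤ 0ℚ ℚ.+ miss r
      try-up {v} 0<L r≤ = try-edges v (λ a → untested? σ₀ v a ×-dec far? L v a) r≤ 0ℚ ℚ.≤-refl TreePresent
        (λ (u , j , L≤ , eq) tree σe → reveal-tree false σe tree ,
          shortcut j L≤ eq (reveal-tree true σe tree) (revealed-present u) (<-≤-trans 0<L L≤))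
        tree₀ (λ (u , _) → Untested.hidden u)

      try-down : ∀ {v} → 0 < L → r ≤ ∑[ a < n ] 𝟙 (untested? σ₀ v a ×-dec far? L a v) → E p σ₀ f ℚ.≤ 0ℚ ℚ.+ miss r
      try-down {v} 0<L r≤ = try-edges v (λ a → untested? σ₀ v a ×-dec far? L a v) r≤ 0ℚ ℚ.≤-refl TreePresent
        (λ (u , j , L≤ , eq) tree σe → reveal-tree false σe tree ,
          shortcut j L≤ eq (reveal-tree true σe tree) (present-sym (revealed-present u)) (<-≤-trans 0<L L≤))
        tree₀ (λ (u , _) → Untested.hidden u)

      -- A union bound: each stage of the zigzag tests at least r edges and is lost only if all of
      -- them are absent.
      failure : ℕ → ℚ
      failure zero       = 0ℚ
      failure (suc fuel) = failure fuel ℚ.+ miss r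

      0≤failure : ∀ fuel → 0ℚ ℚ.≤ failure fuel
      0≤failure zero       = ℚ.≤-refl
      0≤failure (suc fuel) = ℚ.+-mono-≤ (0≤failure fuel) (0≤miss r)

      module _ (w M : ℕ) (0<w : 0 < w) (M-large : 2 * L + 2 * w ≤ M) (v : Fin n)
        (climb : ∀ i → i + (w + w) ≤ M → ∃ λ j → ∃ λ x → i ≤ j × j < i + w × anc par j v ≡ just x ×
          r ≤ ∑[ a < n ] 𝟙 (untested? σ₀ x a ×-dec far? (3 * w) x a)) where

        -- Earlier stages test edges at branch vertices of level at most `lo` only, so the edges
        -- with both ends on the branch above `lo` are as fresh as they were in `σ₀`.
        Hidden : ℕ → Revealed (n * n) → Set
        Hidden lo σ = ∀ {x y} i j → lo < i → i < j → anc par i v ≡ just x → anc par j v ≡ just y →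
          Untested σ₀ x y → lookup σ (edge x y) ≡ nothing

        hidden-mono : ∀ {lo lo′ σ} → lo ≤ lo′ → Hidden lo σ → Hidden lo′ σ
        hidden-mono lo≤lo′ hid i j lo′<i = hid i j (≤-<-trans lo≤lo′ lo′<i)

        reveal-hidden : ∀ {lo σ x c} b k → k ≤ lo → anc par k v ≡ just x → Hidden lo σ → Hidden lo (σ [ edge x c ]≔ just b)
        reveal-hidden {lo} {σ} {x} {c} b k k≤lo x-at hid {y} {z} i j lo<i i<j y-at z-at u =
          trans (lookup∘update′ (other ∘ edge-injective) σ (just b)) (hid i j lo<i i<j y-at z-at u)
          where
          other : (y ≡ x × z ≡ c) ⊎ (y ≡ c × z ≡ x) → _
          other (inj₁ (y≡x , _)) = apart i k (>⇒≢ (≤-<-trans k≤lo lo<i)) y-at x-at y≡x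
          other (inj₂ (_ , z≡x)) = apart j k (>⇒≢ (≤-<-trans k≤lo (<-trans lo<i i<j))) z-at x-at z≡x

        -- Closing the ladder now would give a cycle with m + d vertices. The top is at level at
        -- most w + 2(m + d), so the branch cannot run out before that number reaches L. The last
        -- condition says that `fuel` further gains of w suffice.
        Bound : ℕ → Set
        Bound fuel = ∀ {σ lo m} d → TreePresent σ → Hidden lo σ → Ladder v σ lo (suc (lo + d)) m → w ≤ d →
          suc (lo + d) ≤ w + 2 * (m + d) → L ≤ m + d + fuel * w → E p σ f ℚ.≤ failure fuel

        -- The path climbs to `x`, fewer than w + 1 levels below the top, and leaves by an edge
        -- reaching at least 3w up, hence at least 2w beyond the top. At most w levels are given up
        -- and at least 2w - 1 are opened, so together with the new vertex the closing length grows
        -- by at least w, and by at least half as much as the level of the top.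
        advance : ∀ fuel → Bound fuel → ∀ {σ lo m} d → TreePresent σ → Hidden lo σ → Ladder v σ lo (suc (lo + (w + d))) m →
          suc (lo + (w + d)) ≤ w + 2 * (m + (w + d)) → L ≤ m + (w + d) + suc fuel * w →
          ∀ {x} δ → δ < w → anc par (lo + (suc d + δ)) v ≡ just x →
          r ≤ ∑[ a < n ] 𝟙 (untested? σ₀ x a ×-dec far? (3 * w) x a) → E p σ f ℚ.≤ failure (suc fuel)
        advance fuel bound {σ} {lo} {m} d tree hid lad hi≤ L≤ {x} δ δ<w x-at r≤ =
          try-edges x (λ c → untested? σ₀ x c ×-dec far? (3 * w) x c) r≤ (failure fuel) (0≤failure fuel)
            (λ σ → TreePresent σ × Hidden hi σ × Ladder v σ j hi (m + (suc d + δ))) step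
            (tree , hidden-mono {σ = σ} (≤-trans (m≤m+n lo (w + d)) (n≤1+n _)) hid , raises (suc d + δ) tree j<hi lad)
            (λ (u , k , 3w≤k , c-at) → hid j (j + k) lo<j (m<m+n j (<-≤-trans 0<w (≤-trans (m≤m+n w _) 3w≤k)))
              x-at (anc-+ j k x-at c-at) u)
          where
          j hi : ℕ
          j  = lo + (suc d + δ)
          hi = suc (lo + (w + d))
          lo<j : lo < j
          lo<j = m<m+n lo (s≤s z≤n)
          j<hi : j < hi
          j<hi = ≤-by 0 δ<w (eq lo d δ w)
            where
            eq : ∀ lo d δ w → suc (lo + (suc d + δ)) + w + 0 ≡ suc (lo + (w + d)) + suc δ
            eq = solve-∀
          step : ∀ {σ c} → Untested σ₀ x c × Far (3 * w) x c →
            TreePresent σ × Hidden hi σ × Ladder v σ j hi (m + (suc d + δ)) → lookup σ (edge x c) ≡ nothing →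
            (TreePresent (σ [ edge x c ]≔ just false) × Hidden hi (σ [ edge x c ]≔ just false) ×
              Ladder v (σ [ edge x c ]≔ just false) j hi (m + (suc d + δ)))
            × E p (σ [ edge x c ]≔ just true) f ℚ.≤ failure fuel
          step {σ} {c} (u , k , 3w≤k , c-at) (tree , hid , lad) σe =
            (reveal-tree false σe tree , reveal-hidden {σ = σ} false j (<⇒≤ j<hi) x-at hid , reveal-ladder false σe lad) , success
            where
            σ′ : Revealed (n * n)
            σ′ = σ [ edge x c ]≔ just true
            hi+2w≤ : hi + 2 * w ≤ j + k
            hi+2w≤ = ≤-by δ 3w≤k (eq lo d δ w k)
              where
              eq : ∀ lo d δ w k → suc (lo + (w + d)) + 2 * w + k + δ ≡ lo + (suc d + δ) + k + 3 * w
              eq = solve-∀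
            hi<j+k : hi < j + k
            hi<j+k = <-≤-trans (m<m+n hi (<-≤-trans 0<w (m≤m+n w _))) hi+2w≤
            lad′ : Ladder v σ′ j hi (m + (suc d + δ))
            lad′ = reveal-ladder true σe lad
            success : E p σ′ f ℚ.≤ failure fuel
            success with (e , eq) ← m≤n⇒∃[o]m+o≡n hi<j+k =
              bound e (reveal-tree true σe tree) (reveal-hidden {σ = σ} true j (<⇒≤ j<hi) x-at hid)
                (subst (λ z → Ladder v σ′ hi z (suc (m + (suc d + δ)))) (sym eq)
                  (jump j<hi hi<j+k lad′ (anc-+ j k x-at c-at)
                    (subst (λ y → Present σ′ y c) (anc-unique j x-at (Ladder.bottom-at lad′)) (revealed-present u))))
                (≤-by 0 (+-mono-≤ 2w≤1+e 0<w) (eq₁ w e))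
                (≤-by (2 + 2 * δ) (+-mono-≤ hi≤ 2w≤1+e) (eq₂ lo w d m δ e))
                (≤-by (suc δ) (+-mono-≤ L≤ 2w≤1+e) (eq₃ w d m δ e fuel L))
              where
              2w≤1+e : 2 * w ≤ suc e
              2w≤1+e = +-cancelˡ-≤ hi _ _ (≤-trans hi+2w≤ (≤-reflexive (trans (sym eq) (sym (+-suc hi e)))))
              eq₁ : ∀ w e → w + (suc e + w) + 0 ≡ e + (2 * w + 1)
              eq₁ = solve-∀
              eq₂ : ∀ lo w d m δ e → suc (suc (lo + (w + d)) + e) + (w + 2 * (m + (w + d)) + suc e) + (2 + 2 * δ)
                ≡ w + 2 * (suc (m + (suc d + δ)) + e) + (suc (lo + (w + d)) + 2 * w)
              eq₂ = solve-∀
              eq₃ : ∀ w d m δ e fuel L → L + (m + (w + d) + suc fuel * w + suc e) + suc δ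
                ≡ suc (m + (suc d + δ)) + e + fuel * w + (L + 2 * w)
              eq₃ = solve-∀

        room : ∀ lo d w m L M → suc (lo + d) + (w + w) + (w + 2 * (m + (w + d)) + (2 * L + M)) + 2
          ≡ M + (suc (lo + (w + d)) + (2 * suc (m + (w + d)) + (2 * L + 2 * w)))
        room = solve-∀

        zigzag : ∀ fuel → Bound fuel
        zigzag fuel {m = m} d tree hid lad w≤d hi≤ L≤ with L ≤? m + d
        ... | yes L≤len = ℚ.≤-trans (ℚ.≤-reflexive (cycle⇒0 L≤len (close tree lad))) (0≤failure fuel)
        zigzag zero {m = m} d tree hid lad w≤d hi≤ L≤ | no L≰len = contradiction (subst (L ≤_) (+-identityʳ (m + d)) L≤) L≰len
        zigzag (suc fuel) {σ} {lo} {m} d tree hid lad w≤d hi≤ L≤ | no L≰len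
          with (d′ , refl) ← m≤n⇒∃[o]m+o≡n w≤d
          -- The window consists of the w levels just below the top. It and the w levels above it
          -- fit into the branch because m + d < L.
          with (j , x , i≤j , j<hi , x-at , r≤) ← climb (suc (lo + d′)) (≤-by 2
                 (+-mono-≤ hi≤ (+-mono-≤ (*-monoʳ-≤ 2 (≰⇒> L≰len)) M-large)) (room lo d′ w m L M))
          with (δ , refl) ← m≤n⇒∃[o]m+o≡n i≤j =
          advance fuel (zigzag fuel) {σ} d′ tree hid lad hi≤ L≤ δ (+-cancelˡ-< (suc (lo + d′)) δ w j<hi)
            (subst (λ z → anc par z v ≡ just x) (place lo d′ δ) x-at) r≤
          where
          place : ∀ lo d δ → suc (lo + d) + δ ≡ lo + (suc d + δ)
          place = solve-∀

        -- The first rung leaves the lowest window and is a ladder with two vertices; it accounts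
        -- for the extra stage in `suc fuel`.
        search : ∀ fuel → L ≤ fuel * w → E p σ₀ f ℚ.≤ failure (suc fuel)
        search fuel L≤ with (j , x , _ , j<w , x-at , r≤) ← climb 0 (≤-trans (m≤n+m (w + w) (2 * L))
            (≤-trans (≤-reflexive (cong (λ z → 2 * L + (w + z)) (sym (+-identityʳ w)))) M-large)) =
          try-edges x (λ c → untested? σ₀ x c ×-dec far? (3 * w) x c) r≤ (failure fuel) (0≤failure fuel)
            (λ σ → TreePresent σ × Hidden j σ) step (tree₀ , λ _ _ _ _ _ _ → Untested.hidden) (λ (u , _) → Untested.hidden u)
          where
          step : ∀ {σ c} → Untested σ₀ x c × Far (3 * w) x c → TreePresent σ × Hidden j σ → lookup σ (edge x c) ≡ nothing →
            (TreePresent (σ [ edge x c ]≔ just false) × Hidden j (σ [ edge x c ]≔ just false))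
            × E p (σ [ edge x c ]≔ just true) f ℚ.≤ failure fuel
          step {σ} (u , zero , 3w≤ , c-at) (tree , hid) σe = contradiction 3w≤ (<⇒≱ (≤-trans 0<w (m≤m+n w _)))
          step {σ} {c} (u , suc k , 3w≤ , c-at) (tree , hid) σe =
            (reveal-tree false σe tree , reveal-hidden {σ = σ} false j ≤-refl x-at hid) ,
            zigzag fuel k (reveal-tree true σe tree) (reveal-hidden {σ = σ} true j ≤-refl x-at hid)
              (subst (λ z → Ladder v (σ [ edge x c ]≔ just true) j z 2) (+-suc j k)
                (rung j (j + suc k) (m<m+n j (s≤s z≤n)) x-at (anc-+ j (suc k) x-at c-at) (revealed-present u)))
              (≤-by w (+-mono-≤ 3w≤ 0<w) (eq₁ w k))
              (≤-by (3 + k) (<⇒≤ j<w) (eq₂ j w k))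
              (≤-trans L≤ (m≤n+m _ _))
            where
            eq₁ : ∀ w k → w + (suc k + w) + w ≡ k + (3 * w + 1)
            eq₁ = solve-∀
            eq₂ : ∀ j w k → suc (j + k) + w + (3 + k) ≡ w + 2 * (2 + k) + j
            eq₂ = solve-∀

  -- Depth-first search

  unrevealed : ∀ {m} → Revealed m → ℕ
  unrevealed []            = 0
  unrevealed (just _ ∷ σ)  = unrevealed σ
  unrevealed (nothing ∷ σ) = suc (unrevealed σ)

  reveal-unrevealed : ∀ {m} (σ : Revealed m) i b → lookup σ i ≡ nothing → unrevealed σ ≡ suc (unrevealed (σ [ i ]≔ just b))
  reveal-unrevealed (nothing ∷ σ) zero    b eq = refl
  reveal-unrevealed (just _ ∷ σ)  (suc i) b eq = reveal-unrevealed σ i b eq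
  reveal-unrevealed (nothing ∷ σ) (suc i) b eq = cong suc (reveal-unrevealed σ i b eq)

  anc-agree : ∀ {n} {par par′ : Fin n → Maybe (Fin n)} {V : Fin n → Set} →
    (∀ {x} → V x → par′ x ≡ par x) → (∀ {x y} → V x → par x ≡ just y → V y) →
    ∀ j {x} → V x → anc par′ j x ≡ anc par j x
  anc-agree same closed zero    Vx = refl
  anc-agree {par = par} same closed (suc j) {x} Vx rewrite same Vx with par x in eq
  ... | nothing = refl
  ... | just y  = anc-agree same closed j (closed Vx eq)

  module DFS {n} (G : Graph n) where

    open RandomGraph G

    known? : ∀ σ u v → Dec (lookup σ (edge u v) ≢ nothing)
    known? σ u v = ¬? (Maybe.≡-dec Bool._≟_ (lookup σ (edge u v)) nothing)

    -- Ordered pairs are counted, so a test adds at most 2 and the sum over vertices needs no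
    -- further bookkeeping.
    known : Revealed (n * n) → ℕ
    known σ = ∑[ u < n ] (∑[ v < n ] 𝟙 (known? σ u v))

    reveal-known : ∀ σ a b x → known (σ [ edge a b ]≔ x) ≤ known σ + 2
    reveal-known σ a b x = begin
      known (σ [ edge a b ]≔ x)
        ≤⟨ sum-mono (λ u → sum-mono λ v → 𝟙-≤ (known? (σ [ edge a b ]≔ x) u v) (cover u v)) ⟩
      ∑[ u < n ] (∑[ v < n ] (𝟙 (known? σ u v) + δ a u * δ b v + δ b u * δ a v))
        ≡⟨ sum-cong-≗ (λ u → ∑-distrib-+₃ (λ v → 𝟙 (known? σ u v)) (λ v → δ a u * δ b v) (λ v → δ b u * δ a v)) ⟩
      ∑[ u < n ] (∑[ v < n ] 𝟙 (known? σ u v) + ∑[ v < n ] (δ a u * δ b v) + ∑[ v < n ] (δ b u * δ a v))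
        ≡⟨ ∑-distrib-+₃ (λ u → ∑[ v < n ] 𝟙 (known? σ u v)) (λ u → ∑[ v < n ] (δ a u * δ b v)) (λ u → ∑[ v < n ] (δ b u * δ a v)) ⟩
      known σ + ∑[ u < n ] (∑[ v < n ] (δ a u * δ b v)) + ∑[ u < n ] (∑[ v < n ] (δ b u * δ a v))
        ≤⟨ +-mono-≤ (+-monoʳ-≤ (known σ) (square a b)) (square b a) ⟩
      known σ + 1 + 1
        ≡⟨ +-assoc (known σ) 1 1 ⟩
      known σ + 2 ∎
      where
      open ≤-Reasoning
      δ : Fin n → Fin n → ℕ
      δ a u = 𝟙 (a Fin.≟ u)
      square : ∀ a b → ∑[ u < n ] (∑[ v < n ] (δ a u * δ b v)) ≤ 1
      square a b = ≤-trans (≤-reflexive (sym (sum-*-sum (δ a) (δ b)))) (*-mono-≤ (one a) (one b))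
        where
        one : ∀ a → ∑[ u < n ] δ a u ≤ 1
        one a = sum-unique-≤ (a Fin.≟_) (λ p q → trans (sym p) q) λ _ → ≤-refl
      cover : ∀ u v → lookup (σ [ edge a b ]≔ x) (edge u v) ≢ nothing → 1 ≤ 𝟙 (known? σ u v) + δ a u * δ b v + δ b u * δ a v
      cover u v ≢nothing with edge u v Fin.≟ edge a b
      ... | no e≢ = ≤-trans (1≤𝟙 (known? σ u v) (≢nothing ∘ trans (lookup∘update′ e≢ σ x))) (≤-trans (m≤m+n _ (δ a u * δ b v)) (m≤m+n _ (δ b u * δ a v)))
      ... | yes eq with edge-injective eq
      ... | inj₁ (refl , refl) = ≤-trans (*-mono-≤ (1≤𝟙 (u Fin.≟ u) refl) (1≤𝟙 (v Fin.≟ v) refl))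
        (≤-trans (m≤n+m _ (𝟙 (known? σ u v))) (m≤m+n _ (δ v u * δ u v)))
      ... | inj₂ (refl , refl) = ≤-trans (*-mono-≤ (1≤𝟙 (u Fin.≟ u) refl) (1≤𝟙 (v Fin.≟ v) refl)) (m≤n+m _ _)

    unreveal-untested : ∀ {σ a b u v x} → Untested (σ [ edge a b ]≔ just x) u v → Untested σ u v
    unreveal-untested {σ} {a} {b} {u} {v} {x} (untested adj eq) = untested adj (trans (sym (lookup∘update′ other σ (just x))) eq)
      where
      other : edge u v ≢ edge a b
      other e with () ← trans (sym eq) (trans (cong (lookup (σ [ edge a b ]≔ just x)) e) (lookup∘update (edge a b) σ (just x)))

    not-self : ∀ {σ u} → ¬ Untested σ u u
    not-self {u = u} (untested adj _) with () ← trans (sym adj) (Graph.irrefl G u)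

    -- `top` is the top of the search stack, and its ancestors form the rest of the stack.
    -- `frontier` is what keeps `vertical` alive: an untested edge to an unvisited vertex can start
    -- on the stack only. The index `t` counts tests.
    record State (σ : Revealed (n * n)) (t : ℕ) : Set where
      field
        par : Fin n → Maybe (Fin n)
        dep : Fin n → ℕ
        vis : Fin n → Bool
        top : Maybe (Fin n)
        par-vis     : ∀ {v u} → par v ≡ just u → vis v ≡ true × vis u ≡ true
        par-dep     : ∀ {v u} → par v ≡ just u → dep v ≡ suc (dep u)
        par-present : ∀ {v u} → par v ≡ just u → Present σ v u
        top-vis     : ∀ {v} → top ≡ just v → vis v ≡ true
        vertical    : ∀ {u v} → vis u ≡ true → vis v ≡ true → Untested σ u v →
          (∃ λ j → anc par j u ≡ just v) ⊎ (∃ λ j → anc par j v ≡ just u)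
        frontier    : ∀ {x u} → vis x ≡ true → vis u ≡ false → Untested σ x u →
          ∃ λ y → ∃ λ j → top ≡ just y × anc par j y ≡ just x
        known≤      : known σ ≤ 2 * t

      unvisited : ℕ
      unvisited = ∑[ u < n ] 𝟙 (vis u Bool.≟ false)

      height : ℕ
      height = maybe (suc ∘ dep) 0 top

      -- A visit removes weight 2 and lengthens the stack by 1, a test uses up a coin, and a retreat
      -- shortens the stack.
      measure : ℕ
      measure = 2 * unvisited + unrevealed σ + height

    open State

    separate : ∀ {vis : Fin n → Bool} {u x} → vis u ≡ false → vis x ≡ true → x ≢ u
    separate u∉ x∈ refl with () ← trans (sym u∉) x∈

    module Visit {σ t} (s : State σ t) {u} (u∉ : vis s u ≡ false) where

      vis′ : Fin n → Bool
      vis′ = updateAt (vis s) u (const true)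

      vis-here : vis′ u ≡ true
      vis-here = updateAt-updates u (vis s)

      vis-other : ∀ {x} → x ≢ u → vis′ x ≡ vis s x
      vis-other {x} x≢u = updateAt-minimal x u (vis s) x≢u

      vis-old : ∀ {x} → vis s x ≡ true → vis′ x ≡ true
      vis-old x∈ = trans (vis-other (separate u∉ x∈)) x∈

      vis-cases : ∀ {x} → vis′ x ≡ true → x ≡ u ⊎ vis s x ≡ true
      vis-cases {x} x∈ with x Fin.≟ u
      ... | yes x≡u = inj₁ x≡u
      ... | no  x≢u = inj₂ (trans (sym (vis-other x≢u)) x∈)

      vis-not : ∀ {x} → vis′ x ≡ false → vis s x ≡ false
      vis-not {x} x∉ with x Fin.≟ u
      ... | yes refl = u∉
      ... | no  x≢u  = trans (sym (vis-other x≢u)) x∉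

      visit-unvisited : suc (∑[ x < n ] 𝟙 (vis′ x Bool.≟ false)) ≤ unvisited s
      visit-unvisited = begin
        suc (∑[ x < n ] 𝟙 (vis′ x Bool.≟ false))
          ≤⟨ +-monoˡ-≤ _ (≤-trans (1≤𝟙 (u Fin.≟ u) refl) (term≤sum (λ x → 𝟙 (u Fin.≟ x)) u)) ⟩
        ∑[ x < n ] 𝟙 (u Fin.≟ x) + ∑[ x < n ] 𝟙 (vis′ x Bool.≟ false)
          ≡⟨ ∑-distrib-+ (λ x → 𝟙 (u Fin.≟ x)) (λ x → 𝟙 (vis′ x Bool.≟ false)) ⟨
        ∑[ x < n ] (𝟙 (u Fin.≟ x) + 𝟙 (vis′ x Bool.≟ false))
          ≤⟨ sum-mono bound ⟩
        unvisited s ∎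
        where
        open ≤-Reasoning
        bound : ∀ x → 𝟙 (u Fin.≟ x) + 𝟙 (vis′ x Bool.≟ false) ≤ 𝟙 (vis s x Bool.≟ false)
        bound x with u Fin.≟ x
        ... | yes refl = ≤-trans (≤-reflexive (cong (λ b → suc (𝟙 (b Bool.≟ false))) vis-here)) (1≤𝟙 (vis s u Bool.≟ false) u∉)
        ... | no  u≢x  = 𝟙-mono (vis′ x Bool.≟ false) (vis s x Bool.≟ false) vis-not

    -- When the stack is empty, `frontier` excludes untested edges from visited to unvisited
    -- vertices, so the new root meets none of the old vertices.
    visit-root : ∀ {σ t} (s : State σ t) {u} → top s ≡ nothing → vis s u ≡ false → State σ t
    visit-root {σ} {t} s {u} top≡ u∉ = record
      { par = par s ; dep = dep′ ; vis = vis′ ; top = just u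
      ; par-vis = λ eq → let (p , q) = par-vis s eq in vis-old p , vis-old q
      ; par-dep = λ eq → let (p , q) = par-vis s eq in trans (dep-old p) (trans (par-dep s eq) (cong suc (sym (dep-old q))))
      ; par-present = par-present s
      ; top-vis = λ { refl → vis-here }
      ; vertical = λ a∈ b∈ e → vert (vis-cases a∈) (vis-cases b∈) e
      ; frontier = λ x∈ w∉ e → front (vis-cases x∈) (vis-not w∉) e
      ; known≤ = known≤ s }
      where
      open Visit s u∉
      dep′ : Fin n → ℕ
      dep′ = updateAt (dep s) u (const 0)
      dep-old : ∀ {x} → vis s x ≡ true → dep′ x ≡ dep s x
      dep-old {x} x∈ = updateAt-minimal x u (dep s) (separate u∉ x∈)
      no-frontier : ∀ {x w} → vis s x ≡ true → vis s w ≡ false → ¬ Untested σ x w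
      no-frontier x∈ w∉ e with (_ , _ , eq , _) ← frontier s x∈ w∉ e with () ← trans (sym top≡) eq
      vert : ∀ {a b} → a ≡ u ⊎ vis s a ≡ true → b ≡ u ⊎ vis s b ≡ true → Untested σ a b →
        (∃ λ j → anc (par s) j a ≡ just b) ⊎ (∃ λ j → anc (par s) j b ≡ just a)
      vert (inj₁ refl) (inj₁ refl) e = contradiction e not-self
      vert (inj₁ refl) (inj₂ b∈)   e = contradiction (untested-sym e) (no-frontier b∈ u∉)
      vert (inj₂ a∈)   (inj₁ refl) e = contradiction e (no-frontier a∈ u∉)
      vert (inj₂ a∈)   (inj₂ b∈)   e = vertical s a∈ b∈ e
      front : ∀ {x w} → x ≡ u ⊎ vis s x ≡ true → vis s w ≡ false → Untested σ x w →
        ∃ λ y → ∃ λ j → just u ≡ just y × anc (par s) j y ≡ just x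
      front (inj₁ refl) w∉ e = u , 0 , refl , refl
      front (inj₂ x∈)   w∉ e = contradiction e (no-frontier x∈ w∉)

    -- By `frontier`, an untested edge from a visited vertex to `u` starts at `y` or an ancestor of
    -- `y`, and these become the ancestors of `u`. Older chains of ancestors stay among visited
    -- vertices and do not notice the new parent.
    visit-child : ∀ {σ t} (s : State σ t) {y u} → top s ≡ just y → vis s u ≡ false → Untested σ y u →
      State (σ [ edge y u ]≔ just true) (suc t)
    visit-child {σ} {t} s {y} {u} top≡ u∉ e@(untested adj hidden) = record
      { par = par′ ; dep = dep′ ; vis = vis′ ; top = just u
      ; par-vis = λ eq → pv (par-cases eq)
      ; par-dep = λ eq → pd (par-cases eq)
      ; par-present = λ eq → pp (par-cases eq)
      ; top-vis = λ { refl → vis-here }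
      ; vertical = λ a∈ b∈ e → vert (vis-cases a∈) (vis-cases b∈) (unreveal-untested e)
      ; frontier = λ x∈ w∉ e → front (vis-cases x∈) (vis-not w∉) (unreveal-untested e)
      ; known≤ = ≤-trans (reveal-known σ y u (just true)) (≤-trans (+-monoˡ-≤ 2 (known≤ s)) (≤-reflexive (double t))) }
      where
      open Visit s u∉
      double : ∀ t → 2 * t + 2 ≡ 2 * suc t
      double = solve-∀
      y∈ : vis s y ≡ true
      y∈ = top-vis s top≡
      par′ : Fin n → Maybe (Fin n)
      par′ = updateAt (par s) u (const (just y))
      dep′ : Fin n → ℕ
      dep′ = updateAt (dep s) u (const (suc (dep s y)))
      dep-old : ∀ {x} → vis s x ≡ true → dep′ x ≡ dep s x
      dep-old {x} x∈ = updateAt-minimal x u (dep s) (separate u∉ x∈)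
      par-old : ∀ {x} → vis s x ≡ true → par′ x ≡ par s x
      par-old {x} x∈ = updateAt-minimal x u (par s) (separate u∉ x∈)
      par-cases : ∀ {v w} → par′ v ≡ just w → (v ≡ u × w ≡ y) ⊎ par s v ≡ just w
      par-cases {v} eq with v Fin.≟ u
      ... | yes refl = inj₁ (refl , Maybe.just-injective (trans (sym eq) (updateAt-updates u (par s))))
      ... | no  v≢u  = inj₂ (trans (sym (updateAt-minimal v u (par s) v≢u)) eq)
      pv : ∀ {v w} → (v ≡ u × w ≡ y) ⊎ par s v ≡ just w → vis′ v ≡ true × vis′ w ≡ true
      pv (inj₁ (refl , refl)) = vis-here , vis-old y∈
      pv (inj₂ eq) = let (p , q) = par-vis s eq in vis-old p , vis-old q
      pd : ∀ {v w} → (v ≡ u × w ≡ y) ⊎ par s v ≡ just w → dep′ v ≡ suc (dep′ w)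
      pd (inj₁ (refl , refl)) = trans (updateAt-updates u (dep s)) (cong suc (sym (dep-old y∈)))
      pd (inj₂ eq) = let (p , q) = par-vis s eq in trans (dep-old p) (trans (par-dep s eq) (cong suc (sym (dep-old q))))
      pp : ∀ {v w} → (v ≡ u × w ≡ y) ⊎ par s v ≡ just w → Present (σ [ edge y u ]≔ just true) v w
      pp (inj₁ (refl , refl)) = present-sym (present adj (lookup∘update (edge y u) σ (just true)))
      pp (inj₂ eq) = reveal-present true hidden (par-present s eq)
      agree : ∀ j {x} → vis s x ≡ true → anc par′ j x ≡ anc (par s) j x
      agree j = anc-agree {V = λ x → vis s x ≡ true} par-old (λ _ eq → proj₂ (par-vis s eq)) j
      stacked : ∀ {x} → vis s x ≡ true → Untested σ x u → ∃ λ j → anc par′ j u ≡ just x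
      stacked x∈ e with (y′ , j , top≡′ , eq) ← frontier s x∈ u∉ e with refl ← Maybe.just-injective (trans (sym top≡) top≡′) =
        suc j , trans (anc-suc j (updateAt-updates u (par s))) (trans (agree j y∈) eq)
      vert : ∀ {a b} → a ≡ u ⊎ vis s a ≡ true → b ≡ u ⊎ vis s b ≡ true → Untested σ a b →
        (∃ λ j → anc par′ j a ≡ just b) ⊎ (∃ λ j → anc par′ j b ≡ just a)
      vert (inj₁ refl) (inj₁ refl) e = contradiction e not-self
      vert (inj₁ refl) (inj₂ b∈)   e = inj₁ (stacked b∈ (untested-sym e))
      vert (inj₂ a∈)   (inj₁ refl) e = inj₂ (stacked a∈ e)
      vert (inj₂ a∈)   (inj₂ b∈)   e =
        Sum.map (λ (j , eq) → j , trans (agree j a∈) eq) (λ (j , eq) → j , trans (agree j b∈) eq) (vertical s a∈ b∈ e)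
      front : ∀ {x w} → x ≡ u ⊎ vis s x ≡ true → vis s w ≡ false → Untested σ x w →
        ∃ λ z → ∃ λ j → just u ≡ just z × anc par′ j z ≡ just x
      front (inj₁ refl) w∉ e = u , 0 , refl , refl
      front (inj₂ x∈)   w∉ e with (y′ , j , top≡′ , eq) ← frontier s x∈ w∉ e with refl ← Maybe.just-injective (trans (sym top≡) top≡′) =
        u , suc j , refl , trans (anc-suc j (updateAt-updates u (par s))) (trans (agree j y∈) eq)

    reject : ∀ {σ t} (s : State σ t) {y u} → Untested σ y u → State (σ [ edge y u ]≔ just false) (suc t)
    reject {σ} {t} s {y} {u} (untested _ hidden) = record
      { par = par s ; dep = dep s ; vis = vis s ; top = top s
      ; par-vis = par-vis s ; par-dep = par-dep s
      ; par-present = λ eq → reveal-present false hidden (par-present s eq)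
      ; top-vis = top-vis s
      ; vertical = λ a∈ b∈ e → vertical s a∈ b∈ (unreveal-untested e)
      ; frontier = λ x∈ w∉ e → frontier s x∈ w∉ (unreveal-untested e)
      ; known≤ = ≤-trans (reveal-known σ y u (just false)) (≤-trans (+-monoˡ-≤ 2 (known≤ s)) (≤-reflexive (double t))) }
      where
      double : ∀ t → 2 * t + 2 ≡ 2 * suc t
      double = solve-∀

    -- Only `y` leaves the stack, and no untested edge joins it to an unvisited vertex.
    retreat : ∀ {σ t} (s : State σ t) {y} → top s ≡ just y → (∀ u → vis s u ≡ false → ¬ Untested σ y u) → State σ t
    retreat {σ} {t} s {y} top≡ none = record
      { par = par s ; dep = dep s ; vis = vis s ; top = par s y
      ; par-vis = par-vis s ; par-dep = par-dep s ; par-present = par-present s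
      ; top-vis = λ eq → proj₂ (par-vis s eq)
      ; vertical = vertical s
      ; frontier = front
      ; known≤ = known≤ s }
      where
      front : ∀ {x w} → vis s x ≡ true → vis s w ≡ false → Untested σ x w → ∃ λ z → ∃ λ j → par s y ≡ just z × anc (par s) j z ≡ just x
      front x∈ w∉ e with frontier s x∈ w∉ e
      ... | (y′ , j , top≡′ , eq) with refl ← Maybe.just-injective (trans (sym top≡) top≡′) with j
      ...   | zero with refl ← eq = contradiction e (none _ w∉)
      ...   | suc j′ with (z , p , q) ← anc-suc⁻¹ {par = par s} j′ eq = z , j′ , p , q

    initial : ∀ σ → (∀ i → lookup σ i ≡ nothing) → State σ 0
    initial σ hidden = record
      { par = λ _ → nothing ; dep = λ _ → 0 ; vis = λ _ → false ; top = nothing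
      ; par-vis = λ () ; par-dep = λ () ; par-present = λ () ; top-vis = λ () ; vertical = λ () ; frontier = λ ()
      ; known≤ = ≤-reflexive (trans (sum-cong-≗ λ u → sum-none (known? σ u) λ v isKnown → isKnown (hidden (edge u v)))
          (trans (sum-const n 0) (*-zeroʳ n))) }

    module _ (p : ℚ) (0≤p : 0ℚ ℚ.≤ p) (p≤1 : p ℚ.≤ 1ℚ) (f : Coins n → ℚ) (κ A D : ℚ) (0≤D : 0ℚ ℚ.≤ D)
      (finish : ∀ {σ t} (s : State σ t) → (∀ v → vis s v ≡ true) → κ ℚ.* E p σ f ℚ.≤ A ℚ.+ D ℚ.* (p ℚ.* ℕtoℚ t)) where

      open Bernoulli p 0≤p p≤1

      -- p · (number of tested edges) + (number of unvisited vertices) is a supermartingale: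
      -- a test adds p to the first term and with probability p removes a vertex.
      Φ : ℕ → ℕ → ℚ
      Φ t m = A ℚ.+ D ℚ.* (p ℚ.* ℕtoℚ t ℚ.+ ℕtoℚ m)

      Φ-mono : ∀ t {l m} → l ≤ m → Φ t l ℚ.≤ Φ t m
      Φ-mono t {l} {m} l≤m = ℚ.+-monoʳ-≤ A (ℚ.*-monoˡ-≤-nonNeg D {{ℚ.nonNegative 0≤D}}
        (ℚ.+-monoʳ-≤ (p ℚ.* ℕtoℚ t) (ℕtoℚ-mono {l} {m} l≤m)))

      Φ-step : ∀ t m → p ℚ.* Φ (suc t) m ℚ.+ (1ℚ ℚ.- p) ℚ.* Φ (suc t) (suc m) ≡ Φ t (suc m)
      Φ-step t m rewrite ℕtoℚ-+ 1 t | ℕtoℚ-+ 1 m =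
        solve 5 (λ p A D t m →
          p :* (A :+ D :* (p :* (con 1ℚ :+ t) :+ m)) :+ (con 1ℚ :- p) :* (A :+ D :* (p :* (con 1ℚ :+ t) :+ (con 1ℚ :+ m)))
          := A :+ D :* (p :* t :+ (con 1ℚ :+ m))) refl p A D (ℕtoℚ t) (ℕtoℚ m)
        where open +-*-Solver

      -- `Φ` is preserved on average by a test and does not increase otherwise, so the bound assumed
      -- in `finish` is carried back from the end of the search. Linearity in pt is essential: it
      -- replaces the expected number of tests without that number ever being a random variable.
      explore : ∀ fuel {σ t} (s : State σ t) → measure s < fuel → κ ℚ.* E p σ f ℚ.≤ Φ t (unvisited s)
      explore (suc fuel) {σ} {t} s (s≤s μ≤) with top s in top≡
      ... | nothing with Fin.any? (λ u → vis s u Bool.≟ false)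
      ...   | yes (u , u∉) = ℚ.≤-trans
        (explore fuel (visit-root s top≡ u∉) (≤-trans (≤-by 0 (*-monoʳ-≤ 2 visit-unvisited) eq) μ≤))
        (Φ-mono t (<⇒≤ visit-unvisited))
        where
        open Visit s u∉
        lemma : ∀ a b r → suc (2 * a + r + 1) + 2 * b + 0 ≡ 2 * b + r + 0 + 2 * suc a
        lemma = solve-∀
        eq : suc (measure (visit-root s top≡ u∉)) + 2 * unvisited s + 0
          ≡ 2 * unvisited s + unrevealed σ + 0 + 2 * suc (∑[ x < n ] 𝟙 (vis′ x Bool.≟ false))
        eq rewrite updateAt-updates u {const 0} (dep s) = lemma (∑[ x < n ] 𝟙 (vis′ x Bool.≟ false)) (unvisited s) (unrevealed σ)
      ...   | no none = ℚ.≤-trans (finish s λ v → Bool.¬-not (λ v∉ → none (v , v∉)))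
        (ℚ.+-monoʳ-≤ A (ℚ.*-monoˡ-≤-nonNeg D {{ℚ.nonNegative 0≤D}} (ℚ.≤-trans (ℚ.≤-reflexive (sym (ℚ.+-identityʳ (p ℚ.* ℕtoℚ t))))
          (ℚ.+-monoʳ-≤ (p ℚ.* ℕtoℚ t) (0≤ℕtoℚ (unvisited s))))))
      explore (suc fuel) {σ} {t} s (s≤s μ≤) | just y with Fin.any? (λ u → vis s u Bool.≟ false ×-dec untested? σ y u)
      ...   | no none = explore fuel (retreat s top≡ λ u u∉ e → none (u , u∉ , e))
        (≤-trans (≤-reflexive (sym (+-suc (2 * unvisited s + unrevealed σ) _))) (≤-trans (+-monoʳ-≤ (2 * unvisited s + unrevealed σ) lower) μ≤))
        where
        lower : suc (maybe (suc ∘ dep s) 0 (par s y)) ≤ suc (dep s y)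
        lower with par s y in eq
        ... | nothing = s≤s z≤n
        ... | just z  = s≤s (≤-reflexive (sym (par-dep s eq)))
      ...   | yes (u , u∉ , e) = begin
        κ ℚ.* E p σ f
          ≡⟨ cong (κ ℚ.*_) (E-split p σ f (edge y u) (Untested.hidden e)) ⟩
        κ ℚ.* (p ℚ.* E₁ ℚ.+ (1ℚ ℚ.- p) ℚ.* E₀)
          ≡⟨ solve 4 (λ κ p a b → κ :* (p :* a :+ (con 1ℚ :- p) :* b) := p :* (κ :* a) :+ (con 1ℚ :- p) :* (κ :* b)) refl κ p E₁ E₀ ⟩
        p ℚ.* (κ ℚ.* E₁) ℚ.+ (1ℚ ℚ.- p) ℚ.* (κ ℚ.* E₀)
          ≤⟨ ℚ.+-mono-≤
               (*-mono-p (ℚ.≤-trans (explore fuel (visit-child s top≡ u∉ e) (≤-trans down₁ μ≤)) (Φ-mono (suc t) m′≤)))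
               (*-mono-1-p (ℚ.≤-trans (explore fuel (reject s e) (≤-trans down₀ μ≤)) (Φ-mono (suc t) (≤-reflexive (sym m≡))))) ⟩
        p ℚ.* Φ (suc t) m ℚ.+ (1ℚ ℚ.- p) ℚ.* Φ (suc t) (suc m)
          ≡⟨ Φ-step t m ⟩
        Φ t (suc m)
          ≡⟨ cong (Φ t) m≡ ⟩
        Φ t (unvisited s) ∎
        where
        open ℚ.≤-Reasoning
        open +-*-Solver
        open Visit s u∉
        E₁ E₀ : ℚ
        E₁ = E p (σ [ edge y u ]≔ just true) f
        E₀ = E p (σ [ edge y u ]≔ just false) f
        m : ℕ
        m = pred (unvisited s)
        m′≤ : ∑[ x < n ] 𝟙 (vis′ x Bool.≟ false) ≤ m
        m′≤ = pred-mono-≤ visit-unvisited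
        m≡ : suc m ≡ unvisited s
        m≡ = suc-pred (unvisited s) {{>-nonZero (≤-trans (s≤s z≤n) visit-unvisited)}}
        σ-shrinks : ∀ b → unrevealed σ ≡ suc (unrevealed (σ [ edge y u ]≔ just b))
        σ-shrinks b = reveal-unrevealed σ (edge y u) b (Untested.hidden e)
        down₀ : suc (measure (reject s e)) ≤ 2 * unvisited s + unrevealed σ + suc (dep s y)
        down₀ rewrite σ-shrinks false | top≡ = ≤-reflexive (lemma (unvisited s) (unrevealed (σ [ edge y u ]≔ just false)) (dep s y))
          where
          lemma : ∀ a r h → suc (2 * a + r + suc h) ≡ 2 * a + suc r + suc h
          lemma = solve-∀
        down₁ : suc (measure (visit-child s top≡ u∉ e)) ≤ 2 * unvisited s + unrevealed σ + suc (dep s y)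
        down₁ rewrite σ-shrinks true | updateAt-updates u {const (suc (dep s y))} (dep s) = ≤-by 1 (*-monoʳ-≤ 2 visit-unvisited)
          (lemma (∑[ x < n ] 𝟙 (vis′ x Bool.≟ false)) (unvisited s) (unrevealed (σ [ edge y u ]≔ just true)) (dep s y))
          where
          lemma : ∀ a b r h → suc (2 * a + r + suc (suc h)) + 2 * b + 1 ≡ 2 * b + suc r + suc h + 2 * suc a
          lemma = solve-∀

  -- Bounding the failure probability

  deg≡sum : ∀ {n} (G : Graph n) v → deg G v ≡ ∑[ u < n ] (if adj G v u then 1 else 0)
  deg≡sum G v = go (λ u → if adj G v u then 1 else 0) (λ u → u)
    where
    go : ∀ {m} {A : Set} (g : A → ℕ) (h : Fin m → A) → Data.Nat.ListAction.sum (map g (tabulate h)) ≡ sum (g ∘ h)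
    go {zero}  g h = refl
    go {suc m} g h = cong (g (h zero) +_) (go g (h ∘ suc))

  module Terminal {n} (G : Graph n) (c4 : C4Free G) (v₀ : Fin n)
    (p : ℚ) (0≤p : 0ℚ ℚ.≤ p) (p≤1 : p ℚ.≤ 1ℚ) (target : ℚ)
    (dec : Decidable (λ (c : Coins n) → HasCycleAtLeast (subgraph G c) target))
    (a ℓ r B : ℕ) .{{_ : NonZero a}} .{{_ : NonZero r}} .{{_ : NonZero B}}
    (3≤ℓ : 3 ≤ ℓ) (ℓ≤ : ℓ + 13 ≤ a * a)
    (B-large : (2 * ℓ + 4) * (1 + (ℓ + 5) * ((2 * ℓ + 4) * (a + 9))) ≤ B)
    (r-large : 2 * (a * a * B) * B ≤ r)
    (degrees : ∀ v → (a + 7) * r ≤ deg G v)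
    (target≤ : target ℚ.≤ ℕtoℚ (ℓ * (r * r))) where

    open RandomGraph G
    open DFS G
    open Bernoulli p 0≤p p≤1

    L : ℕ
    L = ℓ * (r * r)

    f : Coins n → ℚ
    f c = if does (dec c) then 0ℚ else 1ℚ

    f≤1 : ∀ c → f c ℚ.≤ 1ℚ
    f≤1 c with does (dec c)
    ... | true  = ℚ.nonNegative⁻¹ 1ℚ
    ... | false = ℚ.≤-refl

    1≤r² : 1 ≤ r * r
    1≤r² = >-nonZero⁻¹ (r * r) {{m*n≢0 r r}}

    -- Guarantees the three vertices that `IsCycle` asks for.
    3≤L : 3 ≤ L
    3≤L = ≤-trans 3≤ℓ (m≤m*n ℓ (r * r) {{m*n≢0 r r}})

    f-cycle : ∀ {σ c m} → Consistent σ c → L ≤ m → ∀ {x xs} → Unique (x ∷ xs) →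
      Linked (Present σ) (x ∷ xs ++ [ x ]) → suc (length xs) ≡ m → f c ≡ 0ℚ
    f-cycle {c = c} cons L≤m {x} {xs} unique linked refl with dec c
    ... | yes _ = refl
    ... | no ¬c = contradiction
      (x , xs , (≤-trans 3≤L L≤m , unique , Linked.map (present⇒subgraph {c = c} cons) linked) ,
        ℚ.≤-trans target≤ (ℕtoℚ-mono L≤m)) ¬c

    module _ {σ t} (s : State σ t) (visited : ∀ v → State.vis s v ≡ true) where

      open State s
      open RootedForest par dep par-dep

      untested-C4 : ∀ {a a′ b b′} → a ≢ a′ → b ≢ b′ →
        Untested σ a b → Untested σ a b′ → Untested σ a′ b → Untested σ a′ b′ → ⊥
      untested-C4 {a} {a′} {b} {b′} a≢a′ b≢b′ ab ab′ a′b a′b′ = c4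
        (a , b , a′ , b′ , distinct ab , a≢a′ , distinct ab′ , distinct (untested-sym a′b) , b≢b′ , distinct a′b′ ,
         edge⇒T ab , edge⇒T (untested-sym a′b) , edge⇒T a′b′ , edge⇒T (untested-sym ab′))
        where
        distinct : ∀ {x y} → Untested σ x y → x ≢ y
        distinct e refl = not-self e
        edge⇒T : ∀ {x y} → Untested σ x y → T (adj G x y)
        edge⇒T e = subst T (sym (Untested.adjacent e)) _

      open VerticalGraph par dep par-dep (untested? σ) untested-sym untested-C4 (λ {u} {v} → vertical (visited u) (visited v))

      -- A vertex that is not full has lost at least r untested edges to revealed coins, and `known`
      -- adds these up over all vertices.
      r*notFull≤ : r * notFull ((a + 7) * r) r ≤ 2 * t
      r*notFull≤ = begin
        r * notFull ((a + 7) * r) r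
          ≡⟨ *-distribˡ-sum r (λ v → 𝟙 (¬? (full? ((a + 7) * r) r v))) ⟩
        ∑[ v < n ] (r * 𝟙 (¬? (full? ((a + 7) * r) r v)))
          ≤⟨ sum-mono (λ v → ≤-trans (≤-reflexive (*-comm r _)) (𝟙-*-≤ (¬? (full? ((a + 7) * r) r v)) (lost v))) ⟩
        known σ
          ≤⟨ known≤ ⟩
        2 * t ∎
        where
        open ≤-Reasoning
        degree≥ : ∀ v → deg G v ≤ degree v + ∑[ u < n ] 𝟙 (known? σ v u)
        degree≥ v = begin
          deg G v
            ≡⟨ deg≡sum G v ⟩
          ∑[ u < n ] (if adj G v u then 1 else 0)
            ≤⟨ sum-mono split ⟩
          ∑[ u < n ] (𝟙 (untested? σ v u) + 𝟙 (known? σ v u))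
            ≡⟨ ∑-distrib-+ (λ u → 𝟙 (untested? σ v u)) (λ u → 𝟙 (known? σ v u)) ⟩
          degree v + ∑[ u < n ] 𝟙 (known? σ v u) ∎
          where
          split : ∀ u → (if adj G v u then 1 else 0) ≤ 𝟙 (untested? σ v u) + 𝟙 (known? σ v u)
          split u with adj G v u in eq
          ... | false = z≤n
          ... | true with Maybe.≡-dec Bool._≟_ (lookup σ (edge v u)) nothing
          ...   | yes _ = s≤s z≤n
          ...   | no  _ = s≤s z≤n
        lost : ∀ v → ¬ Full ((a + 7) * r) r v → r ≤ ∑[ u < n ] 𝟙 (known? σ v u)
        lost v ¬full = +-cancelˡ-≤ (degree v) r _ (≤-trans (<⇒≤ (≰⇒> ¬full)) (≤-trans (degrees v) (degree≥ v)))

      module S = Search G p 0≤p p≤1 f f≤1 r par dep par-dep σ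

      cycle⇒0 : ∀ {σ m} → L ≤ m → Branch.Cycle par dep par-dep σ m → E p σ f ≡ 0ℚ
      cycle⇒0 {σ} L≤m (x , xs , unique , linked , eq) = E-zero p σ f λ c cons → f-cycle cons L≤m unique linked eq

      failure : ℕ → ℚ
      failure = S.failure L cycle⇒0 par-present

      0≤failure : ∀ m → 0ℚ ℚ.≤ failure m
      0≤failure = S.0≤failure L cycle⇒0 par-present

      -- After the first of the ℓ + 1 stages each one gains at least w, and ℓw ≥ L. A vertex with r
      -- edges of length at least L settles the matter in a single stage.
      small : B * (2 * t) ≤ r * n → E p σ f ℚ.≤ failure (suc ℓ)
      small 2Bt≤ with Fin.any? (λ v → r ≤? up L v)
      ... | yes (v , r≤) = ℚ.≤-trans (S.try-up L cycle⇒0 par-present (≤-trans (s≤s z≤n) 3≤L) r≤) (ℚ.+-monoˡ-≤ (miss r) (0≤failure ℓ))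
      ... | no ¬up with Fin.any? (λ v → r ≤? down L v)
      ...   | yes (v , r≤) = ℚ.≤-trans (S.try-down L cycle⇒0 par-present (≤-trans (s≤s z≤n) 3≤L) r≤) (ℚ.+-monoˡ-≤ (miss r) (0≤failure ℓ))
      ...   | no ¬down =
        let (v , climb) = climbing-branch a ℓ r B ℓ≤ B-large r-large few
              (λ v → <⇒≤ (≰⇒> λ r≤ → ¬up (v , r≤))) (λ v → <⇒≤ (≰⇒> λ r≤ → ¬down (v , r≤))) v₀
        in S.search L cycle⇒0 par-present (2 * (r * r)) ((2 * ℓ + 4) * (r * r)) (≤-trans 1≤r² (m≤m+n (r * r) _))
             (≤-reflexive (eq ℓ (r * r))) v climb ℓ (*-monoʳ-≤ ℓ (m≤m+n (r * r) _))
        where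
        eq : ∀ ℓ q → 2 * (ℓ * q) + 2 * (2 * q) ≡ (2 * ℓ + 4) * q
        eq = solve-∀
        few : B * notFull ((a + 7) * r) r ≤ n
        few = *-cancelˡ-≤ r (≤-trans (≤-reflexive (swap r B _)) (≤-trans (*-monoʳ-≤ B r*notFull≤) 2Bt≤))
          where
          swap : ∀ r B x → r * (B * x) ≡ B * (r * x)
          swap = solve-∀

      failure≡ : ∀ m → failure m ≡ ℕtoℚ m ℚ.* miss r
      failure≡ zero    = sym (ℚ.*-zeroˡ (miss r))
      failure≡ (suc m) = trans (cong (ℚ._+ miss r) (failure≡ m)) (trans
        (solve 2 (λ x y → x :* y :+ y := (con 1ℚ :+ x) :* y) refl (ℕtoℚ m) (miss r)) (cong (ℚ._* miss r) (sym (ℕtoℚ-+ 1 m))))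
        where open +-*-Solver

      -- Markov's inequality in pointwise form: with few tests `small` and `miss≤` give the first
      -- summand; with many tests the trivial bound 1 on `E` is absorbed by the second, because rn <
      -- 2Bt.
      finish : (ℕtoℚ n ℚ.* (ℕtoℚ r ℚ.* p)) ℚ.* E p σ f ℚ.≤ ℕtoℚ n ℚ.* ℕtoℚ (suc ℓ) ℚ.+ ℕtoℚ (B * 2) ℚ.* (p ℚ.* ℕtoℚ t)
      finish with B * (2 * t) ≤? r * n
      ... | yes 2Bt≤ = begin
        (N ℚ.* (R ℚ.* p)) ℚ.* E p σ f
          ≤⟨ ℚ.*-monoˡ-≤-nonNeg (N ℚ.* (R ℚ.* p)) {{ℚ.nonNegative 0≤κ}} (ℚ.≤-trans (small 2Bt≤) (ℚ.≤-reflexive (failure≡ (suc ℓ)))) ⟩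
        (N ℚ.* (R ℚ.* p)) ℚ.* (ℕtoℚ (suc ℓ) ℚ.* miss r)
          ≡⟨ solve 5 (λ N R p ℓ m → (N :* (R :* p)) :* (ℓ :* m) := (N :* ℓ) :* ((R :* p) :* m)) refl N R p (ℕtoℚ (suc ℓ)) (miss r) ⟩
        (N ℚ.* ℕtoℚ (suc ℓ)) ℚ.* (R ℚ.* p ℚ.* miss r)
          ≤⟨ ℚ.*-monoˡ-≤-nonNeg (N ℚ.* ℕtoℚ (suc ℓ)) {{ℚ.nonNegative (*-nonNeg (0≤ℕtoℚ n) (0≤ℕtoℚ (suc ℓ)))}} (miss≤ r) ⟩
        (N ℚ.* ℕtoℚ (suc ℓ)) ℚ.* 1ℚ
          ≡⟨ solve 1 (λ x → x :* con 1ℚ := x :+ con 0ℚ) refl (N ℚ.* ℕtoℚ (suc ℓ)) ⟩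
        N ℚ.* ℕtoℚ (suc ℓ) ℚ.+ 0ℚ
          ≤⟨ ℚ.+-monoʳ-≤ (N ℚ.* ℕtoℚ (suc ℓ)) (*-nonNeg (0≤ℕtoℚ (B * 2)) (*-nonNeg 0≤p (0≤ℕtoℚ t))) ⟩
        N ℚ.* ℕtoℚ (suc ℓ) ℚ.+ ℕtoℚ (B * 2) ℚ.* (p ℚ.* ℕtoℚ t) ∎
        where
        open ℚ.≤-Reasoning
        open +-*-Solver
        N R : ℚ
        N = ℕtoℚ n
        R = ℕtoℚ r
        0≤κ : 0ℚ ℚ.≤ N ℚ.* (R ℚ.* p)
        0≤κ = *-nonNeg (0≤ℕtoℚ n) (*-nonNeg (0≤ℕtoℚ r) 0≤p)
      ... | no 2Bt≰ = begin
        (N ℚ.* (R ℚ.* p)) ℚ.* E p σ f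
          ≤⟨ ℚ.*-monoˡ-≤-nonNeg (N ℚ.* (R ℚ.* p)) {{ℚ.nonNegative 0≤κ}} (E≤1 σ f f≤1) ⟩
        (N ℚ.* (R ℚ.* p)) ℚ.* 1ℚ
          ≡⟨ solve 3 (λ N R p → (N :* (R :* p)) :* con 1ℚ := (R :* N) :* p) refl N R p ⟩
        (R ℚ.* N) ℚ.* p
          ≡⟨ cong (ℚ._* p) (sym (ℕtoℚ-* r n)) ⟩
        ℕtoℚ (r * n) ℚ.* p
          ≤⟨ ℚ.*-monoʳ-≤-nonNeg p {{ℚ.nonNegative 0≤p}} (ℕtoℚ-mono (<⇒≤ (≰⇒> 2Bt≰))) ⟩
        ℕtoℚ (B * (2 * t)) ℚ.* p
          ≡⟨ cong (ℚ._* p) (trans (cong ℕtoℚ (sym (*-assoc B 2 t))) (ℕtoℚ-* (B * 2) t)) ⟩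
        (ℕtoℚ (B * 2) ℚ.* ℕtoℚ t) ℚ.* p
          ≡⟨ solve 3 (λ b t p → (b :* t) :* p := con 0ℚ :+ b :* (p :* t)) refl (ℕtoℚ (B * 2)) (ℕtoℚ t) p ⟩
        0ℚ ℚ.+ ℕtoℚ (B * 2) ℚ.* (p ℚ.* ℕtoℚ t)
          ≤⟨ ℚ.+-monoˡ-≤ _ (*-nonNeg (0≤ℕtoℚ n) (0≤ℕtoℚ (suc ℓ))) ⟩
        N ℚ.* ℕtoℚ (suc ℓ) ℚ.+ ℕtoℚ (B * 2) ℚ.* (p ℚ.* ℕtoℚ t) ∎
        where
        open ℚ.≤-Reasoning
        open +-*-Solver
        N R : ℚ
        N = ℕtoℚ n
        R = ℕtoℚ r
        0≤κ : 0ℚ ℚ.≤ N ℚ.* (R ℚ.* p)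
        0≤κ = *-nonNeg (0≤ℕtoℚ n) (*-nonNeg (0≤ℕtoℚ r) 0≤p)

    σ∅ : Revealed (n * n)
    σ∅ = replicate (n * n) nothing

    -- Initially t = 0 and at most n vertices are unvisited, so n cancels and the right side keeps
    -- only `ℓ` and `B`.
    failure-bound : (ℕtoℚ r ℚ.* p) ℚ.* E p σ∅ f ℚ.≤ ℕtoℚ (suc ℓ + B * 2)
    failure-bound = ℚ.*-cancelˡ-≤-pos N {{ℚ.positive (ℚ.<-≤-trans (ℚ.positive⁻¹ 1ℚ) (ℕtoℚ-mono {1} {n} (≤-trans (s≤s z≤n) (Fin.toℕ<n v₀))))}} (begin
      N ℚ.* ((R ℚ.* p) ℚ.* E p σ∅ f)
        ≡⟨ ℚ.*-assoc N (R ℚ.* p) (E p σ∅ f) ⟨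
      (N ℚ.* (R ℚ.* p)) ℚ.* E p σ∅ f
        ≤⟨ explore p 0≤p p≤1 f (N ℚ.* (R ℚ.* p)) (N ℚ.* ℕtoℚ (suc ℓ)) (ℕtoℚ (B * 2)) (0≤ℕtoℚ (B * 2))
             finish (suc (State.measure s₀)) s₀ ≤-refl ⟩
      N ℚ.* ℕtoℚ (suc ℓ) ℚ.+ ℕtoℚ (B * 2) ℚ.* (p ℚ.* 0ℚ ℚ.+ ℕtoℚ (State.unvisited s₀))
        ≤⟨ ℚ.+-monoʳ-≤ (N ℚ.* ℕtoℚ (suc ℓ)) (ℚ.*-monoˡ-≤-nonNeg (ℕtoℚ (B * 2)) {{ℚ.nonNegative (0≤ℕtoℚ (B * 2))}}
             (ℚ.+-monoʳ-≤ (p ℚ.* 0ℚ) (ℕtoℚ-mono unvisited≤n))) ⟩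
      N ℚ.* ℕtoℚ (suc ℓ) ℚ.+ ℕtoℚ (B * 2) ℚ.* (p ℚ.* 0ℚ ℚ.+ N)
        ≡⟨ solve 4 (λ N ℓ b p → N :* ℓ :+ b :* (p :* con 0ℚ :+ N) := N :* (ℓ :+ b)) refl N (ℕtoℚ (suc ℓ)) (ℕtoℚ (B * 2)) p ⟩
      N ℚ.* (ℕtoℚ (suc ℓ) ℚ.+ ℕtoℚ (B * 2))
        ≡⟨ cong (N ℚ.*_) (sym (ℕtoℚ-+ (suc ℓ) (B * 2))) ⟩
      N ℚ.* ℕtoℚ (suc ℓ + B * 2) ∎)
      where
      open ℚ.≤-Reasoning
      open +-*-Solver
      N R : ℚ
      N = ℕtoℚ n
      R = ℕtoℚ r
      s₀ : State σ∅ 0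
      s₀ = initial σ∅ λ i → lookup-replicate i nothing
      unvisited≤n : State.unvisited s₀ ≤ n
      unvisited≤n = ≤-trans (sum-≤-const λ u → 𝟙≤1 (State.vis s₀ u Bool.≟ false)) (≤-reflexive (*-identityʳ n))

  -- Choice of the constants

  -- The denominator of `x` serves: the product is the numerator, a positive integer.
  archimedean : ∀ x → 0ℚ ℚ.< x → ∃ λ N → 1ℚ ℚ.≤ ℕtoℚ (suc N) ℚ.* x
  archimedean x@(mkℚ (ℤ.+ 0) d c) 0<x = contradiction (ℚ.positive 0<x) λ ()
  archimedean (mkℚ ℤ.-[1+ _ ] d c) 0<x = contradiction (ℚ.positive 0<x) λ ()
  archimedean x@(mkℚ (ℤ.+ suc a) d c) 0<x = d , ℚ.toℚᵘ-cancel-≤ (ℚᵘ.≤-respʳ-≃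
    (ℚᵘ.≃-sym (ℚᵘ.≃-trans (ℚ.toℚᵘ-homo-* (ℕtoℚ (suc d)) x)
      (ℚᵘ.*-congʳ {ℚ.toℚᵘ x} (ℚᵘ.≃-reflexive (cong ℚ.toℚᵘ (ℕtoℚ≡mkℚ (suc d)))))))
    (ℚᵘ.*≤* (ℤ.+≤+ (bound a d))))
    where
    bound : ∀ a d → 1 * suc (d + 0) ≤ suc d * suc a * 1
    bound a d = ≤-by (a * suc d) (z≤n {0}) (eq a d)
      where
      eq : ∀ a d → 1 * suc (d + 0) + 0 + a * suc d ≡ suc d * suc a * 1 + 0
      eq = solve-∀

  -- a = 32 (c + 1) makes ℓ = a² − 13 larger than (1 − 1/(2c+2)) (a + 7)².
  choose-a : ∀ c → ∃ λ a → ∃ λ ℓ → 3 ≤ ℓ × ℓ + 13 ≤ suc a * suc a ×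
    (2 * c + 1) * ((suc a + 7) * (suc a + 7)) ≤ 2 * suc c * ℓ
  choose-a c = 31 + 32 * c , 1011 + 2048 * c + 1024 * (c * c) , m≤m+n 3 _ ,
    ≤-by 0 (z≤n {0}) (eq₁ c) , ≤-by (501 + 580 * c + 128 * (c * c)) (z≤n {0}) (eq₂ c)
    where
    eq₁ : ∀ c → 1011 + 2048 * c + 1024 * (c * c) + 13 + 0 + 0 ≡ suc (31 + 32 * c) * suc (31 + 32 * c) + 0
    eq₁ = solve-∀
    eq₂ : ∀ c → (2 * c + 1) * ((suc (31 + 32 * c) + 7) * (suc (31 + 32 * c) + 7)) + 0 + (501 + 580 * c + 128 * (c * c))
      ≡ 2 * suc c * (1011 + 2048 * c + 1024 * (c * c)) + 0
    eq₂ = solve-∀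

  square-ratio : ∀ c r → 5 * suc c ≤ r → 2 * c * (suc r * suc r) ≤ (2 * c + 1) * (r * r)
  square-ratio c r 5N≤r with (e , refl) ← m≤n⇒∃[o]m+o≡n 5N≤r =
    ≤-by (5 * (c * c) + 28 * c + 25 + 6 * (c * e) + 10 * e + e * e) (z≤n {0}) (eq c e)
    where
    eq : ∀ c e → 2 * c * (suc (5 * suc c + e) * suc (5 * suc c + e)) + 0 + (5 * (c * c) + 28 * c + 25 + 6 * (c * e) + 10 * e + e * e)
      ≡ (2 * c + 1) * ((5 * suc c + e) * (5 * suc c + e)) + 0
    eq = solve-∀

  -- The factor c/(c + 1) is split as 2c/(2c + 1) times (2c + 1)/(2c + 2). The first pays for
  -- replacing r + 1 by r, the second for replacing Q² by ℓ.
  length-ratio : ∀ c Q ℓ r k → 5 * suc c ≤ r → (2 * c + 1) * (Q * Q) ≤ 2 * suc c * ℓ → k ≤ Q * suc r →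
    c * (k * k) ≤ suc c * (ℓ * (r * r))
  length-ratio c Q ℓ r k 5N≤r Q-ratio k≤ = *-cancelˡ-≤ 2 (begin
    2 * (c * (k * k))                      ≤⟨ *-monoʳ-≤ 2 (*-monoʳ-≤ c (*-mono-≤ k≤ k≤)) ⟩
    2 * (c * (Q * suc r * (Q * suc r)))    ≡⟨ eq₁ c Q (suc r) ⟩
    Q * Q * (2 * c * (suc r * suc r))      ≤⟨ *-monoʳ-≤ (Q * Q) (square-ratio c r 5N≤r) ⟩
    Q * Q * ((2 * c + 1) * (r * r))        ≡⟨ eq₂ c Q (r * r) ⟩
    (2 * c + 1) * (Q * Q) * (r * r)        ≤⟨ *-monoˡ-≤ (r * r) Q-ratio ⟩
    2 * suc c * ℓ * (r * r)                ≡⟨ eq₃ c ℓ (r * r) ⟩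
    2 * (suc c * (ℓ * (r * r)))            ∎)
    where
    open ≤-Reasoning
    eq₁ : ∀ c Q s → 2 * (c * (Q * s * (Q * s))) ≡ Q * Q * (2 * c * (s * s))
    eq₁ = solve-∀
    eq₂ : ∀ c Q q → Q * Q * ((2 * c + 1) * q) ≡ (2 * c + 1) * (Q * Q) * q
    eq₂ = solve-∀
    eq₃ : ∀ c ℓ q → 2 * suc c * ℓ * q ≡ 2 * (suc c * (ℓ * q))
    eq₃ = solve-∀

  1≤⇒0< : ∀ {x} → 1ℚ ℚ.≤ x → 0ℚ ℚ.< x
  1≤⇒0< = ℚ.<-≤-trans (ℚ.positive⁻¹ 1ℚ)

  ℕtoℚ-positive : ∀ m → ℚ.Positive (ℕtoℚ (suc m))
  ℕtoℚ-positive m = ℚ.positive (1≤⇒0< (ℕtoℚ-mono {1} {suc m} (s≤s z≤n)))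

  -- From 1/(c + 1) ≤ η it follows that 1 - η ≤ c/(c + 1).
  cycle-target : ∀ η c k L → 1ℚ ℚ.≤ ℕtoℚ (suc c) ℚ.* η → c * (k * k) ≤ suc c * L →
    (1ℚ ℚ.- η) ℚ.* (ℕtoℚ k ℚ.* ℕtoℚ k) ℚ.≤ ℕtoℚ L
  cycle-target η c k L 1≤Nη ratio = ℚ.*-cancelˡ-≤-pos N {{ℕtoℚ-positive c}} (begin
    N ℚ.* ((1ℚ ℚ.- η) ℚ.* kk)             ≡⟨ solve 3 (λ N η k → N :* ((con 1ℚ :- η) :* k) := (N :- N :* η) :* k) refl N η kk ⟩
    (N ℚ.- N ℚ.* η) ℚ.* kk                ≤⟨ ℚ.*-monoʳ-≤-nonNeg kk {{ℚ.nonNegative (*-nonNeg (0≤ℕtoℚ k) (0≤ℕtoℚ k))}}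
                                               (ℚ.+-monoʳ-≤ N (ℚ.neg-antimono-≤ 1≤Nη)) ⟩
    (N ℚ.- 1ℚ) ℚ.* kk                     ≡⟨ cong (λ z → (z ℚ.- 1ℚ) ℚ.* kk) (ℕtoℚ-+ 1 c) ⟩
    (1ℚ ℚ.+ ℕtoℚ c ℚ.- 1ℚ) ℚ.* kk         ≡⟨ solve 2 (λ c k → (con 1ℚ :+ c :- con 1ℚ) :* k := c :* k) refl (ℕtoℚ c) kk ⟩
    ℕtoℚ c ℚ.* kk                         ≡⟨ trans (ℕtoℚ-* c (k * k)) (cong (ℕtoℚ c ℚ.*_) (ℕtoℚ-* k k)) ⟨
    ℕtoℚ (c * (k * k))                    ≤⟨ ℕtoℚ-mono ratio ⟩
    ℕtoℚ (suc c * L)                      ≡⟨ ℕtoℚ-* (suc c) L ⟩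
    N ℚ.* ℕtoℚ L                          ∎)
    where
    open ℚ.≤-Reasoning
    open +-*-Solver
    N kk : ℚ
    N  = ℕtoℚ (suc c)
    kk = ℕtoℚ k ℚ.* ℕtoℚ k

  -- pk ≥ (Q + 1)(W + 1)(d + 1) and k ≤ (Q + 1)r make rp at least (W + 1)(d + 1), so x is at most
  -- 1/(d + 1). The successors provide positivity for the cancellations.
  small-failure : ∀ ε p d r k W Q x → 0ℚ ℚ.≤ p → 1ℚ ℚ.≤ ℕtoℚ (suc d) ℚ.* ε → k ≤ suc Q * r →
    ℕtoℚ (suc Q * (suc W * suc d)) ℚ.≤ p ℚ.* ℕtoℚ k → (ℕtoℚ r ℚ.* p) ℚ.* x ℚ.≤ ℕtoℚ (suc W) → x ℚ.≤ ε
  small-failure ε p d r k W Q x 0≤p 1≤Dε k≤ large bound =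
    ℚ.*-cancelˡ-≤-pos rp {{ℚ.positive (1≤⇒0< (ℚ.≤-trans (ℕtoℚ-mono {1} {suc W * suc d} (s≤s z≤n)) WD≤))}} (begin
      rp ℚ.* x                                       ≤⟨ bound ⟩
      ℕtoℚ (suc W)                                   ≡⟨ ℚ.*-identityʳ (ℕtoℚ (suc W)) ⟨
      ℕtoℚ (suc W) ℚ.* 1ℚ                            ≤⟨ ℚ.*-monoˡ-≤-nonNeg (ℕtoℚ (suc W)) {{ℚ.nonNegative (0≤ℕtoℚ (suc W))}} 1≤Dε ⟩
      ℕtoℚ (suc W) ℚ.* (ℕtoℚ (suc d) ℚ.* ε)          ≡⟨ ℚ.*-assoc (ℕtoℚ (suc W)) (ℕtoℚ (suc d)) ε ⟨
      ℕtoℚ (suc W) ℚ.* ℕtoℚ (suc d) ℚ.* ε            ≡⟨ cong (ℚ._* ε) (ℕtoℚ-* (suc W) (suc d)) ⟨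
      ℕtoℚ (suc W * suc d) ℚ.* ε                     ≤⟨ ℚ.*-monoʳ-≤-nonNeg ε {{ℚ.nonNegative 0≤ε}} WD≤ ⟩
      rp ℚ.* ε                                       ∎)
    where
    open ℚ.≤-Reasoning
    open +-*-Solver
    rp : ℚ
    rp = ℕtoℚ r ℚ.* p
    0≤ε : 0ℚ ℚ.≤ ε
    0≤ε = ℚ.*-cancelˡ-≤-pos (ℕtoℚ (suc d)) {{ℕtoℚ-positive d}}
      (ℚ.≤-trans (ℚ.≤-reflexive (ℚ.*-zeroʳ (ℕtoℚ (suc d)))) (ℚ.≤-trans (ℚ.nonNegative⁻¹ 1ℚ) 1≤Dε))
    WD≤ : ℕtoℚ (suc W * suc d) ℚ.≤ rp
    WD≤ = ℚ.*-cancelˡ-≤-pos (ℕtoℚ (suc Q)) {{ℕtoℚ-positive Q}} (begin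
      ℕtoℚ (suc Q) ℚ.* ℕtoℚ (suc W * suc d)          ≡⟨ ℕtoℚ-* (suc Q) (suc W * suc d) ⟨
      ℕtoℚ (suc Q * (suc W * suc d))                 ≤⟨ large ⟩
      p ℚ.* ℕtoℚ k                                   ≤⟨ ℚ.*-monoˡ-≤-nonNeg p {{ℚ.nonNegative 0≤p}} (ℕtoℚ-mono k≤) ⟩
      p ℚ.* ℕtoℚ (suc Q * r)                         ≡⟨ cong (p ℚ.*_) (ℕtoℚ-* (suc Q) r) ⟩
      p ℚ.* (ℕtoℚ (suc Q) ℚ.* ℕtoℚ r)                ≡⟨ solve 3 (λ p q r → p :* (q :* r) := q :* (r :* p)) refl p (ℕtoℚ (suc Q)) (ℕtoℚ r) ⟩
      ℕtoℚ (suc Q) ℚ.* rp                            ∎)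

  -- Assembling the threshold for k

  module Threshold (p : ℕ → ℚ) (bounds : ∀ k → 0ℚ ℚ.≤ p k × p k ℚ.≤ 1ℚ)
    (large : ∀ (M : ℚ) → ∃ λ K → ∀ k → K ≤ k → M ℚ.≤ p k ℚ.* ℕtoℚ k)
    (η ε : ℚ) (c d : ℕ) (1≤Nη : 1ℚ ℚ.≤ ℕtoℚ (suc c) ℚ.* η) (1≤Dε : 1ℚ ℚ.≤ ℕtoℚ (suc d) ℚ.* ε)
    (a-1 ℓ B-1 : ℕ) (3≤ℓ : 3 ≤ ℓ) (ℓ≤ : ℓ + 13 ≤ suc a-1 * suc a-1)
    (Q-ratio : (2 * c + 1) * ((suc a-1 + 7) * (suc a-1 + 7)) ≤ 2 * suc c * ℓ)
    (B-large : (2 * ℓ + 4) * (1 + (ℓ + 5) * ((2 * ℓ + 4) * (suc a-1 + 9))) ≤ suc B-1) where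

    a B Q R W K : ℕ
    a = suc a-1
    B = suc B-1
    Q = a + 7
    -- The first summand is the lower bound on r required by the counting, the second the one
    -- required by `square-ratio`; k ≥ RQ gives r ≥ R.
    R = 2 * (a * a * B) * B + 5 * suc c
    W = ℓ + B * 2
    K = proj₁ (large (ℕtoℚ (suc (pred (2 * Q)) * (suc W * suc d)))) + R * Q


    module _ (k : ℕ) (K≤k : K ≤ k) where

      r : ℕ
      r = k / Q

      R≤r : R ≤ r
      R≤r = ≤-trans (≤-reflexive (sym (m*n/n≡m R Q))) (/-mono-≤ {o = Q} {p = Q} (≤-trans (m≤n+m (R * Q) _) K≤k) ≤-refl)

      instance
        r≢0 : NonZero r
        r≢0 = >-nonZero (≤-trans (s≤s z≤n) (≤-trans (m≤n+m (5 * suc c) (2 * (a * a * B) * B)) R≤r))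

      B²≤r : 2 * (a * a * B) * B ≤ r
      B²≤r = ≤-trans (m≤m+n (2 * (a * a * B) * B) (5 * suc c)) R≤r

      5N≤r : 5 * suc c ≤ r
      5N≤r = ≤-trans (m≤n+m (5 * suc c) (2 * (a * a * B) * B)) R≤r

      Qr≤k : Q * r ≤ k
      Qr≤k = ≤-trans (≤-reflexive (*-comm Q r)) (m/n*n≤m k Q)

      k≤Q[1+r] : k ≤ Q * suc r
      k≤Q[1+r] = begin
        k                   ≡⟨ m≡m%n+[m/n]*n k Q ⟩
        k % Q + r * Q       ≤⟨ +-monoˡ-≤ (r * Q) (<⇒≤ (m%n<n k Q)) ⟩
        suc r * Q           ≡⟨ *-comm (suc r) Q ⟩
        Q * suc r           ∎
        where open ≤-Reasoning

      -- Turns the growth of pk into growth of pr. The left factor reduces to `2 * Q` and has the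
      -- successor form that `small-failure` expects.
      k≤2Qr : k ≤ suc (pred (2 * Q)) * r
      k≤2Qr = begin
        k                   ≤⟨ k≤Q[1+r] ⟩
        Q * suc r           ≤⟨ *-monoʳ-≤ Q (+-monoˡ-≤ r (>-nonZero⁻¹ r)) ⟩
        Q * (r + r)         ≡⟨ eq Q r ⟩
        2 * Q * r           ∎
        where
        open ≤-Reasoning
        eq : ∀ Q r → Q * (r + r) ≡ 2 * Q * r
        eq = solve-∀

      conclusion : ∀ n (G : Graph n) → C4Free G → MinDegree G k →
        (dec : Decidable (λ (c : Coins n) → HasCycleAtLeast (subgraph G c) ((1ℚ ℚ.- η) ℚ.* (ℕtoℚ k ℚ.* ℕtoℚ k)))) →
        1ℚ ℚ.- ε ℚ.≤ Pr (p k) dec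
      conclusion n G c4 (k≤deg , v₀ , _) dec = ℚ.≤-trans
        (ℚ.+-monoʳ-≤ 1ℚ (ℚ.neg-antimono-≤ (small-failure ε (p k) d r k W (pred (2 * Q)) (E (p k) σ∅ f)
          (proj₁ (bounds k)) 1≤Dε k≤2Qr (proj₂ (large _) k (≤-trans (m≤m+n _ (R * Q)) K≤k)) failure-bound)))
        (ℚ.≤-reflexive (sym (Pr≡1-failure (p k) dec)))
        where
        open Terminal G c4 v₀ (p k) (proj₁ (bounds k)) (proj₂ (bounds k)) ((1ℚ ℚ.- η) ℚ.* (ℕtoℚ k ℚ.* ℕtoℚ k)) dec a ℓ r B
          3≤ℓ ℓ≤ B-large B²≤r (λ v → ≤-trans Qr≤k (k≤deg v))
          (cycle-target η c k (ℓ * (r * r)) 1≤Nη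
            (length-ratio c Q ℓ r k 5N≤r Q-ratio k≤Q[1+r]))

open import Defs
open import Data.Nat using (ℕ)
open import Data.Rational using (ℚ; 0ℚ; 1ℚ; _*_; _-_; _≤_; _<_)
open import Data.Nat.Properties using (n≤1+n)
open import Data.Product using (∃; _×_; _,_)
open import Relation.Unary using (Decidable)

theorem1p8 : (p : ℕ → ℚ) → (∀ k → 0ℚ ≤ p k × p k ≤ 1ℚ) →
  (∀ (M : ℚ) → ∃ λ K → ∀ k → K Data.Nat.≤ k → M ≤ p k * ℕtoℚ k) →
  (η ε : ℚ) → 0ℚ < η → 0ℚ < ε →
  ∃ λ K → ∀ k → K Data.Nat.≤ k →
    ∀ n (G : Graph n) → C4Free G → MinDegree G k →
    (dec : Decidable (λ (c : Coins n) →
              HasCycleAtLeast (subgraph G c) ((1ℚ - η) * (ℕtoℚ k * ℕtoℚ k)))) →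
    1ℚ - ε ≤ Pr (p k) dec
theorem1p8 p bounds large η ε 0<η 0<ε =
  let (c , 1≤Nη) = LongCycles.archimedean η 0<η
      (d , 1≤Dε) = LongCycles.archimedean ε 0<ε
      (a-1 , ℓ , 3≤ℓ , ℓ≤ , Q-ratio) = LongCycles.choose-a c
      -- `B` is taken to be one more than its required lower bound, which also makes it nonzero.
      module T = LongCycles.Threshold p bounds large η ε c d 1≤Nη 1≤Dε a-1 ℓ _ 3≤ℓ ℓ≤ Q-ratio (n≤1+n _)
  in T.K , T.conclusion
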